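{- Let $G$ be a balanced bipartite graph of order $2n$. If $q(\widehat{G})\leq n$, then $G$ is Hamiltonian unless $G\in\bigcup_{k=1}^{\lfloor n/2\rfloor}\mathcal{B}_n^k$, or $G=\varGamma_1$ or $\varGamma_2$ for $n=4$.
   Context: All graphs are finite and simple; equality of graphs and membership in classes of graphs are up to isomorphism. $q(G)$ is the signless Laplacian spectral radius, i.e. the largest eigenvalue of $A+D$, where $A$ is the adjacency matrix and $D$ the diagonal degree matrix of $G$. A graph is Hamiltonian if it contains a cycle through all its vertices. A bipartite graph with partite sets $X,Y$ is balanced if $|X|=|Y|$. The quasi-complement $\widehat{G}$ of a bipartite graph $G$ with partite sets $X,Y$ is the graph on the same vertex set (bipartite with the same partite sets) in which, for $x\in X$, $y\in Y$, $xy\in E(\widehat{G})$ if and only if $xy\notin E(G)$. For $1\leq k\leq n/2$, $\mathcal{B}_n^k$ is the set of balanced bipartite graphs of order $2n$ obtained from some bipartite graph $H$ with partite sets $X_0,Y_0$ of sizes $k$ and $n-k$, respectively, by adding $k$ additional vertices, each adjacent exactly to all vertices of $X_0$, and $n-k$ additional vertices, each adjacent exactly to all vertices of $Y_0$. $\varGamma_1$ is the bipartite graph with partite sets $\{t_1,t_2,t_3,t_4\}$ and $\{b_1,b_2,b_3,b_4\}$ and edge set $\{t_ib_i,\ t_1b_i,\ t_ib_1 : i=2,3,4\}$. $\varGamma_2$ is $\varGamma_1$ with the additional edge $t_1b_1$.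
   Formalization: The formal theorem assumes n ≥ 2: for n = 1 the claim fails for G = K₂, whose quasi-complement has q = 0 ≤ 1 while K₂ has no cycle and the union over k is empty; for n = 0 there is no eigenvalue. -}

module Defs where

open import Algebra.Bundles.Raw using (RawMonoid)
import Algebra.Definitions.RawMonoid as RawMonoidDefs
open import Data.Bool.Base using (Bool; true; false; not; if_then_else_)
open import Data.Fin.Base using (Fin; zero; suc; fromℕ; inject₁; splitAt)
open import Data.Fin.Properties using () renaming (_≟_ to _≟F_)
import Data.Integer.Base as ℤ
open import Data.Nat.Base as ℕ using (ℕ; zero; suc; _⊔_)
import Data.Nat.Properties as ℕₚ
open import Data.Product.Base using (Σ-syntax; ∃-syntax; _×_; _,_)
open import Data.Rational.Base as ℚ
  using (ℚ; 0ℚ; 1ℚ; ½; _+_; _*_; _-_; -_; ∣_∣; _<_; _≤_; 1/_; Positive)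
import Data.Rational.Properties as ℚₚ
open import Data.Rational.Solver using (module +-*-Solver)
open import Data.Sum.Base using (_⊎_; inj₁; inj₂)
open import Function.Bundles using (_↔_; Inverse)
open import Level using (0ℓ)
open import Relation.Binary.PropositionalEquality
open import Relation.Nullary using (¬_)
open import Relation.Nullary.Decidable using (⌊_⌋)

------------------------------------------------------------------------
-- Real numbers, as Cauchy sequences of rationals under the setoid
-- equality _≈ℝ_ (difference tends to 0).  Operations are pointwise.

IsCauchy : (ℕ → ℚ) → Set
IsCauchy f = ∀ ε → 0ℚ < ε →
  ∃[ N ] ∀ m n → N ℕ.≤ m → N ℕ.≤ n → ∣ f m - f n ∣ < ε

record ℝ : Set where
  constructor mkℝ
  field
    seq    : ℕ → ℚ
    cauchy : IsCauchy seq

open ℝ public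

infix 4 _≈ℝ_ _≤ℝ_

_≈ℝ_ : ℝ → ℝ → Set
x ≈ℝ y = ∀ ε → 0ℚ < ε → ∃[ N ] ∀ n → N ℕ.≤ n → ∣ seq x n - seq y n ∣ < ε

_≤ℝ_ : ℝ → ℝ → Set
x ≤ℝ y = ∀ ε → 0ℚ < ε → ∃[ N ] ∀ n → N ℕ.≤ n → seq x n ≤ seq y n + ε

fromℚ : ℚ → ℝ
fromℚ p = mkℝ (λ _ → p) λ ε 0<ε → 0 , λ _ _ _ _ →
  subst (λ r → ∣ r ∣ < ε) (sym (ℚₚ.+-inverseʳ p)) 0<ε

fromℕℝ : ℕ → ℝ
fromℕℝ n = fromℚ (ℤ.+ n ℚ./ 1)

0ℝ : ℝ
0ℝ = fromℕℝ 0

0<½* : ∀ {ε} → 0ℚ < ε → 0ℚ < ½ * ε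
0<½* {ε} 0<ε =
  subst (_< ½ * ε) (ℚₚ.*-zeroʳ ½) (ℚₚ.*-monoʳ-<-pos ½ 0<ε)

½*+½* : ∀ ε → ½ * ε + ½ * ε ≡ ε
½*+½* ε = trans (sym (ℚₚ.*-distribʳ-+ ε ½ ½)) (ℚₚ.*-identityˡ ε)

+-cauchy : ∀ f g → IsCauchy f → IsCauchy g → IsCauchy (λ n → f n + g n)
+-cauchy f g cf cg ε 0<ε =
  let M , hM = cf (½ * ε) (0<½* 0<ε)
      N , hN = cg (½ * ε) (0<½* 0<ε)
  in M ⊔ N , λ m n m≥ n≥ → begin-strict
    ∣ (f m + g m) - (f n + g n) ∣
      ≡⟨ cong ∣_∣ (solve 4 (λ a b c d →
           (a :+ b) :- (c :+ d) := (a :- c) :+ (b :- d)) refl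
           (f m) (g m) (f n) (g n)) ⟩
    ∣ (f m - f n) + (g m - g n) ∣
      ≤⟨ ℚₚ.∣p+q∣≤∣p∣+∣q∣ (f m - f n) (g m - g n) ⟩
    ∣ f m - f n ∣ + ∣ g m - g n ∣
      <⟨ ℚₚ.+-mono-<
           (hM m n (ℕₚ.m⊔n≤o⇒m≤o M N m≥) (ℕₚ.m⊔n≤o⇒m≤o M N n≥))
           (hN m n (ℕₚ.m⊔n≤o⇒n≤o M N m≥) (ℕₚ.m⊔n≤o⇒n≤o M N n≥)) ⟩
    ½ * ε + ½ * ε
      ≡⟨ ½*+½* ε ⟩
    ε ∎
  where
  open ℚₚ.≤-Reasoning
  open +-*-Solver

bounded : ∀ f → IsCauchy f →
  Σ[ B ∈ ℚ ] Positive B × (∃[ N ] ∀ n → N ℕ.≤ n → ∣ f n ∣ ≤ B)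
bounded f cf =
  let N , hN = cf 1ℚ (ℚₚ.positive⁻¹ 1ℚ)
  in ∣ f N ∣ + 1ℚ
   , ℚₚ.nonNeg+pos⇒pos ∣ f N ∣ {{ℚₚ.∣-∣-nonNeg (f N)}} 1ℚ
   , N , λ n n≥ → begin
    ∣ f n ∣
      ≡⟨ cong ∣_∣ (solve 2 (λ a b → a := b :+ (a :- b)) refl (f n) (f N)) ⟩
    ∣ f N + (f n - f N) ∣
      ≤⟨ ℚₚ.∣p+q∣≤∣p∣+∣q∣ (f N) (f n - f N) ⟩
    ∣ f N ∣ + ∣ f n - f N ∣
      ≤⟨ ℚₚ.+-monoʳ-≤ ∣ f N ∣ (ℚₚ.<⇒≤ (hN n N n≥ ℕₚ.≤-refl)) ⟩
    ∣ f N ∣ + 1ℚ ∎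
  where
  open ℚₚ.≤-Reasoning
  open +-*-Solver

module Scale (B ε : ℚ) (B>0 : Positive B) (0<ε : 0ℚ < ε) where
  instance
    _ = B>0
    _ = ℚₚ.pos⇒nonZero B
    _ = ℚₚ.pos⇒nonNeg B

  δ : ℚ
  δ = 1/ B * (½ * ε)

  0<δ : 0ℚ < δ
  0<δ = subst (_< δ) (ℚₚ.*-zeroʳ (1/ B))
          (ℚₚ.*-monoʳ-<-pos (1/ B) {{ℚₚ.1/pos⇒pos B}} (0<½* 0<ε))

  scale : ∀ {a d} → ∣ a ∣ ≤ B → ∣ d ∣ < δ → ∣ a * d ∣ < ½ * ε
  scale {a} {d} a≤B d<δ = begin-strict
    ∣ a * d ∣                ≡⟨ ℚₚ.∣p*q∣≡∣p∣*∣q∣ a d ⟩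
    ∣ a ∣ * ∣ d ∣            ≤⟨ ℚₚ.*-monoʳ-≤-nonNeg ∣ d ∣ {{ℚₚ.∣-∣-nonNeg d}} a≤B ⟩
    B * ∣ d ∣                <⟨ ℚₚ.*-monoʳ-<-pos B d<δ ⟩
    B * (1/ B * (½ * ε))     ≡⟨ ℚₚ.*-assoc B (1/ B) (½ * ε) ⟨
    B * 1/ B * (½ * ε)       ≡⟨ cong (_* (½ * ε)) (ℚₚ.*-inverseʳ B) ⟩
    1ℚ * (½ * ε)             ≡⟨ ℚₚ.*-identityˡ (½ * ε) ⟩
    ½ * ε                    ∎
    where open ℚₚ.≤-Reasoning

*-cauchy : ∀ f g → IsCauchy f → IsCauchy g → IsCauchy (λ n → f n * g n)
*-cauchy f g cf cg ε 0<ε =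
  let A , A>0 , Nf , hA = bounded f cf
      B , B>0 , Ng , hB = bounded g cg
      module SA = Scale A ε A>0 0<ε
      module SB = Scale B ε B>0 0<ε
      M , hM = cf SB.δ SB.0<δ
      N , hN = cg SA.δ SA.0<δ
  in (Nf ⊔ Ng) ⊔ (M ⊔ N) , λ m n m≥ n≥ →
    let m≥M⊔N = ℕₚ.m⊔n≤o⇒n≤o (Nf ⊔ Ng) (M ⊔ N) m≥
        n≥M⊔N = ℕₚ.m⊔n≤o⇒n≤o (Nf ⊔ Ng) (M ⊔ N) n≥
        m≥Nf  = ℕₚ.m⊔n≤o⇒m≤o Nf Ng (ℕₚ.m⊔n≤o⇒m≤o (Nf ⊔ Ng) (M ⊔ N) m≥)
        n≥Ng  = ℕₚ.m⊔n≤o⇒n≤o Nf Ng (ℕₚ.m⊔n≤o⇒m≤o (Nf ⊔ Ng) (M ⊔ N) n≥)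
    in begin-strict
    ∣ f m * g m - f n * g n ∣
      ≡⟨ cong ∣_∣ (solve 4 (λ a b c d →
           a :* b :- c :* d := a :* (b :- d) :+ d :* (a :- c)) refl
           (f m) (g m) (f n) (g n)) ⟩
    ∣ f m * (g m - g n) + g n * (f m - f n) ∣
      ≤⟨ ℚₚ.∣p+q∣≤∣p∣+∣q∣ (f m * (g m - g n)) (g n * (f m - f n)) ⟩
    ∣ f m * (g m - g n) ∣ + ∣ g n * (f m - f n) ∣
      <⟨ ℚₚ.+-mono-<
           (SA.scale {f m} {g m - g n} (hA m m≥Nf)
             (hN m n (ℕₚ.m⊔n≤o⇒n≤o M N m≥M⊔N) (ℕₚ.m⊔n≤o⇒n≤o M N n≥M⊔N)))
           (SB.scale {g n} {f m - f n} (hB n n≥Ng)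
             (hM m n (ℕₚ.m⊔n≤o⇒m≤o M N m≥M⊔N) (ℕₚ.m⊔n≤o⇒m≤o M N n≥M⊔N))) ⟩
    ½ * ε + ½ * ε
      ≡⟨ ½*+½* ε ⟩
    ε ∎
  where
  open ℚₚ.≤-Reasoning
  open +-*-Solver

infixl 6 _+ℝ_
infixl 7 _*ℝ_

_+ℝ_ : ℝ → ℝ → ℝ
x +ℝ y = mkℝ (λ n → seq x n + seq y n) (+-cauchy (seq x) (seq y) (cauchy x) (cauchy y))

_*ℝ_ : ℝ → ℝ → ℝ
x *ℝ y = mkℝ (λ n → seq x n * seq y n) (*-cauchy (seq x) (seq y) (cauchy x) (cauchy y))

+-0-rawMonoidℝ : RawMonoid 0ℓ 0ℓ
+-0-rawMonoidℝ = record
  { Carrier = ℝ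
  ; _≈_     = _≈ℝ_
  ; _∙_     = _+ℝ_
  ; ε       = 0ℝ
  }

open RawMonoidDefs +-0-rawMonoidℝ public using () renaming (sum to sumℝ)
open RawMonoidDefs ℕ.+-0-rawMonoid public using () renaming (sum to sumℕ)

------------------------------------------------------------------------
-- Eigenvalues.  Only real eigenvalues are considered; the matrices
-- below are symmetric, so these are all of their eigenvalues.

Matrix : ℕ → Set
Matrix N = Fin N → Fin N → ℝ

IsEigenvalue : ∀ {N} → Matrix N → ℝ → Set
IsEigenvalue {N} M μ = Σ[ v ∈ (Fin N → ℝ) ]
  (¬ (∀ i → v i ≈ℝ 0ℝ)) ×
  (∀ i → sumℝ (λ j → M i j *ℝ v j) ≈ℝ μ *ℝ v i)

IsLargestEigenvalue : ∀ {N} → Matrix N → ℝ → Set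
IsLargestEigenvalue M μ =
  IsEigenvalue M μ × (∀ ν → IsEigenvalue M ν → ν ≤ℝ μ)

------------------------------------------------------------------------
-- Finite simple graphs of order N

record Graph (N : ℕ) : Set where
  field
    adj       : Fin N → Fin N → Bool
    symmetric : ∀ u v → adj u v ≡ adj v u
    loopless  : ∀ v → adj v v ≡ false

open Graph public

infix 4 _≅_

_≅_ : ∀ {M N} → Graph M → Graph N → Set
_≅_ {M} {N} G H = Σ[ φ ∈ Fin M ↔ Fin N ]
  ∀ u v → adj G u v ≡ adj H (Inverse.to φ u) (Inverse.to φ v)

adjacencyEntry : ∀ {N} → Graph N → Fin N → Fin N → ℕ
adjacencyEntry G u v = if adj G u v then 1 else 0

degree : ∀ {N} → Graph N → Fin N → ℕ
degree G u = sumℕ (adjacencyEntry G u)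

degreeEntry : ∀ {N} → Graph N → Fin N → Fin N → ℕ
degreeEntry G u v = if ⌊ u ≟F v ⌋ then degree G u else 0

signlessLaplacian : ∀ {N} → Graph N → Matrix N
signlessLaplacian G u v =
  fromℕℝ (adjacencyEntry G u v ℕ.+ degreeEntry G u v)

-- q is the signless Laplacian spectral radius q(G), presented through
-- its defining property (which determines q up to _≈ℝ_).
IsSignlessSpectralRadius : ∀ {N} → Graph N → ℝ → Set
IsSignlessSpectralRadius G q = IsLargestEigenvalue (signlessLaplacian G) q

-- A cycle with ℓ + 1 ≥ 3 distinct vertices.
record Cycle {N : ℕ} (G : Graph N) : Set where
  field
    ℓ        : ℕ
    long     : 3 ℕ.≤ suc ℓ
    vertex   : Fin (suc ℓ) → Fin N
    distinct : ∀ i j → vertex i ≡ vertex j → i ≡ j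
    step     : ∀ (i : Fin ℓ) → adj G (vertex (inject₁ i)) (vertex (suc i)) ≡ true
    close    : adj G (vertex (fromℕ ℓ)) (vertex zero) ≡ true

Hamiltonian : ∀ {N} → Graph N → Set
Hamiltonian G = Σ[ C ∈ Cycle G ] ∀ v → ∃[ i ] Cycle.vertex C i ≡ v

------------------------------------------------------------------------
-- Bipartite graphs with designated partite sets X = Fin a, Y = Fin b.
-- Such a graph is balanced of order 2n exactly when a = b = n.

record BipartiteGraph (a b : ℕ) : Set where
  constructor mkBipartite
  field
    edge : Fin a → Fin b → Bool

open BipartiteGraph public

bipAdj : ∀ {a b} → BipartiteGraph a b → (u v : Fin a ⊎ Fin b) → Bool
bipAdj B (inj₁ x) (inj₁ _) = false
bipAdj B (inj₁ x) (inj₂ y) = edge B x y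
bipAdj B (inj₂ y) (inj₁ x) = edge B x y
bipAdj B (inj₂ _) (inj₂ _) = false

bipAdj-sym : ∀ {a b} (B : BipartiteGraph a b) u v → bipAdj B u v ≡ bipAdj B v u
bipAdj-sym B (inj₁ _) (inj₁ _) = refl
bipAdj-sym B (inj₁ _) (inj₂ _) = refl
bipAdj-sym B (inj₂ _) (inj₁ _) = refl
bipAdj-sym B (inj₂ _) (inj₂ _) = refl

bipAdj-irrefl : ∀ {a b} (B : BipartiteGraph a b) v → bipAdj B v v ≡ false
bipAdj-irrefl B (inj₁ _) = refl
bipAdj-irrefl B (inj₂ _) = refl

-- The underlying graph; the first a vertices form X, the last b form Y.
toGraph : ∀ {a b} → BipartiteGraph a b → Graph (a ℕ.+ b)
toGraph {a} B = record
  { adj       = λ u v → bipAdj B (splitAt a u) (splitAt a v)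
  ; symmetric = λ u v → bipAdj-sym B (splitAt a u) (splitAt a v)
  ; loopless  = λ v → bipAdj-irrefl B (splitAt a v)
  }

quasiComplement : ∀ {a b} → BipartiteGraph a b → BipartiteGraph a b
quasiComplement B = mkBipartite λ x y → not (edge B x y)

attachEdge : ∀ {a b} → BipartiteGraph a b → Fin a ⊎ Fin b → Fin b ⊎ Fin a → Bool
attachEdge H (inj₁ x₀) (inj₁ y₀) = edge H x₀ y₀
attachEdge H (inj₁ x₀) (inj₂ _)  = true
attachEdge H (inj₂ _)  (inj₁ y₀) = true
attachEdge H (inj₂ _)  (inj₂ _)  = false

-- From H with partite sets X₀, Y₀ of sizes a, b: add a new vertices
-- adjacent exactly to X₀ (they join the side of Y₀) and b new vertices
-- adjacent exactly to Y₀ (they join the side of X₀).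
attach : ∀ {a b} → BipartiteGraph a b → BipartiteGraph (a ℕ.+ b) (b ℕ.+ a)
attach {a} {b} H = mkBipartite λ x y → attachEdge H (splitAt a x) (splitAt b y)

-- Membership, up to isomorphism, in 𝓑ₙᵏ (meaningful for 1 ≤ k ≤ n / 2).
In𝓑 : (n k : ℕ) → ∀ {N} → Graph N → Set
In𝓑 n k G = Σ[ H ∈ BipartiteGraph k (n ℕ.∸ k) ] G ≅ toGraph (attach H)

-- In Γ₁ and Γ₂ the index i : Fin 4 stands for tᵢ₊₁ and bᵢ₊₁ respectively.
Γ₁ : BipartiteGraph 4 4
Γ₁ .edge zero    zero    = false
Γ₁ .edge zero    (suc _) = true
Γ₁ .edge (suc _) zero    = true
Γ₁ .edge (suc i) (suc j) = ⌊ i ≟F j ⌋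

Γ₂ : BipartiteGraph 4 4
Γ₂ .edge zero    zero    = true
Γ₂ .edge zero    (suc j) = Γ₁ .edge zero (suc j)
Γ₂ .edge (suc i) zero    = Γ₁ .edge (suc i) zero
Γ₂ .edge (suc i) (suc j) = Γ₁ .edge (suc i) (suc j)

{-# OPTIONS --safe #-}

-- Let E be an edge-maximal non-Hamiltonian bipartite supergraph of G and Ê its
-- quasi-complement.  Non-adjacent x, y are the ends of a Hamiltonian path of E,
-- and the usual crossing argument gives d(x) + d(y) ≤ n, that is,
-- d̂(x) + d̂(y) ≥ n on every edge of Ê.  Testing q(Ĝ) ≤ n on the vector of
-- degrees of Ê gives Σ_{xy ∈ Ĝ} (d̂(x) + d̂(y))² ≤ n Σ_{xy ∈ Ê} (d̂(x) + d̂(y)), so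
-- d̂(x) + d̂(y) = n on Ê and the edges of Ĝ outside Ê join isolated vertices of Ê.
--
-- Fix a Hamiltonian path x₀ y₀ … x_l y_l of E with x₀, y_l not adjacent, and read
-- it as the word whose i-th letter says whether x₀ is adjacent to y_i; by
-- tightness this holds exactly when x_i and y_l are not adjacent.  Comparing
-- the words of rotated and of reversed paths leaves S…ST…T, for which G is in
-- some 𝓑ₙᵏ, and STST, for which E = Γ₂.
--
-- The Rayleigh bound needs an eigenvalue above any Rayleigh quotient.  It is found
-- by bisecting on the positive definiteness of t I − A, which is decidable for
-- rational t; an eigenvector is obtained by elimination at the limit.
module Submission where

open import Defs
open import Data.Bool.Base using (Bool; true; false; not; if_then_else_)
open import Data.Fin.Base using (Fin; zero; suc)
open import Data.Nat.Base using (ℕ; zero; suc; _≤_; s≤s; ⌊_/2⌋)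
import Data.Nat.Properties as ℕₚ
open import Data.Product.Base using (Σ-syntax; ∃-syntax; _×_; _,_; proj₁; proj₂)
open import Data.Sum.Base using (_⊎_; inj₁; inj₂)
open import Relation.Binary.PropositionalEquality using (_≡_; _≢_; refl; sym; trans; cong; cong₂; subst; subst₂; module ≡-Reasoning)
open import Relation.Nullary using (¬_; Dec; yes; no; contradiction)

-- The hypothesis on q concerns only eigenvalues that come with an eigenvector of Cauchy reals, so a
-- large value of a quadratic form must be turned into such a vector. Elimination asks whether a
-- pivot vanishes, which is undecidable for reals, and so succeeds only up to double negation. That
-- suffices: the test vectors have natural entries, the resulting bound is an inequality in ℕ and
-- may be proved by contradiction, and its failure, being by at least 1, leaves room for a rational
-- t strictly above n.
--
-- A vertex isolated in Ê is adjacent in E to the whole opposite side, so E arises from G by adding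
-- edges between such full vertices only. For S...ST...T these lie where a graph of 𝓑ₙᵏ is arbitrary
-- anyway; for STST the only one is t₁b₁, the difference between Γ₁ and Γ₂.
--
-- Rotating at an S moves x₀ but keeps y_l. By tightness the column of y_l determines the row of
-- whichever vertex starts the path, so the row of x_i for every S at i can be computed from the
-- word.

-- Quadratic forms and positive definiteness over ℚ

module RationalMatrices where

  open import Data.Unit.Base using (⊤; tt)
  open import Data.Rational.Base as ℚ using (ℚ; 0ℚ; 1ℚ; _+_; _*_; _-_; -_)
  import Data.Rational.Properties as ℚₚ
  open import Data.Rational.Solver using (module +-*-Solver)
  open import Relation.Nullary.Decidable using (_×-dec_)
  open import Algebra.Bundles using (CommutativeRing)
  import Algebra.Properties.Semiring.Sum as SemiringSum

  module ∑ℚ = SemiringSum (CommutativeRing.semiring ℚₚ.+-*-commutativeRing)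
  open ∑ℚ using () renaming (sum to sumℚ)
  open +-*-Solver using (solve; _:=_; _:+_; _:*_; _:-_; :-_; con)

  ≤-diff : ∀ {p q} r → 0ℚ ℚ.≤ r → q ≡ p + r → p ℚ.≤ q
  ≤-diff {p} r 0≤r refl = subst (ℚ._≤ p + r) (ℚₚ.+-identityʳ p) (ℚₚ.+-monoʳ-≤ p 0≤r)

  <-diff : ∀ {p q} r → 0ℚ ℚ.< r → q ≡ p + r → p ℚ.< q
  <-diff {p} r 0<r refl = subst (ℚ._< p + r) (ℚₚ.+-identityʳ p) (ℚₚ.+-monoʳ-< p 0<r)

  0≤diff : ∀ {p q} → p ℚ.≤ q → 0ℚ ℚ.≤ q - p
  0≤diff {p} {q} p≤q = subst (ℚ._≤ q - p) (ℚₚ.+-inverseʳ p) (ℚₚ.+-monoˡ-≤ (- p) p≤q)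

  0<diff : ∀ {p q} → p ℚ.< q → 0ℚ ℚ.< q - p
  0<diff {p} {q} p<q = subst (ℚ._< q - p) (ℚₚ.+-inverseʳ p) (ℚₚ.+-monoˡ-< (- p) p<q)

  0≤* : ∀ {p q} → 0ℚ ℚ.≤ p → 0ℚ ℚ.≤ q → 0ℚ ℚ.≤ p * q
  0≤* {p} {q} 0≤p 0≤q = ℚₚ.nonNegative⁻¹ (p * q)
    {{ℚₚ.nonNeg*nonNeg⇒nonNeg p {{ℚ.nonNegative 0≤p}} q {{ℚ.nonNegative 0≤q}}}}

  0<* : ∀ {p q} → 0ℚ ℚ.< p → 0ℚ ℚ.< q → 0ℚ ℚ.< p * q
  0<* {p} {q} 0<p 0<q = ℚₚ.positive⁻¹ (p * q)
    {{ℚₚ.pos*pos⇒pos p {{ℚ.positive 0<p}} q {{ℚ.positive 0<q}}}}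

  0≤+ : ∀ {p q} → 0ℚ ℚ.≤ p → 0ℚ ℚ.≤ q → 0ℚ ℚ.≤ p + q
  0≤+ = ℚₚ.+-mono-≤

  0<+ : ∀ {p q} → 0ℚ ℚ.< p → 0ℚ ℚ.≤ q → 0ℚ ℚ.< p + q
  0<+ = ℚₚ.+-mono-<-≤

  *-cancel-0< : ∀ {p q} → 0ℚ ℚ.≤ p → 0ℚ ℚ.< p * q → 0ℚ ℚ.< q
  *-cancel-0< {p} {q} 0≤p 0<pq = ℚₚ.*-cancelˡ-<-nonNeg p {{ℚ.nonNegative 0≤p}}
    (subst (ℚ._< p * q) (sym (ℚₚ.*-zeroʳ p)) 0<pq)

  *-cancel-≡0 : ∀ {p q} → 0ℚ ℚ.< p → p * q ≡ 0ℚ → q ≡ 0ℚ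
  *-cancel-≡0 {p} {q} 0<p pq≡0 = ℚₚ.≤-antisym
    (ℚₚ.*-cancelˡ-≤-pos p {{ℚ.positive 0<p}} (ℚₚ.≤-reflexive eq))
    (ℚₚ.*-cancelˡ-≤-pos p {{ℚ.positive 0<p}} (ℚₚ.≤-reflexive (sym eq)))
    where
    eq : p * q ≡ p * 0ℚ
    eq = trans pq≡0 (sym (ℚₚ.*-zeroʳ p))

  0≤p² : ∀ p → 0ℚ ℚ.≤ p * p
  0≤p² p with ℚₚ.≤-total 0ℚ p
  ... | inj₁ 0≤p = 0≤* 0≤p 0≤p
  ... | inj₂ p≤0 = subst (0ℚ ℚ.≤_) (solve 1 (λ p → (:- p) :* (:- p) := p :* p) refl p)
                     (0≤* (ℚₚ.neg-antimono-≤ p≤0) (ℚₚ.neg-antimono-≤ p≤0))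

  0≤sum : ∀ {N} (f : Fin N → ℚ) → (∀ i → 0ℚ ℚ.≤ f i) → 0ℚ ℚ.≤ sumℚ f
  0≤sum {zero}  f 0≤f = ℚₚ.≤-refl
  0≤sum {suc N} f 0≤f = 0≤+ (0≤f zero) (0≤sum (λ i → f (suc i)) (λ i → 0≤f (suc i)))

  Matrixℚ : ℕ → Set
  Matrixℚ N = Fin N → Fin N → ℚ

  -- Subtraction is written as multiplication by -1 because the reals carry only sums and products;
  -- the real Schur complement then evaluates termwise to the rational one by definition.
  -1ℚ : ℚ
  -1ℚ = - 1ℚ

  Symmetric : ∀ {N} → Matrixℚ N → Set
  Symmetric M = ∀ i j → M i j ≡ M j i

  -- The Schur complement of the entry M 0 0, multiplied by that entry.
  schur : ∀ {N} → Matrixℚ (suc N) → Matrixℚ N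
  schur M i j = M zero zero * M (suc i) (suc j) + -1ℚ * (M (suc i) zero * M zero (suc j))

  schur-sym : ∀ {N} (M : Matrixℚ (suc N)) → Symmetric M → Symmetric (schur M)
  schur-sym M sy i j = cong₂ (λ a b → M zero zero * a + -1ℚ * b) (sy (suc i) (suc j))
    (trans (ℚₚ.*-comm (M (suc i) zero) (M zero (suc j))) (cong₂ _*_ (sy zero (suc j)) (sy (suc i) zero)))

  -- Positive definiteness, by the signs of the pivots.
  PosDef : ∀ {N} → Matrixℚ N → Set
  PosDef {zero}  M = ⊤
  PosDef {suc N} M = (0ℚ ℚ.< M zero zero) × PosDef (schur M)

  posDef? : ∀ {N} (M : Matrixℚ N) → Dec (PosDef M)
  posDef? {zero}  M = yes tt
  posDef? {suc N} M = (0ℚ ℚₚ.<? M zero zero) ×-dec posDef? (schur M)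

  _·_ : ∀ {N} → Matrixℚ N → (Fin N → ℚ) → Fin N → ℚ
  (M · v) i = sumℚ (λ j → M i j * v j)

  quad : ∀ {N} → Matrixℚ N → (Fin N → ℚ) → ℚ
  quad M v = sumℚ (λ i → v i * (M · v) i)

  sum-combination : ∀ {N} (c b : ℚ) (f g v : Fin N → ℚ) →
    sumℚ (λ j → (c * f j + -1ℚ * (b * g j)) * v j)
      ≡ c * sumℚ (λ j → f j * v j) + -1ℚ * (b * sumℚ (λ j → g j * v j))
  sum-combination {zero}  c b f g v =
    solve 2 (λ c b → con 0ℚ := c :* con 0ℚ :+ con -1ℚ :* (b :* con 0ℚ)) refl c b
  sum-combination {suc N} c b f g v = trans
    (cong ((c * f zero + -1ℚ * (b * g zero)) * v zero +_)
      (sum-combination c b (λ j → f (suc j)) (λ j → g (suc j)) (λ j → v (suc j))))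
    (solve 7 (λ c b f g v F G →
        (c :* f :+ con -1ℚ :* (b :* g)) :* v :+ (c :* F :+ con -1ℚ :* (b :* G))
          := c :* (f :* v :+ F) :+ con -1ℚ :* (b :* (g :* v :+ G)))
      refl c b (f zero) (g zero) (v zero) _ _)

  -- One step of Gaussian elimination without division: the pivot row, scaled by the first entry of
  -- row `suc i`, removes the first unknown.
  schur-· : ∀ {N} (M : Matrixℚ (suc N)) v i →
    M zero zero * (M · v) (suc i)
      ≡ M (suc i) zero * (M · v) zero + (schur M · (λ j → v (suc j))) i
  schur-· M v i = trans
    (solve 5 (λ c b v₀ m r → c :* (b :* v₀ :+ m)
        := b :* (c :* v₀ :+ r) :+ (c :* m :+ con -1ℚ :* (b :* r)))
      refl (M zero zero) (M (suc i) zero) (v zero) _ _)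
    (cong (M (suc i) zero * (M · v) zero +_)
      (sym (sum-combination (M zero zero) (M (suc i) zero) (λ j → M (suc i) (suc j))
        (λ j → M zero (suc j)) (λ j → v (suc j)))))

  sum-eliminate : ∀ {N} (c w : ℚ) (v r b s : Fin N → ℚ) →
    (∀ i → c * r i ≡ b i * w + s i) →
    c * sumℚ (λ i → v i * r i) ≡ w * sumℚ (λ i → b i * v i) + sumℚ (λ i → v i * s i)
  sum-eliminate {zero}  c w v r b s eq =
    solve 2 (λ c w → c :* con 0ℚ := w :* con 0ℚ :+ con 0ℚ) refl c w
  sum-eliminate {suc N} c w v r b s eq = begin
    c * (v zero * r zero + R)
      ≡⟨ solve 4 (λ c v r R → c :* (v :* r :+ R) := v :* (c :* r) :+ c :* R) refl c (v zero) (r zero) R ⟩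
    v zero * (c * r zero) + c * R
      ≡⟨ cong₂ (λ a b → v zero * a + b) (eq zero)
           (sum-eliminate c w _ _ (λ i → b (suc i)) (λ i → s (suc i)) (λ i → eq (suc i))) ⟩
    v zero * (b zero * w + s zero) + (w * B + S)
      ≡⟨ solve 6 (λ v b w s B S → v :* (b :* w :+ s) :+ (w :* B :+ S)
             := w :* (b :* v :+ B) :+ (v :* s :+ S)) refl (v zero) (b zero) w (s zero) B S ⟩
    w * (b zero * v zero + B) + (v zero * s zero + S) ∎
    where
    open ≡-Reasoning
    R = sumℚ (λ i → v (suc i) * r (suc i))
    B = sumℚ (λ i → b (suc i) * v (suc i))
    S = sumℚ (λ i → v (suc i) * s (suc i))

  -- Completing the square in the first coordinate; the linear form that gets squared is the first
  -- entry of `M · v`.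
  schur-quad : ∀ {N} (M : Matrixℚ (suc N)) → Symmetric M → ∀ v →
    M zero zero * quad M v
      ≡ (M · v) zero * (M · v) zero + quad (schur M) (λ j → v (suc j))
  schur-quad M sy v = begin
    c * (v₀ * w + R)
      ≡⟨ ℚₚ.*-distribˡ-+ c (v₀ * w) R ⟩
    c * (v₀ * w) + c * R
      ≡⟨ cong (c * (v₀ * w) +_)
           (sum-eliminate c w v' (λ i → (M · v) (suc i)) (λ i → M (suc i) zero) _ (schur-· M v)) ⟩
    c * (v₀ * w) + (w * sumℚ (λ i → M (suc i) zero * v' i) + S)
      ≡⟨ cong (λ z → c * (v₀ * w) + (w * z + S))
           (∑ℚ.sum-cong-≗ (λ i → cong (_* v' i) (sy (suc i) zero))) ⟩
    c * (v₀ * w) + (w * B + S)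
      ≡⟨ solve 4 (λ c v₀ B S → c :* (v₀ :* (c :* v₀ :+ B)) :+ ((c :* v₀ :+ B) :* B :+ S)
                   := (c :* v₀ :+ B) :* (c :* v₀ :+ B) :+ S) refl c v₀ B S ⟩
    w * w + S ∎
    where
    open ≡-Reasoning
    c = M zero zero
    v₀ = v zero
    v' = λ j → v (suc j)
    w = (M · v) zero
    R = sumℚ (λ i → v' i * (M · v) (suc i))
    B = sumℚ (λ j → M zero (suc j) * v' j)
    S = quad (schur M) v'

  posDef⇒quad≥0 : ∀ {N} (M : Matrixℚ N) → Symmetric M → PosDef M → ∀ v → 0ℚ ℚ.≤ quad M v
  posDef⇒quad≥0 {zero}  M sy _ v = ℚₚ.≤-refl
  posDef⇒quad≥0 {suc N} M sy (0<c , pd) v =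
    ℚₚ.*-cancelˡ-≤-pos (M zero zero) {{ℚ.positive 0<c}}
      (subst₂ ℚ._≤_ (sym (ℚₚ.*-zeroʳ (M zero zero))) (sym (schur-quad M sy v))
        (0≤+ (0≤p² ((M · v) zero)) (posDef⇒quad≥0 (schur M) (schur-sym M sy) pd (λ j → v (suc j)))))

  sum-*0 : ∀ {N} (f : Fin N → ℚ) → sumℚ (λ i → f i * 0ℚ) ≡ 0ℚ
  sum-*0 {N} f = trans (∑ℚ.sum-cong-≗ (λ i → ℚₚ.*-zeroʳ (f i))) (∑ℚ.sum-replicate-zero N)

  sum-0* : ∀ {N} (f : Fin N → ℚ) → sumℚ (λ i → 0ℚ * f i) ≡ 0ℚ
  sum-0* {N} f = trans (∑ℚ.sum-cong-≗ (λ i → ℚₚ.*-zeroˡ (f i))) (∑ℚ.sum-replicate-zero N)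

  swap-* : ∀ a b c → a * (b * c) ≡ b * (a * c)
  swap-* = solve 3 (λ a b c → a :* (b :* c) := b :* (a :* c)) refl

  sum-scale : ∀ {N} (f : Fin N → ℚ) c (v : Fin N → ℚ) → sumℚ (λ j → f j * (c * v j)) ≡ c * sumℚ (λ j → f j * v j)
  sum-scale f c v = trans (∑ℚ.sum-cong-≗ (λ j → swap-* (f j) c (v j)))
    (sym (∑ℚ.*-distribˡ-sum c (λ j → f j * v j)))

  quad-scale : ∀ {N} (M : Matrixℚ N) c v → quad M (λ i → c * v i) ≡ (c * c) * quad M v
  quad-scale M c v = trans
    (∑ℚ.sum-cong-≗ (λ i → trans (cong (c * v i *_) (sum-scale (M i) c v))
      (solve 3 (λ c v r → (c :* v) :* (c :* r) := (c :* c) :* (v :* r)) refl c (v i) ((M · v) i))))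
    (sym (∑ℚ.*-distribˡ-sum (c * c) (λ i → v i * (M · v) i)))

  -- The first unit vector shows that the pivot is positive. A vector for the Schur complement is
  -- extended so that the square in `schur-quad` vanishes, which passes positivity on to the
  -- complement.
  quad>0⇒posDef : ∀ {N} (M : Matrixℚ N) → Symmetric M →
    (∀ v → ¬ (∀ i → v i ≡ 0ℚ) → 0ℚ ℚ.< quad M v) → PosDef M
  quad>0⇒posDef {zero}  M sy pos = tt
  quad>0⇒posDef {suc N} M sy pos = 0<c , quad>0⇒posDef (schur M) (schur-sym M sy) pos'
    where
    c = M zero zero
    e₀ : Fin (suc N) → ℚ
    e₀ zero    = 1ℚ
    e₀ (suc _) = 0ℚ
    quad-e₀ : quad M e₀ ≡ c
    quad-e₀ = trans
      (cong₂ (λ a b → 1ℚ * (c * 1ℚ + a) + b) (sum-*0 (λ j → M zero (suc j))) (sum-0* (λ i → (M · e₀) (suc i))))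
      (solve 1 (λ c → con 1ℚ :* (c :* con 1ℚ :+ con 0ℚ) :+ con 0ℚ := c) refl c)
    0<c : 0ℚ ℚ.< c
    0<c = subst (0ℚ ℚ.<_) quad-e₀ (pos e₀ (λ z → contradiction (z zero) λ ()))
    pos' : ∀ w → ¬ (∀ i → w i ≡ 0ℚ) → 0ℚ ℚ.< quad (schur M) w
    pos' w w≢0 = *-cancel-0< (0≤p² c) (subst (0ℚ ℚ.<_) scaled (0<* 0<c (pos v v≢0)))
      where
      b·w = sumℚ (λ j → M zero (suc j) * w j)
      -- The solution of `(M · v) zero ≡ 0ℚ` over `w`, multiplied by `c` to avoid a division.
      v : Fin (suc N) → ℚ
      v zero    = - b·w
      v (suc j) = c * w j
      v≢0 : ¬ (∀ i → v i ≡ 0ℚ)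
      v≢0 v≡0 = w≢0 λ i → *-cancel-≡0 0<c (v≡0 (suc i))
      Mv₀≡0 : (M · v) zero ≡ 0ℚ
      Mv₀≡0 = trans (cong (c * - b·w +_) (sum-scale (λ j → M zero (suc j)) c w))
        (solve 2 (λ c b → c :* (:- b) :+ c :* b := con 0ℚ) refl c b·w)
      scaled : c * quad M v ≡ (c * c) * quad (schur M) w
      scaled = trans (schur-quad M sy v)
        (trans (cong₂ (λ a b → a * a + b) Mv₀≡0 (quad-scale (schur M) c w))
               (ℚₚ.+-identityˡ (c * c * quad (schur M) w)))

-- Elimination over Cauchy reals: kernel vectors of limits of positive definite matrices

module Elimination where

  open RationalMatrices
  open import Data.Nat.Base as ℕ using (_⊔_)
  open import Data.Unit.Base using (tt)
  open import Data.Rational.Base as ℚ using (ℚ; 0ℚ; 1ℚ; ½; _+_; _*_; _-_; -_; ∣_∣)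
  import Data.Rational.Properties as ℚₚ
  open import Data.Rational.Solver using (module +-*-Solver)

  open ∑ℚ using () renaming (sum to sumℚ)
  open +-*-Solver using (solve; _:=_; _:+_; _:*_; _:-_; :-_; con)

  -- A diagonal entry of the Schur complement plus a square is the pivot times the original entry,
  -- so positivity climbs back up.
  posDef-diagonal : ∀ {N} (M : Matrixℚ N) → Symmetric M → PosDef M → ∀ i → 0ℚ ℚ.< M i i
  posDef-diagonal {suc N} M sy (0<c , pd) zero    = 0<c
  posDef-diagonal {suc N} M sy (0<c , pd) (suc i) =
    *-cancel-0< (ℚₚ.<⇒≤ 0<c) (subst (0ℚ ℚ.<_) eq
      (0<+ (posDef-diagonal (schur M) (schur-sym M sy) pd i) (0≤p² (M zero (suc i)))))
    where
    eq : schur M i i + M zero (suc i) * M zero (suc i) ≡ M zero zero * M (suc i) (suc i)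
    eq = trans
      (cong (λ z → M zero zero * M (suc i) (suc i) + -1ℚ * (z * M zero (suc i))
               + M zero (suc i) * M zero (suc i)) (sy (suc i) zero))
      (solve 2 (λ a b → a :+ con -1ℚ :* (b :* b) :+ b :* b := a) refl
        (M zero zero * M (suc i) (suc i)) (M zero (suc i)))

  Eventually : (ℕ → Set) → Set
  Eventually P = ∃[ N ] ∀ n → N ℕ.≤ n → P n

  Frequently : (ℕ → Set) → Set
  Frequently P = ∀ N → ∃[ n ] N ℕ.≤ n × P n

  Null : (ℕ → ℚ) → Set
  Null f = ∀ ε → 0ℚ ℚ.< ε → Eventually (λ n → ∣ f n ∣ ℚ.< ε)

  eventually-× : ∀ {P Q : ℕ → Set} → Eventually P → Eventually Q → Eventually (λ n → P n × Q n)
  eventually-× (M , p) (N , q) = M ⊔ N , λ n n≥ →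
    p n (ℕₚ.m⊔n≤o⇒m≤o M N n≥) , q n (ℕₚ.m⊔n≤o⇒n≤o M N n≥)

  eventually-map : ∀ {P Q : ℕ → Set} → (∀ {n} → P n → Q n) → Eventually P → Eventually Q
  eventually-map f (N , p) = N , λ n n≥ → f (p n n≥)

  ≈0⇒null : ∀ x → x ≈ℝ 0ℝ → Null (seq x)
  ≈0⇒null x x≈0 ε 0<ε = eventually-map (λ {n} → subst (λ z → ∣ z ∣ ℚ.< ε) (ℚₚ.+-identityʳ (seq x n))) (x≈0 ε 0<ε)

  null⇒≈0 : ∀ x → Null (seq x) → x ≈ℝ 0ℝ
  null⇒≈0 x null ε 0<ε = eventually-map (λ {n} → subst (λ z → ∣ z ∣ ℚ.< ε) (sym (ℚₚ.+-identityʳ (seq x n)))) (null ε 0<ε)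

  null-≗ : ∀ {f g : ℕ → ℚ} → (∀ n → f n ≡ g n) → Null f → Null g
  null-≗ f≗g null ε 0<ε = eventually-map (λ {n} → subst (λ z → ∣ z ∣ ℚ.< ε) (f≗g n)) (null ε 0<ε)

  null-0 : Null (λ _ → 0ℚ)
  null-0 ε 0<ε = 0 , λ _ _ → 0<ε

  ∣∣-< : ∀ {p q} → p ℚ.< q → - q ℚ.< p → ∣ p ∣ ℚ.< q
  ∣∣-< {p} {q} p<q -q<p with ℚₚ.∣p∣≡p∨∣p∣≡-p p
  ... | inj₁ eq = subst (ℚ._< q) (sym eq) p<q
  ... | inj₂ eq = subst (ℚ._< q) (sym eq)
    (subst (- p ℚ.<_) (solve 1 (λ q → :- (:- q) := q) refl q) (ℚₚ.neg-antimono-< -q<p))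

  p≤∣p∣ : ∀ p → p ℚ.≤ ∣ p ∣
  p≤∣p∣ p with ℚₚ.≤-total 0ℚ p
  ... | inj₁ 0≤p = ℚₚ.≤-reflexive (sym (ℚₚ.0≤p⇒∣p∣≡p 0≤p))
  ... | inj₂ p≤0 = ℚₚ.≤-trans p≤0 (ℚₚ.0≤∣p∣ p)

  ∣∣-triangle : ∀ p q → ∣ p ∣ ℚ.≤ ∣ q ∣ + ∣ p - q ∣
  ∣∣-triangle p q = subst (λ z → ∣ z ∣ ℚ.≤ ∣ q ∣ + ∣ p - q ∣)
    (solve 2 (λ p q → q :+ (p :- q) := p) refl p q) (ℚₚ.∣p+q∣≤∣p∣+∣q∣ q (p - q))

  cauchy-frequently⇒null : ∀ f → IsCauchy f →
    (∀ ε → 0ℚ ℚ.< ε → Frequently (λ n → ∣ f n ∣ ℚ.< ε)) → Null f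
  cauchy-frequently⇒null f cf fr ε 0<ε with cf (½ * ε) (0<½* 0<ε)
  ... | N , h with fr (½ * ε) (0<½* 0<ε) N
  ...   | k , N≤k , small = N , λ n N≤n → begin-strict
    ∣ f n ∣                  ≤⟨ ∣∣-triangle (f n) (f k) ⟩
    ∣ f k ∣ + ∣ f n - f k ∣  <⟨ ℚₚ.+-mono-< small (h n k N≤n N≤k) ⟩
    ½ * ε + ½ * ε            ≡⟨ ½*+½* ε ⟩
    ε                        ∎
    where open ℚₚ.≤-Reasoning

  -- The uniform lower bound makes this strict positivity of the limit, which is what dividing by
  -- the sequence requires.
  EventuallyPositive : (ℕ → ℚ) → Set
  EventuallyPositive f = Σ[ ε ∈ ℚ ] 0ℚ ℚ.< ε × Eventually (λ n → ε ℚ.≤ f n)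

  -- A late term that is at least ε would, by the Cauchy property, keep all later terms above ε/2.
  -- So the terms that are known to be positive are also below ε, and a Cauchy sequence that is
  -- small infinitely often tends to 0.
  ¬positive⇒null : ∀ f → IsCauchy f → Frequently (λ n → 0ℚ ℚ.< f n) →
    ¬ EventuallyPositive f → Null f
  ¬positive⇒null f cf fr ¬pos = cauchy-frequently⇒null f cf small
    where
    small : ∀ ε → 0ℚ ℚ.< ε → Frequently (λ n → ∣ f n ∣ ℚ.< ε)
    small ε 0<ε K with cf (½ * ε) (0<½* 0<ε)
    ... | N , h with fr (K ⊔ N)
    ...   | k , K⊔N≤k , 0<fk with f k ℚₚ.<? ε
    ...     | yes fk<ε = k , ℚ≤ , subst (ℚ._< ε) (sym (ℚₚ.0≤p⇒∣p∣≡p (ℚₚ.<⇒≤ 0<fk))) fk<ε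
      where ℚ≤ = ℕₚ.m⊔n≤o⇒m≤o K N K⊔N≤k
    ...     | no fk≮ε = contradiction (½ * ε , 0<½* 0<ε , N , lower) ¬pos
      where
      open ℚₚ.≤-Reasoning
      lower : ∀ n → N ℕ.≤ n → ½ * ε ℚ.≤ f n
      lower n N≤n = ≤-diff ((½ * ε - (f k - f n)) + (f k - ε))
        (0≤+ (0≤diff (ℚₚ.<⇒≤ (ℚₚ.≤-<-trans (p≤∣p∣ (f k - f n))
               (h k n (ℕₚ.m⊔n≤o⇒n≤o K N K⊔N≤k) N≤n))))
             (0≤diff (ℚₚ.≮⇒≥ fk≮ε)))
        (solve 3 (λ ε a b → b := con ½ :* ε :+ ((con ½ :* ε :- (a :- b)) :+ (a :- ε))) refl ε (f k) (f n))

  null-cancel : ∀ c w → EventuallyPositive c → Null (λ n → c n * w n) → Null w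
  null-cancel c w (η , 0<η , pos) null ε 0<ε =
    eventually-map bound (eventually-× pos (null (η * ε) (0<* 0<η 0<ε)))
    where
    open ℚₚ.≤-Reasoning
    bound : ∀ {n} → (η ℚ.≤ c n) × (∣ c n * w n ∣ ℚ.< η * ε) → ∣ w n ∣ ℚ.< ε
    bound {n} (η≤c , small) = ℚₚ.*-cancelˡ-<-nonNeg η {{ℚ.nonNegative (ℚₚ.<⇒≤ 0<η)}} (begin-strict
      η * ∣ w n ∣        ≤⟨ ℚₚ.*-monoʳ-≤-nonNeg ∣ w n ∣ {{ℚₚ.∣-∣-nonNeg (w n)}} (ℚₚ.≤-trans η≤c (p≤∣p∣ (c n))) ⟩
      ∣ c n ∣ * ∣ w n ∣  ≡⟨ ℚₚ.∣p*q∣≡∣p∣*∣q∣ (c n) (w n) ⟨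
      ∣ c n * w n ∣      <⟨ small ⟩
      η * ε              ∎)

  square-reflects-< : ∀ {p q} → 0ℚ ℚ.≤ q → p * p ℚ.< q * q → ∣ p ∣ ℚ.< q
  square-reflects-< {p} {q} 0≤q pp<qq with ∣ p ∣ ℚₚ.<? q
  ... | yes lt = lt
  ... | no ¬lt = contradiction (begin-strict
    p * p          <⟨ pp<qq ⟩
    q * q          ≤⟨ ℚₚ.*-monoʳ-≤-nonNeg q {{ℚ.nonNegative 0≤q}} q≤∣p∣ ⟩
    ∣ p ∣ * q      ≤⟨ ℚₚ.*-monoˡ-≤-nonNeg ∣ p ∣ {{ℚₚ.∣-∣-nonNeg p}} q≤∣p∣ ⟩
    ∣ p ∣ * ∣ p ∣  ≡⟨ ℚₚ.∣p*q∣≡∣p∣*∣q∣ p p ⟨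
    ∣ p * p ∣      ≡⟨ ℚₚ.0≤p⇒∣p∣≡p (0≤p² p) ⟩
    p * p          ∎) (ℚₚ.<-irrefl refl)
    where
    open ℚₚ.≤-Reasoning
    q≤∣p∣ = ℚₚ.≮⇒≥ ¬lt

  seq-sum : ∀ {N} (f : Fin N → ℝ) n → seq (sumℝ f) n ≡ sumℚ (λ j → seq (f j) n)
  seq-sum {zero}  f n = refl
  seq-sum {suc N} f n = cong (seq (f zero) n +_) (seq-sum (λ j → f (suc j)) n)

  at : ∀ {N} → Matrix N → ℕ → Matrixℚ N
  at M n i j = seq (M i j) n

  Kernel : ∀ {N} → Matrix N → Set
  Kernel {N} M = Σ[ v ∈ (Fin N → ℝ) ] ¬ (∀ i → v i ≈ℝ 0ℝ) ×
    (∀ i → sumℝ (λ j → M i j *ℝ v j) ≈ℝ 0ℝ)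

  schurℝ : ∀ {N} → Matrix (suc N) → Matrix N
  schurℝ M i j = M zero zero *ℝ M (suc i) (suc j) +ℝ
    fromℚ -1ℚ *ℝ (M (suc i) zero *ℝ M zero (suc j))

  ½*-< : ∀ {ε} → 0ℚ ℚ.< ε → ½ * ε ℚ.< ε
  ½*-< {ε} 0<ε = <-diff {½ * ε} {ε} (½ * ε) (0<½* 0<ε) (sym (½*+½* ε))

  null-* : ∀ c d → Null c → IsCauchy d → Null (λ n → d n * c n)
  null-* c d null cd ε 0<ε =
    let B , B>0 , N , d≤B = bounded d cd
        module S = Scale B ε B>0 0<ε
        K , c< = null S.δ S.0<δ
    in N ⊔ K , λ n n≥ → ℚₚ.<-trans
         (S.scale {d n} {c n} (d≤B n (ℕₚ.m⊔n≤o⇒m≤o N K n≥)) (c< n (ℕₚ.m⊔n≤o⇒n≤o N K n≥)))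
         (½*-< 0<ε)

  -- The difference of the two sides is a 2 by 2 principal minor, that is, a diagonal entry of the
  -- Schur complement.
  posDef-minor : ∀ {N} (M : Matrixℚ (suc N)) → Symmetric M → PosDef M → ∀ j →
    M zero (suc j) * M zero (suc j) ℚ.< M (suc j) (suc j) * M zero zero
  posDef-minor M sy (_ , pd) j = <-diff (schur M j j)
    (posDef-diagonal (schur M) (schur-sym M sy) pd j)
    (trans (solve 3 (λ c d b → d :* c := b :* b :+ (c :* d :+ con -1ℚ :* (b :* b))) refl
             (M zero zero) (M (suc j) (suc j)) b)
           (cong (λ z → b * b + (M zero zero * M (suc j) (suc j) + -1ℚ * (z * b))) (sy zero (suc j))))
    where b = M zero (suc j)

  frequently-dominated⇒null : ∀ b x → IsCauchy b → Null x →
    Frequently (λ n → b n * b n ℚ.< x n) → Null b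
  frequently-dominated⇒null b x cb null fr = cauchy-frequently⇒null b cb λ ε 0<ε K →
    let N , small = null (ε * ε) (0<* 0<ε 0<ε)
        k , K⊔N≤k , bb<x = fr (K ⊔ N)
    in k , ℕₚ.m⊔n≤o⇒m≤o K N K⊔N≤k ,
       square-reflects-< {b k} {ε} (ℚₚ.<⇒≤ 0<ε)
         (ℚₚ.<-trans {b k * b k} {x k} {ε * ε} bb<x
           (ℚₚ.≤-<-trans (p≤∣p∣ (x k)) (small k (ℕₚ.m⊔n≤o⇒n≤o K N K⊔N≤k))))

  -- The 2 by 2 minors bound the square of an entry of the first row by a bounded multiple of the
  -- pivot. Thus a vanishing pivot carries its row, and by symmetry its column, with it, and the
  -- first unit vector lies in the kernel.
  pivot-null⇒row-null : ∀ {N} (M : Matrix (suc N)) → (∀ n → Symmetric (at M n)) →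
    Frequently (λ n → PosDef (at M n)) → Null (seq (M zero zero)) →
    ∀ j → Null (seq (M zero (suc j)))
  pivot-null⇒row-null M sy fr null j = frequently-dominated⇒null (seq (M zero (suc j)))
    (λ n → seq (M (suc j) (suc j)) n * seq (M zero zero) n)
    (cauchy (M zero (suc j)))
    (null-* (seq (M zero zero)) (seq (M (suc j) (suc j))) null (cauchy (M (suc j) (suc j))))
    (λ K → let n , K≤n , pd = fr K in n , K≤n , posDef-minor (at M n) (sy n) pd j)

  pivot-null⇒kernel : ∀ {N} (M : Matrix (suc N)) → (∀ n → Symmetric (at M n)) →
    Frequently (λ n → PosDef (at M n)) → Null (seq (M zero zero)) → Kernel M
  pivot-null⇒kernel {N} M sy fr null = e₀ , e₀≉0 , λ i →
    null⇒≈0 (sumℝ (λ j → M i j *ℝ e₀ j)) (null-≗ (λ n → sym (row i n)) (column i))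
    where
    e₀ : Fin (suc N) → ℝ
    e₀ zero    = fromℚ 1ℚ
    e₀ (suc _) = fromℚ 0ℚ
    e₀≉0 : ¬ (∀ i → e₀ i ≈ℝ 0ℝ)
    e₀≉0 z with ≈0⇒null (fromℚ 1ℚ) (z zero) 1ℚ (ℚₚ.positive⁻¹ 1ℚ)
    ... | n , lt = ℚₚ.<-irrefl refl (lt n ℕₚ.≤-refl)
    row : ∀ i n → seq (sumℝ (λ j → M i j *ℝ e₀ j)) n ≡ seq (M i zero) n
    row i n = trans (cong (seq (M i zero) n * 1ℚ +_)
        (trans (seq-sum (λ j → M i (suc j) *ℝ e₀ (suc j)) n) (sum-*0 (λ j → seq (M i (suc j)) n))))
      (solve 1 (λ x → x :* con 1ℚ :+ con 0ℚ := x) refl (seq (M i zero) n))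
    column : ∀ i → Null (seq (M i zero))
    column zero    = null
    column (suc j) = null-≗ (λ n → sy n zero (suc j)) (pivot-null⇒row-null M sy fr null j)

  -- Back substitution, again scaled by the pivot. The pivot is bounded away from 0, so the scaled
  -- vector is nonzero whenever `w` is.
  schur-kernel : ∀ {N} (M : Matrix (suc N)) → EventuallyPositive (seq (M zero zero)) →
    Kernel (schurℝ M) → Kernel M
  schur-kernel {N} M pos (w , w≉0 , Sw≈0) = v , v≉0 , Mv≈0
    where
    c = M zero zero
    b·w = sumℝ (λ j → M zero (suc j) *ℝ w j)
    v : Fin (suc N) → ℝ
    v zero    = fromℚ -1ℚ *ℝ b·w
    v (suc j) = c *ℝ w j
    v≉0 : ¬ (∀ i → v i ≈ℝ 0ℝ)
    v≉0 v≈0 = w≉0 λ i → null⇒≈0 (w i)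
      (null-cancel (seq c) (seq (w i)) pos (≈0⇒null (c *ℝ w i) (v≈0 (suc i))))
    row-sum : ∀ i n → seq (sumℝ (λ j → M i j *ℝ v j)) n
      ≡ seq (M i zero) n * (-1ℚ * seq b·w n) + seq c n * sumℚ (λ j → at M n i (suc j) * seq (w j) n)
    row-sum i n = cong (seq (M i zero) n * (-1ℚ * seq b·w n) +_)
      (trans (seq-sum (λ j → M i (suc j) *ℝ v (suc j)) n)
             (sum-scale (λ j → at M n i (suc j)) (seq c n) (λ j → seq (w j) n)))
    Mv≈0 : ∀ i → sumℝ (λ j → M i j *ℝ v j) ≈ℝ 0ℝ
    Mv≈0 zero = null⇒≈0 (sumℝ (λ j → M zero j *ℝ v j)) (null-≗ (λ n → sym (begin
      seq (sumℝ (λ j → M zero j *ℝ v j)) n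
        ≡⟨ row-sum zero n ⟩
      seq c n * (-1ℚ * seq b·w n) + seq c n * sumℚ (λ j → at M n zero (suc j) * seq (w j) n)
        ≡⟨ cong (λ z → seq c n * (-1ℚ * seq b·w n) + seq c n * z)
             (seq-sum (λ j → M zero (suc j) *ℝ w j) n) ⟨
      seq c n * (-1ℚ * seq b·w n) + seq c n * seq b·w n
        ≡⟨ solve 2 (λ c s → c :* (con -1ℚ :* s) :+ c :* s := con 0ℚ) refl (seq c n) (seq b·w n) ⟩
      0ℚ ∎)) null-0)
      where open ≡-Reasoning
    Mv≈0 (suc i) = null⇒≈0 (sumℝ (λ j → M (suc i) j *ℝ v j)) (null-≗ (λ n → begin
      seq (sumℝ (λ j → schurℝ M i j *ℝ w j)) n
        ≡⟨ seq-sum (λ j → schurℝ M i j *ℝ w j) n ⟩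
      sumℚ (λ j → schur (at M n) i j * seq (w j) n)
        ≡⟨ sum-combination (seq c n) (at M n (suc i) zero) (λ j → at M n (suc i) (suc j))
             (λ j → at M n zero (suc j)) (λ j → seq (w j) n) ⟩
      seq c n * R n + -1ℚ * (at M n (suc i) zero * sumℚ (λ j → at M n zero (suc j) * seq (w j) n))
        ≡⟨ cong (λ z → seq c n * R n + -1ℚ * (at M n (suc i) zero * z))
             (seq-sum (λ j → M zero (suc j) *ℝ w j) n) ⟨
      seq c n * R n + -1ℚ * (at M n (suc i) zero * seq b·w n)
        ≡⟨ solve 3 (λ cr b s → cr :+ con -1ℚ :* (b :* s) := b :* (con -1ℚ :* s) :+ cr) refl
             (seq c n * R n) (at M n (suc i) zero) (seq b·w n) ⟩
      at M n (suc i) zero * (-1ℚ * seq b·w n) + seq c n * R n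
        ≡⟨ row-sum (suc i) n ⟨
      seq (sumℝ (λ j → M (suc i) j *ℝ v j)) n ∎)
      (≈0⇒null (sumℝ (λ j → schurℝ M i j *ℝ w j)) (Sw≈0 i)))
      where
      open ≡-Reasoning
      R = λ n → sumℚ (λ j → at M n (suc i) (suc j) * seq (w j) n)

  -- It is undecidable whether a real pivot vanishes, hence the double negation.
  kernel-or-posDef : ∀ {N} (M : Matrix N) → (∀ n → Symmetric (at M n)) →
    Frequently (λ n → PosDef (at M n)) →
    ¬ ¬ (Kernel M ⊎ Eventually (λ n → PosDef (at M n)))
  kernel-or-posDef {zero}  M sy fr k = k (inj₂ (0 , λ _ _ → tt))
  kernel-or-posDef {suc N} M sy fr k =
    -- Under the refutation `k`, a pivot bounded away from 0 is impossible, because the recursion on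
    -- the Schur complement would then settle the claim. Hence the pivot tends to 0.
    k (inj₁ (pivot-null⇒kernel M sy fr
      (¬positive⇒null (seq (M zero zero)) (cauchy (M zero zero))
        (λ K → let n , K≤n , 0<c , _ = fr K in n , K≤n , 0<c) ¬pos)))
    where
    ¬pos : ¬ EventuallyPositive (seq (M zero zero))
    ¬pos pos@(ε , 0<ε , ev) = kernel-or-posDef (schurℝ M) (λ n → schur-sym (at M n) (sy n))
      (λ K → let n , K≤n , _ , pd = fr K in n , K≤n , pd)
      λ where
        (inj₁ ker) → k (inj₁ (schur-kernel M pos ker))
        (inj₂ ev') → k (inj₂ (eventually-map
          (λ (ε≤c , pd) → ℚₚ.<-≤-trans 0<ε ε≤c , pd) (eventually-× ev ev')))

-- Natural numbers inside ℚ, and bisection of a decidable predicate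

module Bisections where

  open RationalMatrices
  open Elimination
  import Data.Nat.Base as ℕ
  import Data.Nat.Coprimality as Coprimality
  import Data.Integer.Base as ℤ
  import Data.Integer.Properties as ℤₚ
  open import Data.Rational.Base as ℚ using (ℚ; mkℚ; 0ℚ; 1ℚ; ½; _+_; _*_; _-_; -_; ∣_∣; 1/_)
  import Data.Rational.Properties as ℚₚ
  open import Data.Rational.Solver using (module +-*-Solver)
  open import Relation.Unary using (Decidable)

  open ∑ℚ using () renaming (sum to sumℚ)
  open +-*-Solver using (solve; _:=_; _:+_; _:*_; _:-_; :-_; con)

  ι : ℕ → ℚ
  ι n = ℤ.+ n ℚ./ 1

  -- `ι n` is normalised by a gcd that is stuck for a variable `n`; with numerator and denominator
  -- exposed, sums and products unfold to a single fraction.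
  ι-mkℚ : ∀ n → ι n ≡ mkℚ (ℤ.+ n) 0 (Coprimality.sym (Coprimality.1-coprimeTo n))
  ι-mkℚ n = ℚₚ.normalize-coprime (Coprimality.sym (Coprimality.1-coprimeTo n))

  ι-+ : ∀ m n → ι (m ℕ.+ n) ≡ ι m + ι n
  ι-+ m n = sym (trans (cong₂ _+_ (ι-mkℚ m) (ι-mkℚ n))
    (ℚₚ./-cong {q₁ = 1} {q₂ = 1} (cong₂ ℤ._+_ (ℤₚ.*-identityʳ (ℤ.+ m)) (ℤₚ.*-identityʳ (ℤ.+ n))) refl))

  ι-* : ∀ m n → ι (m ℕ.* n) ≡ ι m * ι n
  ι-* m n = sym (trans (cong₂ _*_ (ι-mkℚ m) (ι-mkℚ n))
    (ℚₚ./-cong {q₁ = 1} {q₂ = 1} (sym (ℤₚ.pos-* m n)) refl))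

  0≤ι : ∀ n → 0ℚ ℚ.≤ ι n
  0≤ι n = ℚₚ.nonNegative⁻¹ (ι n) {{ℚₚ.normalize-nonNeg n 1}}

  ι-mono-≤ : ∀ {m n} → m ℕ.≤ n → ι m ℚ.≤ ι n
  ι-mono-≤ {m} {n} m≤n = ≤-diff {ι m} {ι n} (ι (n ℕ.∸ m)) (0≤ι (n ℕ.∸ m))
    (trans (cong ι (sym (ℕₚ.m+[n∸m]≡n m≤n))) (ι-+ m (n ℕ.∸ m)))

  0<ι-suc : ∀ n → 0ℚ ℚ.< ι (suc n)
  0<ι-suc n = ℚₚ.<-≤-trans (ℚₚ.positive⁻¹ 1ℚ) (ι-mono-≤ {1} {suc n} (ℕ.s≤s ℕ.z≤n))

  ι-sum : ∀ {N} (f : Fin N → ℕ) → ι (sumℕ f) ≡ sumℚ (λ i → ι (f i))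
  ι-sum {zero}  f = refl
  ι-sum {suc N} f = trans (ι-+ (f zero) (sumℕ (λ i → f (suc i))))
    (cong (ι (f zero) +_) (ι-sum (λ i → f (suc i))))

  archimedean : ∀ p → ∃[ n ] p ℚ.< ι (suc n)
  archimedean p@(mkℚ k d _) = ℤ.∣ k ∣ ,
    subst (p ℚ.<_) (sym (ι-mkℚ (suc ℤ.∣ k ∣)))
      (ℚ.*<* (ℤₚ.≤-<-trans (subst (ℤ._≤ ℤ.+ ℤ.∣ k ∣) (sym (ℤₚ.*-identityʳ k)) (k≤∣k∣ k))
        (subst (ℤ.+ ℤ.∣ k ∣ ℤ.<_) (ℤₚ.pos-* (suc ℤ.∣ k ∣) (suc d))
          (ℤ.+<+ (ℕₚ.m≤m*n (suc ℤ.∣ k ∣) (suc d))))))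
    where
    k≤∣k∣ : ∀ k → k ℤ.≤ ℤ.+ ℤ.∣ k ∣
    k≤∣k∣ (ℤ.+ n)      = ℤₚ.≤-refl
    k≤∣k∣ (ℤ.-[1+ n ]) = ℤ.-≤+

  archimedean-* : ∀ W ε → 0ℚ ℚ.< ε → ∃[ n ] W ℚ.< ε * ι (suc n)
  archimedean-* W ε 0<ε =
    let n , lt = archimedean (1/ ε * W)
    in n , subst (ℚ._< ε * ι (suc n)) cancel (ℚₚ.*-monoʳ-<-pos ε lt)
    where
    instance
      _ = ℚ.positive 0<ε
      _ = ℚₚ.pos⇒nonZero ε
    cancel : ε * (1/ ε * W) ≡ W
    cancel = trans (sym (ℚₚ.*-assoc ε (1/ ε) W))
      (trans (cong (_* W) (ℚₚ.*-inverseʳ ε)) (ℚₚ.*-identityˡ W))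

  mean : ℚ → ℚ → ℚ
  mean l h = ½ * (l + h)

  -- The invariant is that `P` fails at the lower and holds at the upper end, so the limit is a
  -- point at which the answer of `P` changes.
  module Bisection (P : ℚ → Set) (P? : Decidable P)
    (lo₀ hi₀ : ℚ) (lo₀≤hi₀ : lo₀ ℚ.≤ hi₀) (¬P-lo₀ : ¬ P lo₀) (P-hi₀ : P hi₀) where

    record Interval : Set where
      field
        lo hi : ℚ
        lo≤hi : lo ℚ.≤ hi
        ¬P-lo : ¬ P lo
        P-hi  : P hi

    open Interval

    width : Interval → ℚ
    width I = hi I - lo I

    lo≤mean : ∀ I → lo I ℚ.≤ mean (lo I) (hi I)
    lo≤mean I = ≤-diff {lo I} (½ * width I) (0≤* {½} (ℚₚ.nonNegative⁻¹ ½) (0≤diff (lo≤hi I)))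
      (solve 2 (λ l h → con ½ :* (l :+ h) := l :+ con ½ :* (h :- l)) refl (lo I) (hi I))

    mean≤hi : ∀ I → mean (lo I) (hi I) ℚ.≤ hi I
    mean≤hi I = ≤-diff {mean (lo I) (hi I)} (½ * width I) (0≤* {½} (ℚₚ.nonNegative⁻¹ ½) (0≤diff (lo≤hi I)))
      (solve 2 (λ l h → h := con ½ :* (l :+ h) :+ con ½ :* (h :- l)) refl (lo I) (hi I))

    halve : ∀ I → Dec (P (mean (lo I) (hi I))) → Interval
    halve I (yes p) = record { lo = lo I ; hi = mean (lo I) (hi I) ; lo≤hi = lo≤mean I ; ¬P-lo = ¬P-lo I ; P-hi = p }
    halve I (no ¬p) = record { lo = mean (lo I) (hi I) ; hi = hi I ; lo≤hi = mean≤hi I ; ¬P-lo = ¬p ; P-hi = P-hi I }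

    lo≤lo-halve : ∀ I d → lo I ℚ.≤ lo (halve I d)
    lo≤lo-halve I (yes _) = ℚₚ.≤-refl
    lo≤lo-halve I (no  _) = lo≤mean I

    hi-halve≤hi : ∀ I d → hi (halve I d) ℚ.≤ hi I
    hi-halve≤hi I (yes _) = mean≤hi I
    hi-halve≤hi I (no  _) = ℚₚ.≤-refl

    width-halve : ∀ I d → width (halve I d) ≡ ½ * width I
    width-halve I (yes _) = solve 2 (λ l h → con ½ :* (l :+ h) :- l := con ½ :* (h :- l)) refl (lo I) (hi I)
    width-halve I (no  _) = solve 2 (λ l h → h :- con ½ :* (l :+ h) := con ½ :* (h :- l)) refl (lo I) (hi I)

    interval : ℕ → Interval
    interval zero    = record { lo = lo₀ ; hi = hi₀ ; lo≤hi = lo₀≤hi₀ ; ¬P-lo = ¬P-lo₀ ; P-hi = P-hi₀ }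
    interval (suc n) = halve (interval n) (P? (mean (lo (interval n)) (hi (interval n))))

    W : ℚ
    W = hi₀ - lo₀

    -- The width halves at every step, but a rate of 1/(n+1) is enough for the Archimedean property
    -- and avoids powers of 2. The induction rests on (n+2)/2 ≤ n+1.
    width-bound : ∀ n → width (interval n) * ι (suc n) ℚ.≤ W
    width-bound zero    = ℚₚ.≤-reflexive (ℚₚ.*-identityʳ W)
    width-bound (suc n) = begin
      width (interval (suc n)) * ι (suc (suc n))
        ≡⟨ cong₂ _*_ (width-halve I (P? (mean (lo I) (hi I)))) (ι-+ 1 (suc n)) ⟩
      (½ * w) * (1ℚ + s)
        ≤⟨ ≤-diff {(½ * w) * (1ℚ + s)} ((½ * w) * ι n) (0≤* {½ * w} (0≤* {½} (ℚₚ.nonNegative⁻¹ ½) (0≤diff (lo≤hi I))) (0≤ι n))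
             (trans (cong (w *_) (ι-+ 1 n)) (trans
               (solve 2 (λ w m → w :* (con 1ℚ :+ m) := con ½ :* w :* (con 1ℚ :+ (con 1ℚ :+ m)) :+ con ½ :* w :* m) refl w (ι n))
               (cong (λ z → ½ * w * (1ℚ + z) + ½ * w * ι n) (sym (ι-+ 1 n))))) ⟩
      w * s
        ≤⟨ width-bound n ⟩
      W ∎
      where
      open ℚₚ.≤-Reasoning
      I = interval n
      w = width I
      s = ι (suc n)

    lo-mono : ∀ {m n} → m ℕ.≤′ n → lo (interval m) ℚ.≤ lo (interval n)
    lo-mono ℕ.≤′-refl = ℚₚ.≤-refl
    lo-mono (ℕ.≤′-step {n} m≤n) = ℚₚ.≤-trans (lo-mono m≤n)
      (lo≤lo-halve (interval n) (P? (mean (lo (interval n)) (hi (interval n)))))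

    hi-anti : ∀ {m n} → m ℕ.≤′ n → hi (interval n) ℚ.≤ hi (interval m)
    hi-anti ℕ.≤′-refl = ℚₚ.≤-refl
    hi-anti (ℕ.≤′-step {n} m≤n) = ℚₚ.≤-trans
      (hi-halve≤hi (interval n) (P? (mean (lo (interval n)) (hi (interval n))))) (hi-anti m≤n)

    even : ℕ → Bool
    even zero    = true
    even (suc n) = not (even n)

    endpoint : Bool → Interval → ℚ
    endpoint true  I = hi I
    endpoint false I = lo I

    -- Alternating between the two ends makes both P and ¬ P hold infinitely often.
    approx : ℕ → ℚ
    approx n = endpoint (even n) (interval n)

    approx-even : ∀ n → even n ≡ true → P (approx n)
    approx-even n eq rewrite eq = P-hi (interval n)

    approx-odd : ∀ n → even n ≡ false → ¬ P (approx n)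
    approx-odd n eq rewrite eq = ¬P-lo (interval n)

    parity : ∀ b K → ∃[ n ] K ℕ.≤ n × even n ≡ b
    parity b K with even K in eq
    parity true  K | true  = K , ℕₚ.≤-refl , eq
    parity false K | false = K , ℕₚ.≤-refl , eq
    parity true  K | false = suc K , ℕₚ.n≤1+n K , cong not eq
    parity false K | true  = suc K , ℕₚ.n≤1+n K , cong not eq

    approx-P : Frequently (λ n → P (approx n))
    approx-P K = let n , K≤n , eq = parity true K in n , K≤n , approx-even n eq

    approx-¬P : Frequently (λ n → ¬ P (approx n))
    approx-¬P K = let n , K≤n , eq = parity false K in n , K≤n , approx-odd n eq

    endpoint-bounds : ∀ b I → lo I ℚ.≤ endpoint b I × endpoint b I ℚ.≤ hi I
    endpoint-bounds true  I = lo≤hi I , ℚₚ.≤-refl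
    endpoint-bounds false I = ℚₚ.≤-refl , lo≤hi I

    lo≤approx : ∀ {m n} → m ℕ.≤ n → lo (interval m) ℚ.≤ approx n
    lo≤approx {m} {n} m≤n = ℚₚ.≤-trans (lo-mono (ℕₚ.≤⇒≤′ m≤n)) (proj₁ (endpoint-bounds (even n) (interval n)))

    approx≤hi : ∀ {m n} → m ℕ.≤ n → approx n ℚ.≤ hi (interval m)
    approx≤hi {m} {n} m≤n = ℚₚ.≤-trans (proj₂ (endpoint-bounds (even n) (interval n))) (hi-anti (ℕₚ.≤⇒≤′ m≤n))

    approx-cauchy : IsCauchy approx
    approx-cauchy ε 0<ε =
      let N , W<ε = archimedean-* W ε 0<ε
          w<ε : width (interval N) ℚ.< ε
          w<ε = ℚₚ.*-cancelʳ-<-nonNeg (ι (suc N)) {{ℚ.nonNegative (0≤ι (suc N))}}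
                  (ℚₚ.≤-<-trans (width-bound N) W<ε)
      in N , λ m n N≤m N≤n → ∣∣-< {approx m - approx n} {ε}
        (ℚₚ.≤-<-trans (ℚₚ.+-mono-≤ (approx≤hi N≤m) (ℚₚ.neg-antimono-≤ (lo≤approx N≤n))) w<ε)
        (ℚₚ.<-≤-trans (ℚₚ.neg-antimono-< w<ε)
          (subst (ℚ._≤ approx m - approx n)
            (solve 2 (λ l h → l :- h := :- (h :- l)) refl (lo (interval N)) (hi (interval N)))
            (ℚₚ.+-mono-≤ (lo≤approx N≤m) (ℚₚ.neg-antimono-≤ (approx≤hi N≤n)))))

    limit : ℝ
    limit = mkℝ approx approx-cauchy

-- Rayleigh quotients are bounded by the largest eigenvalue

module RayleighQuotients where

  open RationalMatrices
  open Elimination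
  open Bisections
  open import Data.Nat.Base as ℕ using (_⊔_)
  open import Data.Rational.Base as ℚ using (ℚ; 0ℚ; 1ℚ; ½; _+_; _*_; _-_; -_; ∣_∣; 1/_)
  import Data.Rational.Properties as ℚₚ
  open import Data.Rational.Solver using (module +-*-Solver)

  open ∑ℚ using () renaming (sum to sumℚ)
  open +-*-Solver using (solve; _:=_; _:+_; _:*_; _:-_; :-_; con)

  sum-mono : ∀ {N} (f g : Fin N → ℚ) → (∀ i → f i ℚ.≤ g i) → sumℚ f ℚ.≤ sumℚ g
  sum-mono {zero}  f g f≤g = ℚₚ.≤-refl
  sum-mono {suc N} f g f≤g =
    ℚₚ.+-mono-≤ (f≤g zero) (sum-mono (λ i → f (suc i)) (λ i → g (suc i)) (λ i → f≤g (suc i)))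

  term≤sum : ∀ {N} (f : Fin N → ℚ) → (∀ i → 0ℚ ℚ.≤ f i) → ∀ i → f i ℚ.≤ sumℚ f
  term≤sum f 0≤f zero = ≤-diff {f zero} (sumℚ (λ i → f (suc i))) (0≤sum (λ i → f (suc i)) (λ i → 0≤f (suc i))) refl
  term≤sum f 0≤f (suc i) = ℚₚ.≤-trans (term≤sum (λ i → f (suc i)) (λ i → 0≤f (suc i)) i)
    (≤-diff {S} (f zero) (0≤f zero) (ℚₚ.+-comm (f zero) S))
    where S = sumℚ (λ i → f (suc i))

  I : ∀ {N} → Matrixℚ N
  I zero    zero    = 1ℚ
  I zero    (suc _) = 0ℚ
  I (suc _) zero    = 0ℚ
  I (suc i) (suc j) = I i j

  I-sym : ∀ {N} → Symmetric (I {N})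
  I-sym zero    zero    = refl
  I-sym zero    (suc _) = refl
  I-sym (suc _) zero    = refl
  I-sym (suc i) (suc j) = I-sym i j

  I-· : ∀ {N} (v : Fin N → ℚ) i → (I · v) i ≡ v i
  I-· v zero    = trans (cong (1ℚ * v zero +_) (sum-0* (λ j → v (suc j))))
    (solve 1 (λ v → con 1ℚ :* v :+ con 0ℚ := v) refl (v zero))
  I-· v (suc i) = trans (cong₂ _+_ (ℚₚ.*-zeroˡ (v zero)) (I-· (λ j → v (suc j)) i))
    (ℚₚ.+-identityˡ (v (suc i)))

  normSq : ∀ {N} → (Fin N → ℚ) → ℚ
  normSq v = sumℚ (λ i → v i * v i)

  shift : ∀ {N} → Matrixℚ N → ℚ → Matrixℚ N
  shift A t i j = t * I i j + -1ℚ * A i j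

  shift-· : ∀ {N} (A : Matrixℚ N) t v i → (shift A t · v) i ≡ t * v i + -1ℚ * (A · v) i
  shift-· A t v i = begin
    sumℚ (λ j → (t * I i j + -1ℚ * A i j) * v j)
      ≡⟨ ∑ℚ.sum-cong-≗ (λ j → cong (λ z → (t * I i j + -1ℚ * z) * v j) (sym (ℚₚ.*-identityˡ (A i j)))) ⟩
    sumℚ (λ j → (t * I i j + -1ℚ * (1ℚ * A i j)) * v j)
      ≡⟨ sum-combination t 1ℚ (I i) (A i) v ⟩
    t * (I · v) i + -1ℚ * (1ℚ * (A · v) i)
      ≡⟨ cong₂ (λ a b → t * a + -1ℚ * b) (I-· v i) (ℚₚ.*-identityˡ ((A · v) i)) ⟩
    t * v i + -1ℚ * (A · v) i ∎
    where open ≡-Reasoning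

  shift-quad : ∀ {N} (A : Matrixℚ N) t v → quad (shift A t) v ≡ t * normSq v + -1ℚ * quad A v
  shift-quad A t v = begin
    sumℚ (λ i → v i * (shift A t · v) i)
      ≡⟨ ∑ℚ.sum-cong-≗ (λ i → trans (cong (v i *_) (shift-· A t v i))
           (solve 3 (λ v t a → v :* (t :* v :+ con -1ℚ :* a) := t :* (v :* v) :+ con -1ℚ :* (v :* a))
             refl (v i) t ((A · v) i))) ⟩
    sumℚ (λ i → t * (v i * v i) + -1ℚ * (v i * (A · v) i))
      ≡⟨ ∑ℚ.∑-distrib-+ (λ i → t * (v i * v i)) (λ i → -1ℚ * (v i * (A · v) i)) ⟩
    sumℚ (λ i → t * (v i * v i)) + sumℚ (λ i → -1ℚ * (v i * (A · v) i))
      ≡⟨ cong₂ _+_ (sym (∑ℚ.*-distribˡ-sum t (λ i → v i * v i)))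
                   (sym (∑ℚ.*-distribˡ-sum -1ℚ (λ i → v i * (A · v) i))) ⟩
    t * normSq v + -1ℚ * quad A v ∎
    where open ≡-Reasoning

  shift-sym : ∀ {N} (A : Matrixℚ N) → Symmetric A → ∀ t → Symmetric (shift A t)
  shift-sym A sy t i j = cong₂ (λ a b → t * a + -1ℚ * b) (I-sym i j) (sy i j)

  -- Arithmetic and geometric mean: the product is at most the mean of the two squares, each of
  -- which is at most the norm. In this form the case `i ≡ j` is included.
  product≤normSq : ∀ {N} (v : Fin N → ℚ) i j → v i * v j ℚ.≤ normSq v
  product≤normSq v i j = ≤-diff {v i * v j}
    (½ * ((v i - v j) * (v i - v j) + (V - v i * v i) + (V - v j * v j)))
    (0≤* {½} (ℚₚ.nonNegative⁻¹ ½)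
      (0≤+ (0≤+ (0≤p² (v i - v j)) (0≤diff (square≤ i))) (0≤diff (square≤ j))))
    (solve 3 (λ a b V → V := a :* b :+ con ½ :* ((a :- b) :* (a :- b) :+ (V :- a :* a) :+ (V :- b :* b)))
      refl (v i) (v j) V)
    where
    V = normSq v
    square≤ : ∀ i → v i * v i ℚ.≤ V
    square≤ = term≤sum (λ i → v i * v i) (λ i → 0≤p² (v i))

  entrySum : ∀ {N} → Matrixℚ N → ℚ
  entrySum A = sumℚ (λ i → sumℚ (λ j → A i j))

  -- A crude bound on the Rayleigh quotient, whose purpose is to provide an upper end for the
  -- bisection.
  quad≤ : ∀ {N} (A : Matrixℚ N) → (∀ i j → 0ℚ ℚ.≤ A i j) → ∀ v →
    quad A v ℚ.≤ entrySum A * normSq v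
  quad≤ A 0≤A v = begin
    sumℚ (λ i → v i * sumℚ (λ j → A i j * v j))
      ≡⟨ ∑ℚ.sum-cong-≗ (λ i → trans (∑ℚ.*-distribˡ-sum (v i) (λ j → A i j * v j))
           (∑ℚ.sum-cong-≗ (λ j → swap-* (v i) (A i j) (v j)))) ⟩
    sumℚ (λ i → sumℚ (λ j → A i j * (v i * v j)))
      ≤⟨ sum-mono _ _ (λ i → sum-mono _ _ (λ j →
           ℚₚ.*-monoˡ-≤-nonNeg (A i j) {{ℚ.nonNegative (0≤A i j)}} (product≤normSq v i j))) ⟩
    sumℚ (λ i → sumℚ (λ j → A i j * V))
      ≡⟨ ∑ℚ.sum-cong-≗ (λ i → sym (∑ℚ.*-distribʳ-sum V (A i))) ⟩
    sumℚ (λ i → sumℚ (A i) * V)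
      ≡⟨ ∑ℚ.*-distribʳ-sum V (λ i → sumℚ (A i)) ⟨
    entrySum A * V ∎
    where
    open ℚₚ.≤-Reasoning
    V = normSq v

  p²≤0⇒p≡0 : ∀ p → p * p ℚ.≤ 0ℚ → p ≡ 0ℚ
  p²≤0⇒p≡0 p pp≤0 = ℚₚ.∣p∣≡0⇒p≡0 p (ℚₚ.≤-antisym (ℚₚ.≮⇒≥ ¬0<) (ℚₚ.0≤∣p∣ p))
    where
    ¬0< : ¬ (0ℚ ℚ.< ∣ p ∣)
    ¬0< 0<∣p∣ = ℚₚ.<-irrefl refl (ℚₚ.<-≤-trans (0<* 0<∣p∣ 0<∣p∣)
      (subst (ℚ._≤ 0ℚ) (trans (sym (ℚₚ.0≤p⇒∣p∣≡p (0≤p² p))) (ℚₚ.∣p*q∣≡∣p∣*∣q∣ p p)) pp≤0))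

  0<normSq : ∀ {N} (v : Fin N → ℚ) → ¬ (∀ i → v i ≡ 0ℚ) → 0ℚ ℚ.< normSq v
  0<normSq v v≢0 with 0ℚ ℚₚ.<? normSq v
  ... | yes lt = lt
  ... | no ¬lt = contradiction (λ i → p²≤0⇒p≡0 (v i)
    (ℚₚ.≤-trans (product≤normSq v i i) (ℚₚ.≮⇒≥ ¬lt))) v≢0

  shift-posDef : ∀ {N} (A : Matrixℚ N) → Symmetric A → (∀ i j → 0ℚ ℚ.≤ A i j) →
    ∀ t → entrySum A ℚ.< t → PosDef (shift A t)
  shift-posDef A sy 0≤A t R<t = quad>0⇒posDef (shift A t) (shift-sym A sy t) λ v v≢0 →
    subst (0ℚ ℚ.<_) (trans (rearrange R (normSq v) t (quad A v)) (sym (shift-quad A t v)))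
      (0<+ (0<* (0<diff R<t) (0<normSq v v≢0)) (0≤diff (quad≤ A 0≤A v)))
    where
    R = entrySum A
    rearrange : ∀ R V t B → (t - R) * V + (R * V - B) ≡ t * V + -1ℚ * B
    rearrange = solve 4 (λ R V t B → (t :- R) :* V :+ (R :* V :- B) := t :* V :+ con -1ℚ :* B) refl

  shift-¬posDef : ∀ {N} (A : Matrixℚ N) → Symmetric A → ∀ t v →
    t * normSq v ℚ.< quad A v → ¬ PosDef (shift A t)
  shift-¬posDef A sy t v lt pd = ℚₚ.<-irrefl refl (ℚₚ.<-≤-trans lt
    (≤-diff {quad A v} (t * normSq v + -1ℚ * quad A v)
      (subst (0ℚ ℚ.≤_) (shift-quad A t v) (posDef⇒quad≥0 (shift A t) (shift-sym A sy t) pd v))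
      (solve 2 (λ a b → a := b :+ (a :+ con -1ℚ :* b)) refl (t * normSq v) (quad A v))))

  -- `v` shows that the matrix shifted by `t` is not positive definite, whereas a large shift is. At
  -- the bisection limit either elimination yields a kernel vector, which is an eigenvector, or all
  -- late terms give positive definite matrices, and the lower ends among them exclude that. The
  -- eigenvalue exceeds `t` termwise because no interval reaches below `t`.
  eigenvalue-above : ∀ {N} (L : Matrix N) (A : Matrixℚ N) → (∀ n i j → at L n i j ≡ A i j) →
    Symmetric A → (∀ i j → 0ℚ ℚ.≤ A i j) →
    ∀ t → 0ℚ ℚ.≤ t → (v : Fin N → ℚ) → t * normSq v ℚ.< quad A v →
    ¬ (∀ ν → IsEigenvalue L ν → ¬ (∀ n → t ℚ.≤ seq ν n))
  eigenvalue-above {N} L A L≡A sy 0≤A t 0≤t v lt none =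
    kernel-or-posDef M (λ n → shift-sym A sy (Bis.approx n)) Bis.approx-P λ where
      (inj₁ ker) → none Bis.limit (eigen ker) (λ n → Bis.lo≤approx {0} {n} ℕ.z≤n)
      (inj₂ (K , pd)) → let n , K≤n , ¬pd = Bis.approx-¬P K in ¬pd (pd n K≤n)
    where
    0≤R : 0ℚ ℚ.≤ entrySum A
    0≤R = 0≤sum _ (λ i → 0≤sum _ (0≤A i))
    -- A sum of nonnegative terms, so that `hi` lies above both `t` and `entrySum A`.
    hi = t + (1ℚ + entrySum A)
    R<hi : entrySum A ℚ.< hi
    R<hi = <-diff {entrySum A} {hi} (1ℚ + t) (0<+ (ℚₚ.positive⁻¹ 1ℚ) 0≤t)
      (solve 2 (λ t R → t :+ (con 1ℚ :+ R) := R :+ (con 1ℚ :+ t)) refl t (entrySum A))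
    module Bis = Bisection (λ t → PosDef (shift A t)) (λ t → posDef? (shift A t)) t hi
      (≤-diff {t} {hi} (1ℚ + entrySum A) (0≤+ {1ℚ} (ℚₚ.nonNegative⁻¹ 1ℚ) 0≤R) refl)
      (shift-¬posDef A sy t v lt) (shift-posDef A sy 0≤A hi R<hi)
    M : Matrix N
    M i j = Bis.limit *ℝ fromℚ (I i j) +ℝ fromℚ -1ℚ *ℝ fromℚ (A i j)
    eigen : Kernel M → IsEigenvalue L Bis.limit
    eigen (w , w≉0 , Mw≈0) = w , w≉0 , λ i ε 0<ε → eventually-map
      (λ {n} → subst (ℚ._< ε) (trans (sym (ℚₚ.∣-p∣≡∣p∣ (seq (sumℝ (λ j → M i j *ℝ w j)) n)))
        (cong ∣_∣ (row i n))))
      (≈0⇒null (sumℝ (λ j → M i j *ℝ w j)) (Mw≈0 i) ε 0<ε)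
      where
      row : ∀ i n → - seq (sumℝ (λ j → M i j *ℝ w j)) n
        ≡ seq (sumℝ (λ j → L i j *ℝ w j)) n - Bis.approx n * seq (w i) n
      row i n = begin
        - seq (sumℝ (λ j → M i j *ℝ w j)) n
          ≡⟨ cong -_ (seq-sum (λ j → M i j *ℝ w j) n) ⟩
        - (shift A (Bis.approx n) · (λ j → seq (w j) n)) i
          ≡⟨ cong -_ (shift-· A (Bis.approx n) (λ j → seq (w j) n) i) ⟩
        - (Bis.approx n * seq (w i) n + -1ℚ * (A · (λ j → seq (w j) n)) i)
          ≡⟨ solve 2 (λ x y → :- (x :+ con -1ℚ :* y) := y :- x) refl
               (Bis.approx n * seq (w i) n) ((A · (λ j → seq (w j) n)) i) ⟩
        (A · (λ j → seq (w j) n)) i - Bis.approx n * seq (w i) n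
          ≡⟨ cong (_- Bis.approx n * seq (w i) n) (trans (seq-sum (λ j → L i j *ℝ w j) n)
               (∑ℚ.sum-cong-≗ (λ j → cong (_* seq (w j) n) (L≡A n i j)))) ⟨
        seq (sumℝ (λ j → L i j *ℝ w j)) n - Bis.approx n * seq (w i) n ∎
        where open ≡-Reasoning

  -- Integers that differ differ by at least 1, and 1/(V+1) times V stays below 1. The denominator
  -- is V+1 because V may be 0.
  gap : ∀ κ V B → κ ℕ.* V ℕ.< B → Σ[ δ ∈ ℚ ] 0ℚ ℚ.< δ × (ι κ + δ) * ι V ℚ.< ι B
  gap κ V B lt = δ , 0<δ , (begin-strict
    (ι κ + δ) * ι V             <⟨ <-diff {(ι κ + δ) * ι V} {ι κ * ι V + δ * (1ℚ + ι V)} δ 0<δ (expand (ι κ) δ (ι V)) ⟩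
    ι κ * ι V + δ * (1ℚ + ι V)  ≡⟨ cong (λ z → ι κ * ι V + δ * z) (ι-+ 1 V) ⟨
    ι κ * ι V + δ * ι (suc V)   ≡⟨ cong₂ _+_ (sym (ι-* κ V)) (ℚₚ.*-inverseˡ (ι (suc V))) ⟩
    ι (κ ℕ.* V) + 1ℚ            ≡⟨ ℚₚ.+-comm (ι (κ ℕ.* V)) 1ℚ ⟩
    1ℚ + ι (κ ℕ.* V)            ≡⟨ ι-+ 1 (κ ℕ.* V) ⟨
    ι (suc (κ ℕ.* V))           ≤⟨ ι-mono-≤ lt ⟩
    ι B                         ∎)
    where
    open ℚₚ.≤-Reasoning
    instance
      _ = ℚ.positive (0<ι-suc V)
      _ = ℚₚ.pos⇒nonZero (ι (suc V))
    δ : ℚ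
    δ = 1/ ι (suc V)
    0<δ : 0ℚ ℚ.< δ
    0<δ = ℚₚ.positive⁻¹ δ {{ℚₚ.1/pos⇒pos (ι (suc V))}}
    expand : ∀ κ δ V → κ * V + δ * (1ℚ + V) ≡ (κ + δ) * V + δ
    expand = solve 3 (λ κ δ V → κ :* V :+ δ :* (con 1ℚ :+ V) := (κ :+ δ) :* V :+ δ) refl

  ≤ℝ-trans-contradiction : ∀ ν q p δ → 0ℚ ℚ.< δ → ν ≤ℝ q → q ≤ℝ fromℚ p → ¬ (∀ n → p + δ ℚ.≤ seq ν n)
  ≤ℝ-trans-contradiction ν q p δ 0<δ ν≤q q≤p p+δ≤ν =
    -- A quarter of δ for each of the two comparisons leaves half of δ for the strict inequality.
    let ε = ½ * (½ * δ)
        0<ε = 0<½* {½ * δ} (0<½* 0<δ)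
        N₁ , ν≤ = ν≤q ε 0<ε
        N₂ , q≤ = q≤p ε 0<ε
        n = N₁ ⊔ N₂
    in ℚₚ.<-irrefl refl (ℚₚ.≤-<-trans {p + δ} {(p + ε) + ε} {p + δ}
         (ℚₚ.≤-trans (p+δ≤ν n) (ℚₚ.≤-trans (ν≤ n (ℕₚ.m≤m⊔n N₁ N₂))
           (ℚₚ.+-monoˡ-≤ ε (q≤ n (ℕₚ.m≤n⊔m N₁ N₂)))))
         (<-diff {(p + ε) + ε} {p + δ} (½ * δ) (0<½* 0<δ) (split p δ)))
    where
    split : ∀ p δ → p + δ ≡ (p + ½ * (½ * δ)) + ½ * (½ * δ) + ½ * δ
    split = solve 2 (λ p δ → p :+ δ := (p :+ con ½ :* (con ½ :* δ)) :+ con ½ :* (con ½ :* δ) :+ con ½ :* δ) refl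

  -- Being an inequality in ℕ, the conclusion can be proved by refuting its negation, so the doubly
  -- negated eigenvalue suffices. `gap` places that eigenvalue a fixed δ above κ, against `q≤κ`.
  rayleigh≤ : ∀ {N} (L : Matrix N) (A : Fin N → Fin N → ℕ) →
    (∀ n i j → at L n i j ≡ ι (A i j)) → (∀ i j → A i j ≡ A j i) →
    ∀ q κ → (∀ ν → IsEigenvalue L ν → ν ≤ℝ q) → q ≤ℝ fromℕℝ κ →
    (w : Fin N → ℕ) →
    sumℕ (λ i → w i ℕ.* sumℕ (λ j → A i j ℕ.* w j)) ℕ.≤ κ ℕ.* sumℕ (λ i → w i ℕ.* w i)
  rayleigh≤ {N} L A L≡A sy q κ largest q≤κ w = ℕₚ.≮⇒≥ λ lt → absurd (gap κ V B lt)
    where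
    B = sumℕ (λ i → w i ℕ.* sumℕ (λ j → A i j ℕ.* w j))
    V = sumℕ (λ i → w i ℕ.* w i)
    v : Fin N → ℚ
    v i = ι (w i)
    normSq-v : normSq v ≡ ι V
    normSq-v = trans (∑ℚ.sum-cong-≗ (λ i → sym (ι-* (w i) (w i)))) (sym (ι-sum (λ i → w i ℕ.* w i)))
    quad-v : quad (λ i j → ι (A i j)) v ≡ ι B
    quad-v = trans (∑ℚ.sum-cong-≗ (λ i → trans
        (cong (v i *_) (trans (∑ℚ.sum-cong-≗ (λ j → sym (ι-* (A i j) (w j)))) (sym (ι-sum (λ j → A i j ℕ.* w j)))))
        (sym (ι-* (w i) (sumℕ (λ j → A i j ℕ.* w j))))))
      (sym (ι-sum (λ i → w i ℕ.* sumℕ (λ j → A i j ℕ.* w j))))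
    absurd : ¬ (Σ[ δ ∈ ℚ ] 0ℚ ℚ.< δ × (ι κ + δ) * ι V ℚ.< ι B)
    absurd (δ , 0<δ , below) =
      eigenvalue-above L (λ i j → ι (A i j)) L≡A
        (λ i j → cong ι (sy i j)) (λ i j → 0≤ι (A i j)) (ι κ + δ) (0≤+ {ι κ} {δ} (0≤ι κ) (ℚₚ.<⇒≤ 0<δ)) v
        (subst₂ (λ a b → (ι κ + δ) * a ℚ.< b) (sym normSq-v) (sym quad-v) below)
        (λ ν eig → ≤ℝ-trans-contradiction ν q (ι κ) δ 0<δ (largest ν eig) q≤κ)

-- The signless Laplacian form and tight degree sums

module DegreeSums where

  open RayleighQuotients using (rayleigh≤)
  open import Algebra.Bundles using (CommutativeSemiring)
  import Algebra.Properties.Semiring.Sum as SemiringSum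
  open import Data.Nat.Base
  open import Data.Nat.Solver using () renaming (module +-*-Solver to ℕ-Solver)
  open import Data.Fin.Base using (splitAt; _↑ˡ_; _↑ʳ_)
  open import Data.Fin.Properties using (splitAt-↑ˡ; splitAt-↑ʳ) renaming (_≟_ to _≟F_)
  open import Data.Sum.Base using ([_,_]′)
  open import Relation.Nullary.Decidable using (⌊_⌋)

  module ∑ℕ = SemiringSum (CommutativeSemiring.semiring ℕₚ.+-*-commutativeSemiring)
  module NS = ℕ-Solver

  ⟦_⟧ : Bool → ℕ
  ⟦ b ⟧ = if b then 1 else 0

  sum-↑ : ∀ m {n} (f : Fin (m + n) → ℕ) →
    sumℕ f ≡ sumℕ (λ i → f (i ↑ˡ n)) + sumℕ (λ j → f (m ↑ʳ j))
  sum-↑ zero    f = refl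
  sum-↑ (suc m) {n} f = trans (cong (f zero +_) (sum-↑ m (λ i → f (suc i))))
    (sym (ℕₚ.+-assoc (f zero) (sumℕ (λ i → f (suc i ↑ˡ n))) (sumℕ (λ j → f (suc m ↑ʳ j)))))

  sumℕ-mono : ∀ {n} (f g : Fin n → ℕ) → (∀ i → f i ≤ g i) → sumℕ f ≤ sumℕ g
  sumℕ-mono {zero}  f g f≤g = z≤n
  sumℕ-mono {suc n} f g f≤g = ℕₚ.+-mono-≤ (f≤g zero) (sumℕ-mono _ _ (λ i → f≤g (suc i)))

  sum-squeeze : ∀ {n} (f g : Fin n → ℕ) → (∀ i → f i ≤ g i) → sumℕ g ≤ sumℕ f → ∀ i → f i ≡ g i
  sum-squeeze {suc n} f g f≤g g≤f = λ where
      zero    → ℕₚ.≤-antisym (f≤g zero) (ℕₚ.+-cancelʳ-≤ Σg (g zero) (f zero)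
                  (ℕₚ.≤-trans g≤f (ℕₚ.+-monoʳ-≤ (f zero) Σf≤Σg)))
      (suc i) → sum-squeeze _ _ (λ i → f≤g (suc i)) (ℕₚ.+-cancelˡ-≤ (f zero) Σg Σf
                  (ℕₚ.≤-trans (ℕₚ.+-monoˡ-≤ Σg (f≤g zero)) g≤f)) i
    where
    Σf = sumℕ (λ i → f (suc i))
    Σg = sumℕ (λ i → g (suc i))
    Σf≤Σg = sumℕ-mono (λ i → f (suc i)) (λ i → g (suc i)) (λ i → f≤g (suc i))

  sum-diagonal : ∀ {n} (i : Fin n) a (w : Fin n → ℕ) →
    sumℕ (λ j → (if ⌊ i ≟F j ⌋ then a else 0) * w j) ≡ a * w i
  sum-diagonal {suc n} zero a w = trans (cong (a * w zero +_) (∑ℕ.sum-replicate-zero n)) (ℕₚ.+-identityʳ _)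
  sum-diagonal {suc n} (suc i) a w = trans (∑ℕ.sum-cong-≗ same) (sum-diagonal i a (λ j → w (suc j)))
    where
    same : ∀ j → (if ⌊ suc i ≟F suc j ⌋ then a else 0) * w (suc j) ≡ (if ⌊ i ≟F j ⌋ then a else 0) * w (suc j)
    same j with i ≟F j
    ... | yes _ = refl
    ... | no  _ = refl

  degreeEntry-sym : ∀ {N} (G : Graph N) u v → degreeEntry G u v ≡ degreeEntry G v u
  degreeEntry-sym G u v with u ≟F v | v ≟F u
  ... | yes refl | yes _  = refl
  ... | yes refl | no v≢u = contradiction refl v≢u
  ... | no u≢v | yes refl = contradiction refl u≢v
  ... | no _   | no _     = refl

  -- The diagonal entry counts the neighbours of `u`, so `w u` can be charged once to each of them.
  signlessLaplacian-row : ∀ {N} (G : Graph N) (w : Fin N → ℕ) u →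
    sumℕ (λ v → (adjacencyEntry G u v + degreeEntry G u v) * w v)
      ≡ sumℕ (λ v → adjacencyEntry G u v * (w u + w v))
  signlessLaplacian-row G w u = begin
    sumℕ (λ v → (A v + degreeEntry G u v) * w v)
      ≡⟨ ∑ℕ.sum-cong-≗ (λ v → ℕₚ.*-distribʳ-+ (w v) (A v) (degreeEntry G u v)) ⟩
    sumℕ (λ v → A v * w v + degreeEntry G u v * w v)
      ≡⟨ ∑ℕ.∑-distrib-+ (λ v → A v * w v) (λ v → degreeEntry G u v * w v) ⟩
    sumℕ (λ v → A v * w v) + sumℕ (λ v → degreeEntry G u v * w v)
      ≡⟨ cong (sumℕ (λ v → A v * w v) +_) (trans (sum-diagonal u (degree G u) w) (∑ℕ.*-distribʳ-sum (w u) A)) ⟩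
    sumℕ (λ v → A v * w v) + sumℕ (λ v → A v * w u)
      ≡⟨ ∑ℕ.∑-distrib-+ (λ v → A v * w v) (λ v → A v * w u) ⟨
    sumℕ (λ v → A v * w v + A v * w u)
      ≡⟨ ∑ℕ.sum-cong-≗ (λ v → trans (sym (ℕₚ.*-distribˡ-+ (A v) (w v) (w u))) (cong (A v *_) (ℕₚ.+-comm (w v) (w u)))) ⟩
    sumℕ (λ v → A v * (w u + w v)) ∎
    where
    open ≡-Reasoning
    A = adjacencyEntry G u

  sum-zero : ∀ {n} (f : Fin n → ℕ) → (∀ i → f i ≡ 0) → sumℕ f ≡ 0
  sum-zero {n} f f≡0 = trans (∑ℕ.sum-cong-≗ f≡0) (∑ℕ.sum-replicate-zero n)

  bipartite-row-X : ∀ {n} (H : BipartiteGraph n n) x (f : Fin (n + n) → ℕ) →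
    sumℕ (λ v → adjacencyEntry (toGraph H) (x ↑ˡ n) v * f v) ≡ sumℕ (λ y → ⟦ edge H x y ⟧ * f (n ↑ʳ y))
  bipartite-row-X {n} H x f = trans (sum-↑ n _) (cong₂ _+_ (sum-zero _ X) (∑ℕ.sum-cong-≗ Y))
    where
    X : ∀ x' → ⟦ bipAdj H (splitAt n (x ↑ˡ n)) (splitAt n (x' ↑ˡ n)) ⟧ * f (x' ↑ˡ n) ≡ 0
    X x' rewrite splitAt-↑ˡ n x n | splitAt-↑ˡ n x' n = refl
    Y : ∀ y → ⟦ bipAdj H (splitAt n (x ↑ˡ n)) (splitAt n (n ↑ʳ y)) ⟧ * f (n ↑ʳ y) ≡ ⟦ edge H x y ⟧ * f (n ↑ʳ y)
    Y y rewrite splitAt-↑ˡ n x n | splitAt-↑ʳ n n y = refl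

  bipartite-row-Y : ∀ {n} (H : BipartiteGraph n n) y (f : Fin (n + n) → ℕ) →
    sumℕ (λ v → adjacencyEntry (toGraph H) (n ↑ʳ y) v * f v) ≡ sumℕ (λ x → ⟦ edge H x y ⟧ * f (x ↑ˡ n))
  bipartite-row-Y {n} H y f = trans (sum-↑ n _) (trans (cong₂ _+_ (∑ℕ.sum-cong-≗ X) (sum-zero _ Y)) (ℕₚ.+-identityʳ _))
    where
    X : ∀ x → ⟦ bipAdj H (splitAt n (n ↑ʳ y)) (splitAt n (x ↑ˡ n)) ⟧ * f (x ↑ˡ n) ≡ ⟦ edge H x y ⟧ * f (x ↑ˡ n)
    X x rewrite splitAt-↑ˡ n x n | splitAt-↑ʳ n n y = refl
    Y : ∀ y' → ⟦ bipAdj H (splitAt n (n ↑ʳ y)) (splitAt n (n ↑ʳ y')) ⟧ * f (n ↑ʳ y') ≡ 0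
    Y y' rewrite splitAt-↑ʳ n n y | splitAt-↑ʳ n n y' = refl

  rayleigh-graph : ∀ {N} (G : Graph N) q → IsSignlessSpectralRadius G q → ∀ κ → q ≤ℝ fromℕℝ κ →
    (w : Fin N → ℕ) →
    sumℕ (λ u → w u * sumℕ (λ v → adjacencyEntry G u v * (w u + w v))) ≤ κ * sumℕ (λ u → w u * w u)
  rayleigh-graph G q (_ , largest) κ q≤κ w = subst (_≤ κ * sumℕ (λ u → w u * w u))
    (∑ℕ.sum-cong-≗ (λ u → cong (w u *_) (signlessLaplacian-row G w u)))
    (rayleigh≤ (signlessLaplacian G) (λ u v → adjacencyEntry G u v + degreeEntry G u v) (λ _ _ _ → refl)
      (λ u v → cong₂ _+_ (cong ⟦_⟧ (symmetric G u v)) (degreeEntry-sym G u v)) q κ largest q≤κ w)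

  combine-rows : ∀ e a b → a * (e * (a + b)) + b * (e * (b + a)) ≡ e * ((a + b) * (a + b))
  combine-rows = NS.solve 3 (λ e a b →
    a NS.:* (e NS.:* (a NS.:+ b)) NS.:+ b NS.:* (e NS.:* (b NS.:+ a))
      NS.:= e NS.:* ((a NS.:+ b) NS.:* (a NS.:+ b))) refl

  -- An edge is met once from either end, and the two contributions a(a+b) and b(b+a) add up to the
  -- familiar square.
  edge-sum≤ : ∀ {n} (H : BipartiteGraph n n) q → IsSignlessSpectralRadius (toGraph H) q →
    ∀ κ → q ≤ℝ fromℕℝ κ → (a b : Fin n → ℕ) →
    sumℕ (λ x → sumℕ (λ y → ⟦ edge H x y ⟧ * ((a x + b y) * (a x + b y))))
      ≤ κ * (sumℕ (λ x → a x * a x) + sumℕ (λ y → b y * b y))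
  edge-sum≤ {n} H q radius κ q≤κ a b = subst₂ _≤_ lhs (cong (κ *_) rhs)
    (rayleigh-graph (toGraph H) q radius κ q≤κ w)
    where
    open ≡-Reasoning
    G = toGraph H
    w : Fin (n + n) → ℕ
    w u = [ a , b ]′ (splitAt n u)
    w-X : ∀ x → w (x ↑ˡ n) ≡ a x
    w-X x = cong [ a , b ]′ (splitAt-↑ˡ n x n)
    w-Y : ∀ y → w (n ↑ʳ y) ≡ b y
    w-Y y = cong [ a , b ]′ (splitAt-↑ʳ n n y)
    rhs : sumℕ (λ u → w u * w u) ≡ sumℕ (λ x → a x * a x) + sumℕ (λ y → b y * b y)
    rhs = trans (sum-↑ n (λ u → w u * w u)) (cong₂ _+_
      (∑ℕ.sum-cong-≗ (λ x → cong₂ _*_ (w-X x) (w-X x)))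
      (∑ℕ.sum-cong-≗ (λ y → cong₂ _*_ (w-Y y) (w-Y y))))
    row : Fin (n + n) → ℕ
    row u = w u * sumℕ (λ v → adjacencyEntry G u v * (w u + w v))
    e = λ x y → ⟦ edge H x y ⟧
    fX fY : Fin n → Fin n → ℕ
    fX x y = a x * (e x y * (a x + b y))
    fY y x = b y * (e x y * (b y + a x))
    row-X : ∀ x → row (x ↑ˡ n) ≡ sumℕ (fX x)
    row-X x = trans (cong₂ _*_ (w-X x) (trans (bipartite-row-X H x (λ v → w (x ↑ˡ n) + w v))
          (∑ℕ.sum-cong-≗ (λ y → cong₂ (λ p r → e x y * (p + r)) (w-X x) (w-Y y)))))
      (∑ℕ.*-distribˡ-sum (a x) (λ y → e x y * (a x + b y)))
    row-Y : ∀ y → row (n ↑ʳ y) ≡ sumℕ (fY y)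
    row-Y y = trans (cong₂ _*_ (w-Y y) (trans (bipartite-row-Y H y (λ v → w (n ↑ʳ y) + w v))
          (∑ℕ.sum-cong-≗ (λ x → cong₂ (λ p r → e x y * (p + r)) (w-Y y) (w-X x)))))
      (∑ℕ.*-distribˡ-sum (b y) (λ x → e x y * (b y + a x)))
    lhs : sumℕ row ≡ sumℕ (λ x → sumℕ (λ y → e x y * ((a x + b y) * (a x + b y))))
    lhs = begin
      sumℕ row
        ≡⟨ sum-↑ n row ⟩
      sumℕ (λ x → row (x ↑ˡ n)) + sumℕ (λ y → row (n ↑ʳ y))
        ≡⟨ cong₂ _+_ (∑ℕ.sum-cong-≗ row-X) (∑ℕ.sum-cong-≗ row-Y) ⟩
      sumℕ (λ x → sumℕ (fX x)) + sumℕ (λ y → sumℕ (fY y))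
        ≡⟨ cong (sumℕ (λ x → sumℕ (fX x)) +_) (∑ℕ.∑-comm fY) ⟩
      sumℕ (λ x → sumℕ (fX x)) + sumℕ (λ x → sumℕ (λ y → fY y x))
        ≡⟨ ∑ℕ.∑-distrib-+ (λ x → sumℕ (fX x)) (λ x → sumℕ (λ y → fY y x)) ⟨
      sumℕ (λ x → sumℕ (fX x) + sumℕ (λ y → fY y x))
        ≡⟨ ∑ℕ.sum-cong-≗ (λ x → trans (sym (∑ℕ.∑-distrib-+ (fX x) (λ y → fY y x)))
             (∑ℕ.sum-cong-≗ (λ y → combine-rows (e x y) (a x) (b y)))) ⟩
      sumℕ (λ x → sumℕ (λ y → e x y * ((a x + b y) * (a x + b y)))) ∎

  -- The spectral hypothesis, tested on natural vectors (a, b).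
  SpectralBound : ∀ {n} → (Fin n → Fin n → Bool) → Set
  SpectralBound {n} E = ∀ (a b : Fin n → ℕ) →
    sumℕ (λ x → sumℕ (λ y → ⟦ E x y ⟧ * ((a x + b y) * (a x + b y))))
      ≤ n * (sumℕ (λ x → a x * a x) + sumℕ (λ y → b y * b y))

  complement : ∀ {n} → (Fin n → Fin n → Bool) → Fin n → Fin n → Bool
  complement E u v = not (E u v)

  spectral-bound : ∀ {n} (G : BipartiteGraph n n) q →
    IsSignlessSpectralRadius (toGraph (quasiComplement G)) q → q ≤ℝ fromℕℝ n →
    SpectralBound (complement (edge G))
  spectral-bound {n} G q radius q≤n = edge-sum≤ (quasiComplement G) q radius n q≤n

  degX degY : ∀ {n} → (Fin n → Fin n → Bool) → Fin n → ℕ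
  degX F x = sumℕ (λ y → ⟦ F x y ⟧)
  degY F y = sumℕ (λ x → ⟦ F x y ⟧)

  -- Applied with Ê for `F` and Ĝ for `E`. Let σ be the degree sum in `F` of a pair. Then nσ ≤ σ² on
  -- `F` and 0 ≤ σ² elsewhere, while `bound`, tested on the degrees, reverses the inequality between
  -- the totals. So equality holds at every single pair.
  module TightEdges {n} (2≤n : 2 ≤ n) (F E : Fin n → Fin n → Bool)
    (F⊆E : ∀ x y → F x y ≡ true → E x y ≡ true)
    (large : ∀ x y → F x y ≡ true → n ≤ degX F x + degY F y)
    (bound : SpectralBound E) where

    private
      σ : Fin n → Fin n → ℕ
      σ x y = degX F x + degY F y
      f g : Fin n → Fin n → ℕ
      f x y = ⟦ F x y ⟧ * (n * σ x y)
      g x y = ⟦ E x y ⟧ * (σ x y * σ x y)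

      f≤g : ∀ x y → f x y ≤ g x y
      f≤g x y with F x y in eq
      ... | false = z≤n
      ... | true rewrite F⊆E x y eq = ℕₚ.+-monoˡ-≤ 0 (ℕₚ.*-monoˡ-≤ (σ x y) (large x y eq))

      -- With the degrees in F as weights, the right-hand side of edge-sum≤ is
      -- a sum over the edges of F.
      rhs : n * (sumℕ (λ x → degX F x * degX F x) + sumℕ (λ y → degY F y * degY F y))
        ≡ sumℕ (λ x → sumℕ (f x))
      rhs = begin
        n * (sumℕ (λ x → degX F x * degX F x) + sumℕ (λ y → degY F y * degY F y))
          ≡⟨ cong (n *_) (cong₂ _+_
               (∑ℕ.sum-cong-≗ (λ x → ∑ℕ.*-distribʳ-sum (degX F x) (λ y → ⟦ F x y ⟧)))
               (trans (∑ℕ.sum-cong-≗ (λ y → ∑ℕ.*-distribʳ-sum (degY F y) (λ x → ⟦ F x y ⟧)))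
                      (∑ℕ.∑-comm (λ y x → ⟦ F x y ⟧ * degY F y)))) ⟩
        n * (sumℕ (λ x → sumℕ (λ y → ⟦ F x y ⟧ * degX F x)) + sumℕ (λ x → sumℕ (λ y → ⟦ F x y ⟧ * degY F y)))
          ≡⟨ cong (n *_) (sym (∑ℕ.∑-distrib-+ (λ x → sumℕ (λ y → ⟦ F x y ⟧ * degX F x))
                                              (λ x → sumℕ (λ y → ⟦ F x y ⟧ * degY F y)))) ⟩
        n * sumℕ (λ x → sumℕ (λ y → ⟦ F x y ⟧ * degX F x) + sumℕ (λ y → ⟦ F x y ⟧ * degY F y))
          ≡⟨ ∑ℕ.*-distribˡ-sum n (λ x → sumℕ (λ y → ⟦ F x y ⟧ * degX F x) + sumℕ (λ y → ⟦ F x y ⟧ * degY F y)) ⟩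
        sumℕ (λ x → n * (sumℕ (λ y → ⟦ F x y ⟧ * degX F x) + sumℕ (λ y → ⟦ F x y ⟧ * degY F y)))
          ≡⟨ ∑ℕ.sum-cong-≗ (λ x → trans
               (cong (n *_) (sym (∑ℕ.∑-distrib-+ (λ y → ⟦ F x y ⟧ * degX F x) (λ y → ⟦ F x y ⟧ * degY F y))))
               (trans (∑ℕ.*-distribˡ-sum n (λ y → ⟦ F x y ⟧ * degX F x + ⟦ F x y ⟧ * degY F y))
                 (∑ℕ.sum-cong-≗ (λ y → NS.solve 4 (λ n e a b →
                     n NS.:* (e NS.:* a NS.:+ e NS.:* b) NS.:= e NS.:* (n NS.:* (a NS.:+ b)))
                   refl n ⟦ F x y ⟧ (degX F x) (degY F y))))) ⟩
        sumℕ (λ x → sumℕ (f x)) ∎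
        where open ≡-Reasoning

      f≡g : ∀ x y → f x y ≡ g x y
      f≡g x = sum-squeeze (f x) (g x) (f≤g x) (ℕₚ.≤-reflexive (sym (sums x)))
        where
        sums : ∀ x → sumℕ (f x) ≡ sumℕ (g x)
        sums = sum-squeeze (λ x → sumℕ (f x)) (λ x → sumℕ (g x))
          (λ x → sumℕ-mono (f x) (g x) (f≤g x))
          (subst (sumℕ (λ x → sumℕ (g x)) ≤_) rhs (bound (degX F) (degY F)))

    degree-sum-tight : ∀ x y → F x y ≡ true → degX F x + degY F y ≡ n
    degree-sum-tight x y eq = sym (ℕₚ.*-cancelʳ-≡ n (σ x y) (σ x y) {{>-nonZero 0<σ}}
      (ℕₚ.*-cancelˡ-≡ (n * σ x y) (σ x y * σ x y) 1
        (subst₂ (λ p r → ⟦ p ⟧ * (n * σ x y) ≡ ⟦ r ⟧ * (σ x y * σ x y)) eq (F⊆E x y eq) (f≡g x y))))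
      where
      0<σ : 0 < σ x y
      0<σ = ℕₚ.≤-trans (ℕₚ.≤-trans (s≤s z≤n) 2≤n) (large x y eq)

    -- Such a pair contributes nothing on the `F` side, so equality of the terms reads σ² = 0.
    extra-edge-isolated : ∀ x y → F x y ≡ false → E x y ≡ true →
      degX F x ≡ 0 × degY F y ≡ 0
    extra-edge-isolated x y eq eqH = ℕₚ.m+n≡0⇒m≡0 (degX F x) σ≡0 , ℕₚ.m+n≡0⇒n≡0 (degX F x) σ≡0
      where
      σσ≡0 : σ x y * σ x y ≡ 0
      σσ≡0 = trans (sym (ℕₚ.*-identityˡ _))
        (sym (subst₂ (λ p r → ⟦ p ⟧ * (n * σ x y) ≡ ⟦ r ⟧ * (σ x y * σ x y)) eq eqH (f≡g x y)))
      σ≡0 : σ x y ≡ 0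
      σ≡0 with ℕₚ.m*n≡0⇒m≡0∨n≡0 (σ x y) σσ≡0
      ... | inj₁ z = z
      ... | inj₂ z = z

-- Hamiltonian paths and cycles as position sequences, and their rotations

module HamiltonPaths where

  open import Data.Nat.Base
  open import Data.Fin.Base using (toℕ; punchOut)
  open import Data.Fin.Properties using (toℕ-injective; toℕ<n; any?; punchOut-injective; injective⇒≤) renaming (_≟_ to _≟F_)
  open import Function.Base using (_∘_)
  open import Relation.Binary.Definitions using (tri<; tri≈; tri>)

  Edges : ℕ → Set
  Edges n = Fin n → Fin n → Bool

  -- Vertices are listed by positions 0, …, l; values beyond l are irrelevant.
  -- The path is x 0, y 0, x 1, y 1, …, x l, y l.
  record IsPath {l} (E : Edges (suc l)) (x y : ℕ → Fin (suc l)) : Set where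
    field
      x-injective : ∀ {i j} → i ≤ l → j ≤ l → x i ≡ x j → i ≡ j
      y-injective : ∀ {i j} → i ≤ l → j ≤ l → y i ≡ y j → i ≡ j
      rung        : ∀ {i} → i ≤ l → E (x i) (y i) ≡ true
      next        : ∀ {i} → i < l → E (x (suc i)) (y i) ≡ true

  open IsPath public

  record IsCycle {l} (E : Edges (suc l)) (x y : ℕ → Fin (suc l)) : Set where
    field
      isPath  : IsPath E x y
      closing : E (x 0) (y l) ≡ true

  open IsCycle public

  HamiltonCycle : ∀ {l} → Edges (suc l) → Set
  HamiltonCycle E = ∃[ x ] ∃[ y ] IsCycle E x y

  record PositionMap (l : ℕ) (ρ : ℕ → ℕ) : Set where
    field
      preserves-≤ : ∀ {i} → i ≤ l → ρ i ≤ l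
      injective   : ∀ {i j} → i ≤ l → j ≤ l → ρ i ≡ ρ j → i ≡ j

  module _ {l} {ρ : ℕ → ℕ} (R : PositionMap l ρ) where
    open PositionMap R

    ∘-injective : ∀ {A : Set} {x : ℕ → A} → (∀ {i j} → i ≤ l → j ≤ l → x i ≡ x j → i ≡ j) →
      ∀ {i j} → i ≤ l → j ≤ l → x (ρ i) ≡ x (ρ j) → i ≡ j
    ∘-injective inj i≤l j≤l eq = injective i≤l j≤l (inj (preserves-≤ i≤l) (preserves-≤ j≤l) eq)

  -- Reversal of the first `m` positions, extended by the identity.
  flip : ℕ → ℕ → ℕ
  flip m k with k ℕₚ.<? m
  ... | yes _ = m ∸ suc k
  ... | no  _ = k

  flip-< : ∀ {m k} → k < m → flip m k ≡ m ∸ suc k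
  flip-< {m} {k} k<m with k ℕₚ.<? m
  ... | yes _  = refl
  ... | no k≮m = contradiction k<m k≮m

  flip-≥ : ∀ {m k} → m ≤ k → flip m k ≡ k
  flip-≥ {m} {k} m≤k with k ℕₚ.<? m
  ... | yes k<m = contradiction k<m (ℕₚ.≤⇒≯ m≤k)
  ... | no _    = refl

  suc-∸-suc : ∀ {m k} → k < m → suc (m ∸ suc k) ≡ m ∸ k
  suc-∸-suc {m} {k} k<m = sym (ℕₚ.+-∸-assoc 1 k<m)

  flip-involutive : ∀ m k → flip m (flip m k) ≡ k
  flip-involutive m k with k ℕₚ.<? m
  ... | no k≮m  = flip-≥ {m} {k} (ℕₚ.≮⇒≥ k≮m)
  flip-involutive (suc m) k | yes k<m = trans (flip-< {suc m} {m ∸ k} (s≤s (ℕₚ.m∸n≤m m k))) (ℕₚ.m∸[m∸n]≡n (ℕₚ.≤-pred k<m))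

  flip-map : ∀ {l m} → m ≤ suc l → PositionMap l (flip m)
  flip-map {l} {m} m≤ = record { preserves-≤ = preserves-≤ ; injective = injective }
    where
    preserves-≤ : ∀ {k} → k ≤ l → flip m k ≤ l
    preserves-≤ {k} k≤l with k ℕₚ.<? m
    ... | yes _ = ℕₚ.≤-trans (ℕₚ.∸-monoˡ-≤ (suc k) m≤) (ℕₚ.m∸n≤m l k)
    ... | no  _ = k≤l
    injective : ∀ {i j} → i ≤ l → j ≤ l → flip m i ≡ flip m j → i ≡ j
    injective {i} {j} _ _ eq = trans (sym (flip-involutive m i)) (trans (cong (flip m) eq) (flip-involutive m j))

  -- Pósa rotation: with the chord from `x 0` to `y i` the path becomes x_i y_{i-1} x_{i-1} ... y_0
  -- x_0 y_i x_{i+1} .... The reversed part has one more `x` than `y`, whence the different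
  -- arguments of `flip`.
  module Rotation {l} {E : Edges (suc l)} {x y : ℕ → Fin (suc l)} (P : IsPath E x y)
    {i} (i≤l : i ≤ l) (chord : E (x 0) (y i) ≡ true) where

    x′ y′ : ℕ → Fin (suc l)
    x′ = x ∘ flip (suc i)
    y′ = y ∘ flip i

    x′-≤ : ∀ {k} → k ≤ i → x′ k ≡ x (i ∸ k)
    x′-≤ k≤i = cong x (flip-< (s≤s k≤i))

    x′-> : ∀ {k} → i < k → x′ k ≡ x k
    x′-> i<k = cong x (flip-≥ i<k)

    y′-< : ∀ {k} → k < i → y′ k ≡ y (i ∸ suc k)
    y′-< k<i = cong y (flip-< k<i)

    y′-≥ : ∀ {k} → i ≤ k → y′ k ≡ y k
    y′-≥ i≤k = cong y (flip-≥ i≤k)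

    rotate : IsPath E x′ y′
    rotate .x-injective = ∘-injective (flip-map (s≤s i≤l)) (P .x-injective)
    rotate .y-injective = ∘-injective (flip-map (ℕₚ.m≤n⇒m≤1+n i≤l)) (P .y-injective)
    rotate .rung {k} k≤l with ℕₚ.<-cmp k i
    -- In the reversed part old `next` edges become rungs and old rungs become `next` edges; the
    -- chord is the rung at position `i`.
    ... | tri< k<i _ _ = trans
      (cong₂ E (trans (x′-≤ (ℕₚ.<⇒≤ k<i)) (cong x (sym (suc-∸-suc k<i)))) (y′-< k<i))
      (P .next (ℕₚ.<-≤-trans (subst (_≤ i) (sym (suc-∸-suc k<i)) (ℕₚ.m∸n≤m i k)) i≤l))
    ... | tri≈ _ refl _ = trans
      (cong₂ E (trans (x′-≤ ℕₚ.≤-refl) (cong x (ℕₚ.n∸n≡0 k))) (y′-≥ ℕₚ.≤-refl)) chord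
    ... | tri> _ _ i<k = trans (cong₂ E (x′-> i<k) (y′-≥ (ℕₚ.<⇒≤ i<k))) (P .rung k≤l)
    rotate .next {k} k<l with ℕₚ.<-≤-connex k i
    ... | inj₁ k<i = trans (cong₂ E (x′-≤ k<i) (y′-< k<i))
      (P .rung (ℕₚ.≤-trans (ℕₚ.m∸n≤m i (suc k)) i≤l))
    ... | inj₂ i≤k = trans (cong₂ E (x′-> (s≤s i≤k)) (y′-≥ i≤k)) (P .next k<l)

  transpose : ∀ {n} → Edges n → Edges n
  transpose E u v = E v u

  reverse-map : ∀ l → PositionMap l (l ∸_)
  reverse-map l = record
    { preserves-≤ = λ {i} _ → ℕₚ.m∸n≤m l i
    ; injective = λ i≤l j≤l eq → trans (sym (ℕₚ.m∸[m∸n]≡n i≤l)) (trans (cong (l ∸_) eq) (ℕₚ.m∸[m∸n]≡n j≤l))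
    }

  -- Read backwards, the path starts with `y l` and ends with `x 0`; exchanging the sides restores
  -- the pattern.
  transpose-path : ∀ {l} {E : Edges (suc l)} {x y} → IsPath E x y →
    IsPath (transpose E) (y ∘ (l ∸_)) (x ∘ (l ∸_))
  transpose-path {l} P .x-injective = ∘-injective (reverse-map l) (P .y-injective)
  transpose-path {l} P .y-injective = ∘-injective (reverse-map l) (P .x-injective)
  transpose-path {l} P .rung {i} _ = P .rung (ℕₚ.m∸n≤m l i)
  transpose-path {l} {E} {x} {y} P .next {i} i<l = subst (λ k → E (x k) (y (l ∸ suc i)) ≡ true) (suc-∸-suc i<l)
    (P .next (subst (_≤ l) (sym (suc-∸-suc i<l)) (ℕₚ.m∸n≤m l i)))

  transpose-cycle : ∀ {l} {E : Edges (suc l)} → HamiltonCycle (transpose E) → HamiltonCycle E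
  transpose-cycle {l} {E} (x , y , C) = y ∘ (l ∸_) , x ∘ (l ∸_) , record
    { isPath  = transpose-path (C .isPath)
    ; closing = subst (λ k → E (y l) (x k) ≡ true) (sym (ℕₚ.n∸n≡0 l)) (C .closing)
    }

  step : ℕ → ℕ → ℕ
  step l k with k ℕₚ.<? l
  ... | yes _ = suc k
  ... | no  _ = 0

  step-< : ∀ {l k} → k < l → step l k ≡ suc k
  step-< {l} {k} k<l with k ℕₚ.<? l
  ... | yes _  = refl
  ... | no k≮l = contradiction k<l k≮l

  step-last : ∀ l → step l l ≡ 0
  step-last l with l ℕₚ.<? l
  ... | yes l<l = contradiction l<l ℕₚ.1+n≰n
  ... | no _    = refl

  step-map : ∀ l → PositionMap l (step l)
  step-map l = record { preserves-≤ = preserves-≤ ; injective = injective }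
    where
    preserves-≤ : ∀ {k} → k ≤ l → step l k ≤ l
    preserves-≤ {k} k≤l with k ℕₚ.<? l
    ... | yes k<l = k<l
    ... | no  _   = z≤n
    injective : ∀ {i j} → i ≤ l → j ≤ l → step l i ≡ step l j → i ≡ j
    injective {i} {j} i≤l j≤l eq with i ℕₚ.<? l | j ℕₚ.<? l
    ... | yes _  | yes _  = ℕₚ.suc-injective eq
    ... | no i≮l | no j≮l = trans (ℕₚ.≤-antisym i≤l (ℕₚ.≮⇒≥ i≮l)) (ℕₚ.≤-antisym (ℕₚ.≮⇒≥ j≮l) j≤l)

  shift-cycle : ∀ {l} {E : Edges (suc l)} {x y} → 1 ≤ l → IsCycle E x y →
    IsCycle E (x ∘ step l) (y ∘ step l)
  shift-cycle {l} {E} {x} {y} 1≤l C = record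
    { isPath = record
      { x-injective = ∘-injective (step-map l) (C .isPath .x-injective)
      ; y-injective = ∘-injective (step-map l) (C .isPath .y-injective)
      ; rung = λ i≤l → C .isPath .rung (PositionMap.preserves-≤ (step-map l) i≤l)
      ; next = next′
      }
    ; closing = trans (cong₂ (λ a b → E (x a) (y b)) (step-< 1≤l) (step-last l)) (C .isPath .next 1≤l)
    }
    where
    next′ : ∀ {k} → k < l → E (x (step l (suc k))) (y (step l k)) ≡ true
    next′ {k} k<l with ℕₚ.m≤n⇒m<n∨m≡n k<l
    ... | inj₁ k+1<l = trans (cong₂ (λ a b → E (x a) (y b)) (step-< k+1<l) (step-< k<l)) (C .isPath .next k+1<l)
    ... | inj₂ refl  = trans (cong₂ (λ a b → E (x a) (y b)) (step-last l) (step-< k<l)) (C .closing)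

  shift-to : ∀ {l} {E : Edges (suc l)} {x y} → 1 ≤ l → IsCycle E x y → ∀ {k} → k ≤ l →
    ∃[ x′ ] ∃[ y′ ] IsCycle E x′ y′ × x′ 0 ≡ x k
  shift-to 1≤l C {zero} _ = _ , _ , C , refl
  shift-to {x = x} 1≤l C {suc k} k<l =
    let x′ , y′ , C′ , eq = shift-to 1≤l (shift-cycle 1≤l C) {k} (ℕₚ.<⇒≤ k<l)
    in x′ , y′ , C′ , trans eq (cong x (step-< k<l))

  backward : ℕ → ℕ → ℕ
  backward l zero    = 0
  backward l (suc k) = l ∸ k

  backward-map : ∀ l → PositionMap l (backward l)
  backward-map l = record { preserves-≤ = preserves-≤ ; injective = injective }
    where
    preserves-≤ : ∀ {k} → k ≤ l → backward l k ≤ l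
    preserves-≤ {zero}  _ = z≤n
    preserves-≤ {suc k} _ = ℕₚ.m∸n≤m l k
    injective : ∀ {i j} → i ≤ l → j ≤ l → backward l i ≡ backward l j → i ≡ j
    injective {zero}  {zero}  _ _ _ = refl
    injective {zero}  {suc j} _ j<l eq = contradiction (sym eq) (ℕₚ.m>n⇒m∸n≢0 j<l)
    injective {suc i} {zero}  i<l _ eq = contradiction eq (ℕₚ.m>n⇒m∸n≢0 i<l)
    injective {suc i} {suc j} i<l j<l eq = cong suc (PositionMap.injective (reverse-map l) (ℕₚ.<⇒≤ i<l) (ℕₚ.<⇒≤ j<l) eq)

  -- The other orientation of a cycle, with the same x 0; the hypotheses leave
  -- out the edge from x 0 to y 0, which becomes the closing edge.
  reverse-path : ∀ {l} {E : Edges (suc l)} {x y} →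
    (∀ {i j} → i ≤ l → j ≤ l → x i ≡ x j → i ≡ j) →
    (∀ {i j} → i ≤ l → j ≤ l → y i ≡ y j → i ≡ j) →
    (∀ {i} → 1 ≤ i → i ≤ l → E (x i) (y i) ≡ true) →
    (∀ {i} → i < l → E (x (suc i)) (y i) ≡ true) →
    E (x 0) (y l) ≡ true →
    IsPath E (x ∘ backward l) (y ∘ (l ∸_))
  reverse-path {l} {E} {x} {y} xi yi ru ne cl = record
    { x-injective = ∘-injective (backward-map l) xi
    ; y-injective = ∘-injective (reverse-map l) yi
    ; rung = rung′
    ; next = λ {i} i<l → ru (ℕₚ.m<n⇒0<n∸m i<l) (ℕₚ.m∸n≤m l i)
    }
    where
    rung′ : ∀ {i} → i ≤ l → E (x (backward l i)) (y (l ∸ i)) ≡ true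
    rung′ {zero}  _   = cl
    rung′ {suc i} i<l = subst (λ k → E (x k) (y (l ∸ suc i)) ≡ true) (suc-∸-suc i<l)
      (ne (subst (_≤ l) (sym (suc-∸-suc i<l)) (ℕₚ.m∸n≤m l i)))

  -- Pigeonhole principle: a missed value could be punched out of the codomain.
  injective⇒surjective : ∀ {n} (f : Fin n → Fin n) → (∀ {i j} → f i ≡ f j → i ≡ j) →
    ∀ v → ∃[ i ] f i ≡ v
  injective⇒surjective {suc n} f inj v with any? (λ i → f i ≟F v)
  ... | yes found = found
  ... | no missed = contradiction
    (injective⇒≤ {f = λ i → punchOut {i = v} (λ eq → missed (i , sym eq))}
      (λ {i} {j} eq → inj (punchOut-injective {i = v} _ _ eq))) ℕₚ.1+n≰n

  positions-surjective : ∀ {l} {x : ℕ → Fin (suc l)} →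
    (∀ {i j} → i ≤ l → j ≤ l → x i ≡ x j → i ≡ j) → ∀ v → ∃[ k ] k ≤ l × x k ≡ v
  positions-surjective {l} {x} inj v =
    let i , eq = injective⇒surjective (x ∘ toℕ) (λ {i} {j} eq →
          toℕ-injective (inj (ℕₚ.≤-pred (toℕ<n i)) (ℕₚ.≤-pred (toℕ<n j)) eq)) v
    in toℕ i , ℕₚ.≤-pred (toℕ<n i) , eq

  addEdge : ∀ {n} → Edges n → Fin n → Fin n → Edges n
  addEdge E a b u v with u ≟F a | v ≟F b
  ... | yes _ | yes _ = true
  ... | _     | _     = E u v

  addEdge-cases : ∀ {n} (E : Edges n) a b {u v} → addEdge E a b u v ≡ true →
    E u v ≡ true ⊎ (u ≡ a × v ≡ b)
  addEdge-cases E a b {u} {v} eq with u ≟F a | v ≟F b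
  ... | yes p | yes q = inj₂ (p , q)
  ... | yes _ | no _  = inj₁ eq
  ... | no _  | _     = inj₁ eq

  addEdge-⊇ : ∀ {n} (E : Edges n) a b {u v} → E u v ≡ true → addEdge E a b u v ≡ true
  addEdge-⊇ E a b {u} {v} eq with u ≟F a | v ≟F b
  ... | yes _ | yes _ = refl
  ... | yes _ | no _  = eq
  ... | no _  | _     = eq

  addEdge-new : ∀ {n} (E : Edges n) a b → addEdge E a b a b ≡ true
  addEdge-new E a b with a ≟F a | b ≟F b
  ... | yes _ | yes _ = refl
  ... | yes _ | no ≢  = contradiction refl ≢
  ... | no ≢  | _     = contradiction refl ≢

  -- With the cycle started at `a`, the new edge can occur only as the first rung or as the closing
  -- edge. As closing edge it is dropped, leaving the path; as first rung it becomes the closing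
  -- edge after reversing the orientation. It cannot be both, since `1 ≤ l` keeps `y 0` and `y l`
  -- distinct.
  cycle-through-edge : ∀ {l} {E : Edges (suc l)} {a b} → 1 ≤ l → HamiltonCycle (addEdge E a b) →
    HamiltonCycle E ⊎ (∃[ x ] ∃[ y ] IsPath E x y × x 0 ≡ a × y l ≡ b)
  cycle-through-edge {l} {E} {a} {b} 1≤l (x₀ , y₀ , C₀) with
    positions-surjective (C₀ .isPath .x-injective) a
  ... | k , k≤l , x₀k≡a with shift-to 1≤l C₀ k≤l
  ...   | x , y , C , x0≡x₀k = result (addEdge-cases E a b (C .isPath .rung z≤n)) (addEdge-cases E a b (C .closing))
    where
    P = C .isPath
    x0≡a : x 0 ≡ a
    x0≡a = trans x0≡x₀k x₀k≡a
    old : ∀ {i v} → 1 ≤ i → i ≤ l → addEdge E a b (x i) v ≡ true → E (x i) v ≡ true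
    old {suc i} _ i≤l eq with addEdge-cases E a b eq
    ... | inj₁ e          = e
    ... | inj₂ (xi≡a , _) = contradiction (P .x-injective i≤l z≤n (trans xi≡a (sym x0≡a))) λ ()
    next′ : ∀ {i} → i < l → E (x (suc i)) (y i) ≡ true
    next′ i<l = old (s≤s z≤n) i<l (P .next i<l)
    path : E (x 0) (y 0) ≡ true → IsPath E x y
    path e = record { x-injective = P .x-injective ; y-injective = P .y-injective ; next = next′ ; rung = rung′ }
      where
      rung′ : ∀ {i} → i ≤ l → E (x i) (y i) ≡ true
      rung′ {zero}  _   = e
      rung′ {suc i} i≤l = old (s≤s z≤n) i≤l (P .rung i≤l)
    result : E (x 0) (y 0) ≡ true ⊎ (x 0 ≡ a × y 0 ≡ b) → E (x 0) (y l) ≡ true ⊎ (x 0 ≡ a × y l ≡ b) →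
      HamiltonCycle E ⊎ (∃[ x ] ∃[ y ] IsPath E x y × x 0 ≡ a × y l ≡ b)
    result (inj₁ e) (inj₁ e′) = inj₁ (x , y , record { isPath = path e ; closing = e′ })
    result (inj₁ e) (inj₂ (_ , yl≡b)) = inj₂ (x , y , path e , x0≡a , yl≡b)
    result (inj₂ (_ , y0≡b)) (inj₁ e′) = inj₂ (x ∘ backward l , y ∘ (l ∸_)
      , reverse-path (P .x-injective) (P .y-injective) (λ 1≤i i≤l → old 1≤i i≤l (P .rung i≤l)) next′ e′
      , x0≡a , trans (cong y (ℕₚ.n∸n≡0 l)) y0≡b)
    result (inj₂ (_ , y0≡b)) (inj₂ (_ , yl≡b)) =
      contradiction (P .y-injective z≤n ℕₚ.≤-refl (trans y0≡b (sym yl≡b))) (ℕₚ.<⇒≢ 1≤l)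

  _⊑_ : ∀ {n} → Edges n → Edges n → Set
  E ⊑ E′ = ∀ u v → E u v ≡ true → E′ u v ≡ true

  subgraph-cycle : ∀ {l} {E E′ : Edges (suc l)} → E ⊑ E′ →
    HamiltonCycle E → HamiltonCycle E′
  subgraph-cycle E⊑E′ (x , y , C) = x , y , record
    { isPath = record
      { x-injective = C .isPath .x-injective
      ; y-injective = C .isPath .y-injective
      ; rung = λ i≤l → E⊑E′ _ _ (C .isPath .rung i≤l)
      ; next = λ i<l → E⊑E′ _ _ (C .isPath .next i<l)
      }
    ; closing = E⊑E′ _ _ (C .closing)
    }

-- Edge-maximal non-Hamiltonian supergraphs

module Saturation where

  open HamiltonPaths
  open import Data.Bool.Properties using () renaming (_≟_ to _≟B_)
  open import Data.Nat.Base
  open import Data.Nat.DivMod using (_mod_; m<n⇒m%n≡m; m%n<n)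
  open import Data.Fin.Base using (toℕ)
  open import Data.Fin.Properties using (toℕ-fromℕ<; any?) renaming (_≟_ to _≟F_)
  open import Data.List.Base using (List; []; _∷_; allFin; cartesianProduct)
  open import Data.List.Membership.Propositional using (_∈_)
  open import Data.List.Membership.Propositional.Properties using (∈-allFin; ∈-cartesianProduct⁺)
  open import Data.List.Relation.Unary.Any using (here; there)
  open import Data.Vec.Base using (Vec; []; _∷_; lookup; tabulate)
  open import Data.Vec.Properties using (lookup∘tabulate)
  open import Function.Base using (_∘_)
  open import Relation.Nullary.Decidable using (_×-dec_; _→-dec_; map′)
  open import Relation.Unary using (Decidable)

  anyVec? : ∀ {n} m {P : Vec (Fin n) m → Set} → Decidable P → Dec (∃[ v ] P v)
  anyVec? zero    P? = map′ ([] ,_) (λ { ([] , p) → p }) (P? [])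
  anyVec? (suc m) P? = map′ (λ (i , v , p) → i ∷ v , p) (λ { (i ∷ v , p) → i , v , p })
    (any? (λ i → anyVec? m (λ v → P? (i ∷ v))))

  -- Extends a finite list to all of ℕ by wrapping around. Cycles depend only on positions up to
  -- `l`, so a search over lists is a search over all sequences.
  index : ∀ {l} → Vec (Fin (suc l)) (suc l) → ℕ → Fin (suc l)
  index {l} v i = lookup v (i mod suc l)

  index-tabulate : ∀ {l} (x : ℕ → Fin (suc l)) {i} → i ≤ l → index (tabulate (x ∘ toℕ)) i ≡ x i
  index-tabulate {l} x {i} i≤l = trans (lookup∘tabulate (x ∘ toℕ) (i mod suc l))
    (cong x (trans (toℕ-fromℕ< (m%n<n i (suc l))) (m<n⇒m%n≡m (s≤s i≤l))))

  cycle-cong : ∀ {l} {E : Edges (suc l)} {x y x′ y′} →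
    (∀ {i} → i ≤ l → x′ i ≡ x i) → (∀ {i} → i ≤ l → y′ i ≡ y i) → IsCycle E x y → IsCycle E x′ y′
  cycle-cong {E = E} x≗ y≗ C = record
    { isPath = record
      { x-injective = λ i≤l j≤l eq → P .x-injective i≤l j≤l (trans (sym (x≗ i≤l)) (trans eq (x≗ j≤l)))
      ; y-injective = λ i≤l j≤l eq → P .y-injective i≤l j≤l (trans (sym (y≗ i≤l)) (trans eq (y≗ j≤l)))
      ; rung = λ i≤l → trans (cong₂ E (x≗ i≤l) (y≗ i≤l)) (P .rung i≤l)
      ; next = λ i<l → trans (cong₂ E (x≗ i<l) (y≗ (ℕₚ.<⇒≤ i<l))) (P .next i<l)
      }
    ; closing = trans (cong₂ E (x≗ z≤n) (y≗ ℕₚ.≤-refl)) (C .closing)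
    }
    where P = C .isPath

  all<? : ∀ {P : ℕ → Set} → Decidable P → ∀ l → Dec (∀ i → i < l → P i)
  all<? P? l = map′ (λ f i i<l → f {i} i<l) (λ f {i} i<l → f i i<l) (ℕₚ.allUpTo? P? l)

  injective? : ∀ {l} (x : ℕ → Fin (suc l)) →
    Dec (∀ i → i < suc l → ∀ j → j < suc l → x i ≡ x j → i ≡ j)
  injective? {l} x = all<? (λ i → all<? (λ j → (x i ≟F x j) →-dec (i ℕₚ.≟ j)) (suc l)) (suc l)

  cycle? : ∀ {l} (E : Edges (suc l)) x y → Dec (IsCycle E x y)
  cycle? {l} E x y = map′
    (λ (xi , yi , ru , ne , cl) → record
      { isPath = record
        { x-injective = λ i≤l j≤l → xi _ (s≤s i≤l) _ (s≤s j≤l)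
        ; y-injective = λ i≤l j≤l → yi _ (s≤s i≤l) _ (s≤s j≤l)
        ; rung = λ i≤l → ru _ (s≤s i≤l)
        ; next = λ i<l → ne _ i<l }
      ; closing = cl })
    (λ C → (λ _ i<n _ j<n → C .isPath .x-injective (ℕₚ.≤-pred i<n) (ℕₚ.≤-pred j<n))
         , (λ _ i<n _ j<n → C .isPath .y-injective (ℕₚ.≤-pred i<n) (ℕₚ.≤-pred j<n))
         , (λ _ i<n → C .isPath .rung (ℕₚ.≤-pred i<n))
         , (λ _ → C .isPath .next) , C .closing)
    (injective? x ×-dec injective? y
      ×-dec all<? (λ i → E (x i) (y i) ≟B true) (suc l)
      ×-dec all<? (λ i → E (x (suc i)) (y i) ≟B true) l
      ×-dec (E (x 0) (y l) ≟B true))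

  hamiltonCycle? : ∀ {l} (E : Edges (suc l)) → Dec (HamiltonCycle E)
  hamiltonCycle? {l} E = map′
    (λ (u , v , C) → index u , index v , C)
    (λ (x , y , C) → tabulate (x ∘ toℕ) , tabulate (y ∘ toℕ) , cycle-cong (index-tabulate x) (index-tabulate y) C)
    (anyVec? (suc l) (λ u → anyVec? (suc l) (λ v → cycle? E (index u) (index v))))

  addEdge-mono : ∀ {n} {E E′ : Edges n} a b → E ⊑ E′ → addEdge E a b ⊑ addEdge E′ a b
  addEdge-mono {E = E} {E′} a b E⊑E′ u v eq with addEdge-cases E a b {u} {v} eq
  ... | inj₁ e             = addEdge-⊇ E′ a b (E⊑E′ u v e)
  ... | inj₂ (refl , refl) = addEdge-new E′ a b

  -- A single greedy pass is enough: a pair rejected because it would create a Hamiltonian cycle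
  -- would still create one after further edges have been added.
  saturate : ∀ {l} (pairs : List (Fin (suc l) × Fin (suc l))) (E : Edges (suc l)) → ¬ HamiltonCycle E →
    ∃[ E′ ] E ⊑ E′ × ¬ HamiltonCycle E′ ×
      (∀ {a b} → (a , b) ∈ pairs → E′ a b ≡ false → HamiltonCycle (addEdge E′ a b))
  saturate [] E ¬ham = E , (λ _ _ e → e) , ¬ham , λ ()
  saturate ((a , b) ∷ pairs) E ¬ham with hamiltonCycle? (addEdge E a b)
  ... | yes ham = let E′ , E⊑E′ , ¬ham′ , sat = saturate pairs E ¬ham
    in E′ , E⊑E′ , ¬ham′ , λ where
      (here refl) _ → subgraph-cycle (addEdge-mono a b E⊑E′) ham
      (there p)     → sat p
  ... | no ¬ham⁺ = let E′ , E⁺⊑E′ , ¬ham′ , sat = saturate pairs (addEdge E a b) ¬ham⁺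
    in E′ , (λ u v e → E⁺⊑E′ u v (addEdge-⊇ E a b e)) , ¬ham′ , λ where
      (here refl) e → contradiction (trans (sym (E⁺⊑E′ a b (addEdge-new E a b))) e) λ ()
      (there p)     → sat p

  maximal-nonhamiltonian : ∀ {l} → 1 ≤ l → (E : Edges (suc l)) → ¬ HamiltonCycle E →
    ∃[ E′ ] E ⊑ E′ × ¬ HamiltonCycle E′ ×
      (∀ {a b} → E′ a b ≡ false → ∃[ x ] ∃[ y ] IsPath E′ x y × x 0 ≡ a × y l ≡ b)
  maximal-nonhamiltonian {l} 1≤l E ¬ham =
    let E′ , E⊑E′ , ¬ham′ , sat = saturate (cartesianProduct (allFin (suc l)) (allFin (suc l))) E ¬ham
    in E′ , E⊑E′ , ¬ham′ , λ {a} {b} e →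
      resolve ¬ham′ (cycle-through-edge 1≤l (sat (∈-cartesianProduct⁺ (∈-allFin a) (∈-allFin b)) e))
    where
    resolve : ∀ {A B : Set} → ¬ A → A ⊎ B → B
    resolve ¬a (inj₁ a) = contradiction a ¬a
    resolve ¬a (inj₂ b) = b

  complete-cycle : ∀ {l} (E : Edges (suc l)) → (∀ u v → E u v ≡ true) → HamiltonCycle E
  complete-cycle {l} E all = (_mod suc l) , (_mod suc l) , record
    { isPath = record { x-injective = inj ; y-injective = inj ; rung = λ _ → all _ _ ; next = λ _ → all _ _ }
    ; closing = all _ _
    }
    where
    toℕ-mod : ∀ {i} → i ≤ l → toℕ (i mod suc l) ≡ i
    toℕ-mod {i} i≤l = trans (toℕ-fromℕ< (m%n<n i (suc l))) (m<n⇒m%n≡m (s≤s i≤l))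
    inj : ∀ {i j} → i ≤ l → j ≤ l → i mod suc l ≡ j mod suc l → i ≡ j
    inj i≤l j≤l eq = trans (sym (toℕ-mod i≤l)) (trans (cong toℕ eq) (toℕ-mod j≤l))

-- The crossing argument and the effect of rotations on words

module Rotations where

  open HamiltonPaths
  open DegreeSums using (⟦_⟧; degX; degY; sum-squeeze; sumℕ-mono; module ∑ℕ)
  open import Data.Bool.Properties using (not-injective)
  open import Data.Nat.Base
  open import Data.Fin.Base using (toℕ; fromℕ<)
  open import Data.Fin.Properties using (toℕ-injective; toℕ<n; toℕ-fromℕ<)
  open import Function.Base using (_∘_)
  open import Function.Bundles using (_↔_; mk↔ₛ′)

  injective⇒↔ : ∀ {n} (f : Fin n → Fin n) → (∀ {i j} → f i ≡ f j → i ≡ j) → Fin n ↔ Fin n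
  injective⇒↔ f inj = mk↔ₛ′ f (λ v → proj₁ (sur v)) (λ v → proj₂ (sur v)) (λ i → inj (proj₂ (sur (f i))))
    where sur = injective⇒surjective f inj

  toℕ-injective-≤ : ∀ {l} {A : Set} {x : ℕ → A} → (∀ {i j} → i ≤ l → j ≤ l → x i ≡ x j → i ≡ j) →
    ∀ {i j : Fin (suc l)} → x (toℕ i) ≡ x (toℕ j) → i ≡ j
  toℕ-injective-≤ inj {i} {j} eq = toℕ-injective (inj (ℕₚ.≤-pred (toℕ<n i)) (ℕₚ.≤-pred (toℕ<n j)) eq)

  sum-positions : ∀ {l} {x : ℕ → Fin (suc l)} → (∀ {i j} → i ≤ l → j ≤ l → x i ≡ x j → i ≡ j) →
    (f : Fin (suc l) → ℕ) → sumℕ f ≡ sumℕ {suc l} (λ i → f (x (toℕ i)))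
  sum-positions {x = x} inj f = ∑ℕ.sum-permute f (injective⇒↔ (x ∘ toℕ) (toℕ-injective-≤ inj))

  sum-ones : ∀ n → sumℕ {n} (λ _ → 1) ≡ n
  sum-ones zero    = refl
  sum-ones (suc n) = cong suc (sum-ones n)

  -- The path rotated at the chord runs from `x i` to `y l`, so an edge between these would close
  -- it.
  crossing : ∀ {l} {E : Edges (suc l)} {x y} → ¬ HamiltonCycle E → IsPath E x y →
    ∀ {i} → i ≤ l → E (x 0) (y i) ≡ true → E (x i) (y l) ≡ false
  crossing {l} {E} {x} {y} ¬ham P {i} i≤l chord with E (x i) (y l) in eq
  ... | false = refl
  ... | true  = contradiction (x′ , y′ , record
      { isPath = rotate
      ; closing = trans (cong₂ E (x′-≤ z≤n) (y′-≥ i≤l)) eq }) ¬ham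
    where open Rotation P i≤l chord

  module _ {l} {E : Edges (suc l)} {x y} (¬ham : ¬ HamiltonCycle E) (P : IsPath E x y) where

    private
      ends : Fin (suc l) → ℕ
      ends i = ⟦ E (x 0) (y (toℕ i)) ⟧ + ⟦ E (x (toℕ i)) (y l) ⟧

      ends≤1 : ∀ i → ends i ≤ 1
      ends≤1 i with E (x 0) (y (toℕ i)) in eq
      ... | true rewrite crossing ¬ham P (ℕₚ.≤-pred (toℕ<n i)) eq = ℕₚ.≤-refl
      ... | false with E (x (toℕ i)) (y l)
      ...   | true  = ℕₚ.≤-refl
      ...   | false = z≤n

      sum-ends : sumℕ ends ≡ degX E (x 0) + degY E (y l)
      sum-ends = trans (∑ℕ.∑-distrib-+ {suc l} (λ i → ⟦ E (x 0) (y (toℕ i)) ⟧) (λ i → ⟦ E (x (toℕ i)) (y l) ⟧))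
        (sym (cong₂ _+_ (sum-positions (P .y-injective) (λ v → ⟦ E (x 0) v ⟧))
                        (sum-positions (P .x-injective) (λ u → ⟦ E u (y l) ⟧))))

    end-degrees≤ : degX E (x 0) + degY E (y l) ≤ suc l
    end-degrees≤ = subst₂ _≤_ sum-ends (sum-ones (suc l)) (sumℕ-mono ends (λ _ → 1) ends≤1)

    -- Each of the `suc l` positions contributes at most one of the two crossing edges, so a total
    -- of `suc l` forces exactly one at every position.
    last-column′ : degX E (x 0) + degY E (y l) ≡ suc l → ∀ {i} → i ≤ l →
      E (x i) (y l) ≡ not (E (x 0) (y i))
    last-column′ tight {i} i≤l = decode (E (x 0) (y i)) (E (x i) (y l))
      (subst (λ k → ⟦ E (x 0) (y k) ⟧ + ⟦ E (x k) (y l) ⟧ ≡ 1) (toℕ-fromℕ< (s≤s i≤l))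
        (sum-squeeze ends (λ _ → 1) ends≤1
          (ℕₚ.≤-reflexive (trans (sum-ones (suc l)) (trans (sym tight) (sym sum-ends)))) (fromℕ< (s≤s i≤l))))
      where
      decode : ∀ a b → ⟦ a ⟧ + ⟦ b ⟧ ≡ 1 → b ≡ not a
      decode true  false _ = refl
      decode false true  _ = refl

  record Extremal {l} (E : Edges (suc l)) : Set where
    field
      nonhamiltonian : ¬ HamiltonCycle E
      tight          : ∀ u v → E u v ≡ false → degX E u + degY E v ≡ suc l

  open Extremal

  transpose-extremal : ∀ {l} {E : Edges (suc l)} → Extremal E → Extremal (transpose E)
  transpose-extremal ext .nonhamiltonian ham = ext .nonhamiltonian (transpose-cycle ham)
  transpose-extremal {E = E} ext .tight u v e = trans (ℕₚ.+-comm (degY E u) (degX E v)) (ext .tight v u e)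

  record OpenPath {l} (E : Edges (suc l)) : Set where
    field
      x y   : ℕ → Fin (suc l)
      path  : IsPath E x y
      apart : E (x 0) (y l) ≡ false

  open OpenPath

  transpose-open : ∀ {l} {E : Edges (suc l)} → OpenPath E → OpenPath (transpose E)
  transpose-open {l} O .x = O .y ∘ (l ∸_)
  transpose-open {l} O .y = O .x ∘ (l ∸_)
  transpose-open O .path = transpose-path (O .path)
  transpose-open {l} {E} O .apart = subst (λ k → E (O .x k) (O .y l) ≡ false) (sym (ℕₚ.n∸n≡0 l)) (O .apart)

  word : ∀ {l} {E : Edges (suc l)} → OpenPath E → ℕ → Bool
  word {E = E} O j = E (O .x 0) (O .y j)

  word-0 : ∀ {l} {E : Edges (suc l)} (O : OpenPath E) → word O 0 ≡ true
  word-0 O = O .path .rung z≤n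

  module _ {l} {E : Edges (suc l)} (ext : Extremal E) where

    last-column : ∀ (O : OpenPath E) {i} → i ≤ l → E (O .x i) (O .y l) ≡ not (word O i)
    last-column O = last-column′ (ext .nonhamiltonian) (O .path) (ext .tight _ _ (O .apart))

    module _ (O : OpenPath E) {i} (i≤l : i ≤ l) (Si : word O i ≡ true) where
      open Rotation (O .path) i≤l Si

      -- The new ends `x i` and `y l` are again non-adjacent, because the column of `y l` is the
      -- complement of the word and the word has S at `i`.
      rotated : OpenPath E
      rotated .x = x′
      rotated .y = y′
      rotated .path = rotate
      rotated .apart = trans (cong₂ E (x′-≤ z≤n) (y′-≥ i≤l)) (trans (last-column O i≤l) (cong not Si))

      private
        rotated-column : ∀ {j} → j ≤ l → E (x′ j) (O .y l) ≡ not (E (O .x i) (y′ j))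
        rotated-column {j} j≤l = subst₂ (λ a b → E (x′ j) a ≡ not (E b (y′ j))) (y′-≥ i≤l) (x′-≤ z≤n)
          (last-column rotated j≤l)

      -- The column of `y l` complements the row of `x 0` along the old path and the row of `x i`
      -- along the rotated one. Everything after position `i` stays in place, so the two rows agree
      -- there.
      row-right : ∀ {j} → i < j → j ≤ l → E (O .x i) (O .y j) ≡ word O j
      row-right {j} i<j j≤l = not-injective (trans
        (sym (subst₂ (λ a b → E a (O .y l) ≡ not (E (O .x i) b)) (x′-> i<j) (y′-≥ (ℕₚ.<⇒≤ i<j)) (rotated-column j≤l)))
        (last-column O j≤l))

      -- The same comparison in the reversed part, where `y m` shares its new position `i ∸ suc m`
      -- with `x (suc m)`; hence the shift by one.
      row-left : ∀ {m} → m < i → E (O .x i) (O .y m) ≡ word O (suc m)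
      row-left {m} m<i = not-injective (trans
        (sym (subst₂ (λ a b → E a (O .y l) ≡ not (E (O .x i) b)) x′-k y′-k (rotated-column k≤l)))
        (last-column O (ℕₚ.≤-trans m<i i≤l)))
        where
        k = i ∸ suc m
        k<i : k < i
        k<i = subst (_≤ i) (sym (suc-∸-suc m<i)) (ℕₚ.m∸n≤m i m)
        k≤l = ℕₚ.≤-trans (ℕₚ.<⇒≤ k<i) i≤l
        x′-k : x′ k ≡ O .x (suc m)
        x′-k = trans (x′-≤ (ℕₚ.<⇒≤ k<i)) (cong (O .x) (ℕₚ.m∸[m∸n]≡n m<i))
        y′-k : y′ k ≡ O .y m
        y′-k = trans (y′-< k<i) (cong (O .y) (trans (cong (i ∸_) (suc-∸-suc m<i)) (ℕₚ.m∸[m∸n]≡n (ℕₚ.<⇒≤ m<i))))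

      -- Reversing the first `y`s and the shift in `row-left` combine to an exact reversal of the
      -- letters 0 to `i`.
      rotated-word-≤ : ∀ {j} → j ≤ i → word rotated j ≡ word O (i ∸ j)
      rotated-word-≤ {j} j≤i with ℕₚ.m≤n⇒m<n∨m≡n j≤i
      ... | inj₁ j<i = trans (cong₂ E (x′-≤ z≤n) (y′-< j<i))
        (trans (row-left (subst (_≤ i) (sym (suc-∸-suc j<i)) (ℕₚ.m∸n≤m i j))) (cong (word O) (suc-∸-suc j<i)))
      ... | inj₂ refl = trans (cong₂ E (x′-≤ z≤n) (y′-≥ ℕₚ.≤-refl))
        (trans (O .path .rung i≤l) (sym (trans (cong (word O) (ℕₚ.n∸n≡0 j)) (word-0 O))))

      rotated-word-> : ∀ {j} → i < j → j ≤ l → word rotated j ≡ word O j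
      rotated-word-> i<j j≤l = trans (cong₂ E (x′-≤ z≤n) (y′-≥ (ℕₚ.<⇒≤ i<j))) (row-right i<j j≤l)

    -- Two computations of the row of x i′: directly, and after rotating at i.
    adjacent-letters : ∀ (O : OpenPath E) {i i′} → i < i′ → i′ ≤ l → word O i ≡ true → word O i′ ≡ true →
      ∀ {m} → m < i → word O m ≡ word O (suc m)
    adjacent-letters O {i} {i′} i<i′ i′≤l Si Si′ {m} m<i = begin
      word O m                            ≡⟨ cong (word O) (ℕₚ.m∸[m∸n]≡n (ℕₚ.<⇒≤ m<i)) ⟨
      word O (i ∸ (i ∸ m))                ≡⟨ rotated-word-≤ O i≤l Si (ℕₚ.m∸n≤m i m) ⟨
      word O′ (i ∸ m)                     ≡⟨ cong (word O′) (suc-∸-suc m<i) ⟨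
      word O′ (suc j)                     ≡⟨ row-left O′ i′≤l Si′-rotated (ℕₚ.<-trans j<i i<i′) ⟨
      E (O′ .x i′) (O′ .y j)              ≡⟨ cong₂ E (R.x′-> i<i′) (trans (R.y′-< j<i)
                                               (cong (O .y) (trans (cong (i ∸_) (suc-∸-suc m<i)) (ℕₚ.m∸[m∸n]≡n (ℕₚ.<⇒≤ m<i))))) ⟩
      E (O .x i′) (O .y m)                ≡⟨ row-left O i′≤l Si′ (ℕₚ.<-trans m<i i<i′) ⟩
      word O (suc m)                      ∎
      where
      open ≡-Reasoning
      i≤l = ℕₚ.≤-trans (ℕₚ.<⇒≤ i<i′) i′≤l
      module R = Rotation (O .path) i≤l Si
      O′ = rotated O i≤l Si
      Si′-rotated : word O′ i′ ≡ true
      Si′-rotated = trans (rotated-word-> O i≤l Si i<i′ i′≤l) Si′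
      j = i ∸ suc m
      j<i : j < i
      j<i = subst (_≤ i) (sym (suc-∸-suc m<i)) (ℕₚ.m∸n≤m i m)

    -- `adjacent-letters` makes the letters up to `i` all equal. Consequently only the last S of a
    -- word can have a T before it.
    prefix : ∀ (O : OpenPath E) {i i′} → i < i′ → i′ ≤ l → word O i ≡ true → word O i′ ≡ true →
      ∀ {m} → m ≤ i → word O m ≡ true
    prefix O {i} {i′} i<i′ i′≤l Si Si′ m≤i = down (ℕₚ.≤⇒≤′ m≤i) ℕₚ.≤-refl Si
      where
      down : ∀ {m k} → m ≤′ k → k ≤ i → word O k ≡ true → word O m ≡ true
      down ≤′-refl       _   Sk = Sk
      down (≤′-step m≤k) k<i Sk = down m≤k (ℕₚ.<⇒≤ k<i) (trans (adjacent-letters O i<i′ i′≤l Si Si′ k<i) Sk)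

    -- A later S would let `prefix` turn letter `k` into S. Rotating at `suc k` brings letter `k` to
    -- position 1, letter 0 to `suc k` and an S at `m` to `suc k ∸ m`; then `prefix` on the rotated
    -- path would again make letter `k` an S.
    isolated-return : ∀ (O : OpenPath E) {k} → suc k ≤ l → word O k ≡ false → word O (suc k) ≡ true →
      (∀ {j} → suc k < j → j ≤ l → word O j ≡ false) × (∀ {m} → 1 ≤ m → m ≤ k → word O m ≡ false)
    isolated-return O {k} k<l Sk Sk+1 = after , before
      where
      after : ∀ {j} → suc k < j → j ≤ l → word O j ≡ false
      after {j} k+1<j j≤l with word O j in eq
      ... | false = refl
      ... | true  = contradiction (trans (sym (prefix O k+1<j j≤l Sk+1 eq (ℕₚ.n≤1+n k))) Sk) λ ()
      O′ = rotated O k<l Sk+1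
      before : ∀ {m} → 1 ≤ m → m ≤ k → word O m ≡ false
      before {m} 1≤m m≤k with word O m in eq
      ... | false = refl
      ... | true  = contradiction
        (trans (sym (prefix O′ i<p k<l S′i S′p 1≤i)) (trans (rotated-word-≤ O k<l Sk+1 (s≤s z≤n)) Sk)) λ ()
        where
        i = suc k ∸ m
        i<p : i < suc k
        i<p = ℕₚ.∸-monoʳ-< 1≤m (ℕₚ.m≤n⇒m≤1+n m≤k)
        S′i : word O′ i ≡ true
        S′i = trans (rotated-word-≤ O k<l Sk+1 (ℕₚ.<⇒≤ i<p))
          (trans (cong (word O) (ℕₚ.m∸[m∸n]≡n (ℕₚ.m≤n⇒m≤1+n m≤k))) eq)
        S′p : word O′ (suc k) ≡ true
        S′p = trans (rotated-word-≤ O k<l Sk+1 ℕₚ.≤-refl) (trans (cong (word O) (ℕₚ.n∸n≡0 k)) (word-0 O))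
        1≤i : 1 ≤ i
        1≤i = ℕₚ.m<n⇒0<n∸m (s≤s m≤k)

-- The possible words and the block structure they impose

module Words where

  open HamiltonPaths
  open Rotations
  open import Data.Bool.Properties using (not-injective)
  open import Data.Nat.Base
  open import Data.Fin.Base using (toℕ)
  open import Data.Fin.Properties using (toℕ-injective; toℕ<n)
  open import Data.Sum.Base using ([_,_]′)
  open import Function.Base using (_∘_)
  open import Relation.Binary.Definitions using (tri<; tri≈; tri>)

  open Extremal
  open OpenPath

  prefix-length : ∀ l (S : ℕ → Bool) → S 0 ≡ true → S l ≡ false →
    (∀ {k} → k < l → S k ≡ false → S (suc k) ≡ false) →
    ∃[ s ] 1 ≤ s × s ≤ l × (∀ {j} → j < s → S j ≡ true) × (∀ {j} → s ≤ j → j ≤ l → S j ≡ false)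
  prefix-length zero    S S0 Sl mono = contradiction (trans (sym S0) Sl) λ ()
  prefix-length (suc l) S S0 Sl mono with S l in eq
  ... | false =
    let s , 1≤s , s≤l , below , above = prefix-length l S S0 eq (λ k<l → mono (ℕₚ.m<n⇒m<1+n k<l))
    in s , 1≤s , ℕₚ.m≤n⇒m≤1+n s≤l , below , λ s≤j j≤1+l → case-last s≤j above (ℕₚ.m≤n⇒m<n∨m≡n j≤1+l)
    where
    case-last : ∀ {s j} → s ≤ j → (∀ {j} → s ≤ j → j ≤ l → S j ≡ false) → j < suc l ⊎ j ≡ suc l → S j ≡ false
    case-last s≤j above (inj₁ j<1+l) = above s≤j (ℕₚ.≤-pred j<1+l)
    case-last s≤j above (inj₂ refl)  = Sl
  ... | true = suc l , s≤s z≤n , ℕₚ.≤-refl , (λ j<1+l → all-true (ℕₚ.≤-pred j<1+l)) ,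
    λ 1+l≤j j≤1+l → subst (λ j → S j ≡ false) (ℕₚ.≤-antisym 1+l≤j j≤1+l) Sl
    where
    stays-false : ∀ {j k} → j ≤′ k → k ≤ l → S j ≡ false → S k ≡ false
    stays-false ≤′-refl       _   Sj = Sj
    stays-false (≤′-step j≤k) k<l Sj = mono (ℕₚ.m≤n⇒m≤1+n k<l) (stays-false j≤k (ℕₚ.<⇒≤ k<l) Sj)
    all-true : ∀ {j} → j ≤ l → S j ≡ true
    all-true {j} j≤l with S j in Sj
    ... | true  = refl
    ... | false = contradiction (trans (sym eq) (stays-false (ℕₚ.≤⇒≤′ j≤l) ℕₚ.≤-refl Sj)) λ ()

  module _ {l} {E : Edges (suc l)} (ext : Extremal E) where

    -- Within an initial run of S, the row of `x i` copies the word to the right of `i` and the word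
    -- shifted by one to the left; at `i` itself there is the rung.
    block : ∀ (O : OpenPath E) {s} → s ≤ suc l → (∀ {j} → j < s → word O j ≡ true) →
      ∀ {i j} → i < s → j < s → E (O .x i) (O .y j) ≡ true
    block O s≤ S {i} {j} i<s j<s with ℕₚ.<-cmp i j
    ... | tri< i<j _ _ = trans (row-right ext O (ℕₚ.≤-pred (ℕₚ.<-≤-trans i<s s≤)) (S i<s) i<j (ℕₚ.≤-pred (ℕₚ.<-≤-trans j<s s≤))) (S j<s)
    ... | tri≈ _ refl _ = O .path .rung (ℕₚ.≤-pred (ℕₚ.<-≤-trans i<s s≤))
    ... | tri> _ _ j<i = trans (row-left ext O (ℕₚ.≤-pred (ℕₚ.<-≤-trans i<s s≤)) (S i<s) j<i) (S (ℕₚ.≤-<-trans j<i i<s))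

    -- The reversed path starts at `y l`, whose neighbourhood is the complement of the word by
    -- tightness.
    transpose-word : ∀ (O : OpenPath E) j → word (transpose-open O) j ≡ not (word O (l ∸ j))
    transpose-word O j = last-column ext O (ℕₚ.m∸n≤m l j)

    -- By `isolated-return` the word is ST...TST...T. On the transposed path it reads S...STS...ST,
    -- which has a return as well; `isolated-return` applied there leaves both runs of S with a
    -- single letter, so the word is STST.
    return⇒4 : ∀ (O : OpenPath E) {k} → k < l → word O k ≡ false → word O (suc k) ≡ true → l ≡ 3 × k ≡ 1
    return⇒4 O {zero} k<l Sk _ = contradiction (trans (sym (word-0 O)) Sk) λ ()
    return⇒4 O {suc k} k<l Sk Sk+1 = l≡3 , cong suc k≡0
      where
      k+2<l : suc (suc k) < l
      k+2<l = ℕₚ.≤∧≢⇒< k<l λ eq → contradiction (trans (sym Sk+1) (trans (cong (word O) eq) (O .apart))) λ ()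
      c = l ∸ suc (suc k)
      1+c≡ : suc c ≡ l ∸ suc k
      1+c≡ = suc-∸-suc k<l
      Oᵀ = transpose-open O
      Sᵀ-false : word Oᵀ c ≡ false
      Sᵀ-false = trans (transpose-word O c) (cong not (trans (cong (word O) (ℕₚ.m∸[m∸n]≡n k<l)) Sk+1))
      Sᵀ-true : word Oᵀ (suc c) ≡ true
      Sᵀ-true = trans (transpose-word O (suc c)) (cong not (trans (cong (word O)
        (trans (cong (l ∸_) 1+c≡) (ℕₚ.m∸[m∸n]≡n (ℕₚ.<⇒≤ k<l)))) Sk))
      direct = isolated-return ext O k<l Sk Sk+1
      dual = isolated-return (transpose-extremal ext) Oᵀ {c} (subst (_≤ l) (sym 1+c≡) (ℕₚ.m∸n≤m l (suc k))) Sᵀ-false Sᵀ-true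
      untranspose : ∀ {j} → j ≤ l → word Oᵀ (l ∸ j) ≡ false → word O j ≡ true
      untranspose {j} j≤l eq = not-injective (trans
        (sym (trans (transpose-word O (l ∸ j)) (cong (not ∘ word O) (ℕₚ.m∸[m∸n]≡n j≤l)))) eq)
      1≤l : 1 ≤ l
      1≤l = ℕₚ.≤-trans (s≤s z≤n) k<l
      k≡0 : k ≡ 0
      k≡0 with k ℕₚ.≟ 0
      ... | yes eq = eq
      ... | no k≢0 = contradiction
        (trans (sym (untranspose 1≤l (proj₁ dual 1+c< (ℕₚ.m∸n≤m l 1)))) (proj₂ direct ℕₚ.≤-refl (s≤s z≤n))) λ ()
        where
        1+c< : suc c < l ∸ 1
        1+c< = subst (_< l ∸ 1) (sym 1+c≡) (ℕₚ.∸-monoʳ-< (s≤s (ℕₚ.n≢0⇒n>0 k≢0)) (ℕₚ.<⇒≤ k<l))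
      c≤1 : c ≤ 1
      c≤1 with c ℕₚ.≤? 1
      ... | yes le = le
      ... | no ¬le = contradiction
        (trans (sym (untranspose (ℕₚ.m∸n≤m l 1) (subst (λ j → word Oᵀ j ≡ false) (sym (ℕₚ.m∸[m∸n]≡n 1≤l))
          (proj₂ dual ℕₚ.≤-refl (ℕₚ.<⇒≤ (ℕₚ.≰⇒> ¬le)))))) (proj₁ direct k+2<l-1 (ℕₚ.m∸n≤m l 1))) λ ()
        where
        k+4≤l : suc (suc k) + 2 ≤ l
        k+4≤l = subst (suc (suc k) + 2 ≤_) (ℕₚ.m+[n∸m]≡n k<l) (ℕₚ.+-monoʳ-≤ (suc (suc k)) (ℕₚ.≰⇒> ¬le))
        k+2<l-1 : suc (suc k) < l ∸ 1
        k+2<l-1 = subst (_≤ l ∸ 1) (cong (_∸ 1) (ℕₚ.+-comm (suc (suc k)) 2)) (ℕₚ.∸-monoˡ-≤ 1 k+4≤l)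
      l≡3 : l ≡ 3
      l≡3 = ℕₚ.≤-antisym
        (subst (_≤ 3) (ℕₚ.m+[n∸m]≡n k<l) (subst (λ k → suc (suc k) + c ≤ 3) (sym k≡0) (ℕₚ.+-monoʳ-≤ 2 c≤1)))
        (ℕₚ.≤-trans (s≤s (s≤s (s≤s z≤n))) k+2<l)

  -- The structure of a member of 𝓑: the edges between `xt` and `ys` are left free and form the
  -- arbitrary graph in its definition.
  record Blocks {n} (E : Edges n) (s t : ℕ) : Set where
    field
      size : s + t ≡ n
      xs   : Fin s → Fin n
      xt   : Fin t → Fin n
      ys   : Fin s → Fin n
      yt   : Fin t → Fin n
      xst-injective : ∀ {u v} → [ xs , xt ]′ u ≡ [ xs , xt ]′ v → u ≡ v
      yst-injective : ∀ {u v} → [ ys , yt ]′ u ≡ [ ys , yt ]′ v → u ≡ v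
      ss   : ∀ a b → E (xs a) (ys b) ≡ true
      st   : ∀ a b → E (xs a) (yt b) ≡ false
      tt   : ∀ a b → E (xt a) (yt b) ≡ true

  positions-injective : ∀ {l s t} {x : ℕ → Fin (suc l)} → s + t ≡ suc l →
    (∀ {i j} → i ≤ l → j ≤ l → x i ≡ x j → i ≡ j) →
    ∀ {u v : Fin s ⊎ Fin t} →
    [ (λ a → x (toℕ a)) , (λ b → x (s + toℕ b)) ]′ u ≡ [ (λ a → x (toℕ a)) , (λ b → x (s + toℕ b)) ]′ v → u ≡ v
  positions-injective {l} {s} {t} {x} s+t inj {u} {v} = go u v
    where
    lo : (a : Fin s) → toℕ a ≤ l
    lo a = ℕₚ.≤-pred (subst (suc (toℕ a) ≤_) s+t (ℕₚ.≤-trans (toℕ<n a) (ℕₚ.m≤m+n s t)))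
    hi : (b : Fin t) → s + toℕ b ≤ l
    hi b = ℕₚ.≤-pred (subst (suc (s + toℕ b) ≤_) s+t (ℕₚ.+-monoʳ-< s (toℕ<n b)))
    go : ∀ u v → [ (λ a → x (toℕ a)) , (λ b → x (s + toℕ b)) ]′ u ≡ [ (λ a → x (toℕ a)) , (λ b → x (s + toℕ b)) ]′ v → u ≡ v
    go (inj₁ a) (inj₁ b) eq = cong inj₁ (toℕ-injective (inj (lo a) (lo b) eq))
    go (inj₁ a) (inj₂ b) eq = contradiction (subst (_< s) (inj (lo a) (hi b) eq) (toℕ<n a)) (ℕₚ.m+n≮m s (toℕ b))
    go (inj₂ a) (inj₁ b) eq = contradiction (subst (_< s) (inj (lo b) (hi a) (sym eq)) (toℕ<n b)) (ℕₚ.m+n≮m s (toℕ a))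
    go (inj₂ a) (inj₂ b) eq = cong inj₂ (toℕ-injective (ℕₚ.+-cancelˡ-≡ s _ _ (inj (hi a) (hi b) eq)))

  Return : ∀ {l} {E : Edges (suc l)} → OpenPath E → ℕ → Set
  Return O k = word O k ≡ false × word O (suc k) ≡ true

  -- Without a return the word is a run of S followed by a run of T, and the path is cut where the
  -- letter changes. The block of the last positions is complete because the transposed word begins
  -- with their complemented T's.
  prefix⇒blocks : ∀ {l} {E : Edges (suc l)} → Extremal E → (O : OpenPath E) →
    (∀ {k} → k < l → ¬ Return O k) → ∃[ s ] ∃[ t ] 1 ≤ s × 1 ≤ t × Blocks E s t
  prefix⇒blocks {l} {E} ext O ¬return =
    let s , 1≤s , s≤l , S , T = prefix-length l (word O) (word-0 O) (O .apart) stays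
    in s , suc l ∸ s , 1≤s , ℕₚ.m<n⇒0<n∸m (s≤s s≤l) , blocks s (ℕₚ.m≤n⇒m≤1+n s≤l) S T
    where
    stays : ∀ {k} → k < l → word O k ≡ false → word O (suc k) ≡ false
    stays {k} k<l Sk with word O (suc k) in eq
    ... | false = refl
    ... | true  = contradiction (Sk , eq) (¬return k<l)
    module _ s (s≤ : s ≤ suc l) (S : ∀ {j} → j < s → word O j ≡ true) (T : ∀ {j} → s ≤ j → j ≤ l → word O j ≡ false) where
      t = suc l ∸ s
      s+t : s + t ≡ suc l
      s+t = ℕₚ.m+[n∸m]≡n s≤
      hi≤l : (b : Fin t) → s + toℕ b ≤ l
      hi≤l b = ℕₚ.≤-pred (subst (suc (s + toℕ b) ≤_) s+t (ℕₚ.+-monoʳ-< s (toℕ<n b)))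
      Sᵀ : ∀ {j} → j < t → word (transpose-open O) j ≡ true
      Sᵀ {j} j<t = trans (transpose-word ext O j) (cong not (T s≤l-j (ℕₚ.m∸n≤m l j)))
        where
        s≤l-j : s ≤ l ∸ j
        s≤l-j = subst (_≤ l ∸ j) (ℕₚ.m∸[m∸n]≡n s≤) (ℕₚ.∸-monoʳ-≤ (suc l) j<t)
      mirror : (b : Fin t) → l ∸ (s + toℕ b) < t
      mirror b = ℕₚ.≤-trans (s≤s (ℕₚ.∸-monoʳ-≤ l (ℕₚ.m≤m+n s (toℕ b))))
        (ℕₚ.≤-reflexive (sym (ℕₚ.+-∸-assoc 1 (ℕₚ.≤-trans (ℕₚ.m≤m+n s (toℕ b)) (hi≤l b)))))
      blocks : Blocks E s t
      blocks = record
        { size = s+t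
        ; xs = λ a → O .x (toℕ a)
        ; xt = λ b → O .x (s + toℕ b)
        ; ys = λ a → O .y (toℕ a)
        ; yt = λ b → O .y (s + toℕ b)
        ; xst-injective = λ {u} {v} → positions-injective {x = O .x} s+t (O .path .x-injective) {u} {v}
        ; yst-injective = λ {u} {v} → positions-injective {x = O .y} s+t (O .path .y-injective) {u} {v}
        ; ss = λ a b → block ext O s≤ S (toℕ<n a) (toℕ<n b)
        ; st = λ a b → trans (row-right ext O (ℕₚ.≤-pred (ℕₚ.<-≤-trans (toℕ<n a) s≤)) (S (toℕ<n a))
                   (ℕₚ.<-≤-trans (toℕ<n a) (ℕₚ.m≤m+n s (toℕ b))) (hi≤l b))
                 (T (ℕₚ.m≤m+n s (toℕ b)) (hi≤l b))
        ; tt = λ a b → subst₂ (λ i j → E (O .x i) (O .y j) ≡ true)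
                 (ℕₚ.m∸[m∸n]≡n (hi≤l a)) (ℕₚ.m∸[m∸n]≡n (hi≤l b))
                 (block (transpose-extremal ext) (transpose-open O) (ℕₚ.m∸n≤m (suc l) s) Sᵀ (mirror b) (mirror a))
        }

-- Isomorphisms onto members of 𝓑, and the cycle as a closed walk

module Isomorphisms where

  open HamiltonPaths
  open Rotations
  open Words
  open import Data.Nat.Base
  open import Data.Fin.Base using (toℕ; fromℕ; fromℕ<; inject₁; splitAt; join)
  open import Data.Fin.Properties using (toℕ-injective; toℕ<n; toℕ-fromℕ; toℕ-fromℕ<; toℕ-inject₁; splitAt-join; join-splitAt; +↔⊎)
  open import Data.Sum.Base using (swap; [_,_]′)
  open import Data.Sum.Properties using (swap-involutive; swap-↔; inj₁-injective; inj₂-injective)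
  open import Data.Sum.Function.Propositional using (_⊎-↔_)
  open import Function.Base using (_∘_)
  open import Function.Bundles using (_↔_; Inverse)
  open import Function.Properties.Inverse using (↔-sym; ↔-trans)

  open Inverse using (to; from; strictlyInverseˡ)

  ≅-sym : ∀ {M N} {G : Graph M} {H : Graph N} → G ≅ H → H ≅ G
  ≅-sym {G = G} {H} (φ , eq) = ↔-sym φ , λ u v →
    trans (sym (cong₂ (adj H) (strictlyInverseˡ φ u) (strictlyInverseˡ φ v))) (sym (eq (from φ u) (from φ v)))

  ≅-trans : ∀ {L M N} {F : Graph L} {G : Graph M} {H : Graph N} → F ≅ G → G ≅ H → F ≅ H
  ≅-trans (φ , p) (ψ , q) = ↔-trans φ ψ , λ u v → trans (p u v) (q (to φ u) (to φ v))

  toGraph-≅ : ∀ {a b c d} {G : BipartiteGraph a b} {H : BipartiteGraph c d} →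
    (f : (Fin a ⊎ Fin b) ↔ (Fin c ⊎ Fin d)) → (∀ u v → bipAdj G u v ≡ bipAdj H (to f u) (to f v)) →
    toGraph G ≅ toGraph H
  toGraph-≅ {a} {b} {c} {d} {G} {H} f eq = ↔-trans +↔⊎ (↔-trans f (↔-sym +↔⊎)) , λ u v →
    trans (eq (splitAt a u) (splitAt a v)) (sym (cong₂ (bipAdj H)
      (splitAt-join c d (to f (splitAt a u))) (splitAt-join c d (to f (splitAt a v)))))

  sides-≅ : ∀ {a b c d} {G : BipartiteGraph a b} {H : BipartiteGraph c d} →
    (f : Fin a ↔ Fin c) (g : Fin b ↔ Fin d) → (∀ x y → edge G x y ≡ edge H (to f x) (to g y)) →
    toGraph G ≅ toGraph H
  sides-≅ f g eq = toGraph-≅ (f ⊎-↔ g) λ where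
    (inj₁ _) (inj₁ _) → refl
    (inj₁ x) (inj₂ y) → eq x y
    (inj₂ y) (inj₁ x) → eq x y
    (inj₂ _) (inj₂ _) → refl

  transposed : ∀ {n} → BipartiteGraph n n → BipartiteGraph n n
  transposed G = mkBipartite (transpose (edge G))

  transposed-≅ : ∀ {n} (G : BipartiteGraph n n) → toGraph G ≅ toGraph (transposed G)
  transposed-≅ G = toGraph-≅ {G = G} {transposed G} swap-↔ λ where
    (inj₁ _) (inj₁ _) → refl
    (inj₁ _) (inj₂ _) → refl
    (inj₂ _) (inj₁ _) → refl
    (inj₂ _) (inj₂ _) → refl

  injective⇒↔′ : ∀ {m n} → m ≡ n → (f : Fin m → Fin n) → (∀ {i j} → f i ≡ f j → i ≡ j) →
    Σ[ φ ∈ (Fin m ↔ Fin n) ] (∀ i → to φ i ≡ f i)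
  injective⇒↔′ refl f inj = injective⇒↔ f inj , λ _ → refl

  splitAt-injective : ∀ m {n} {i j : Fin (m + n)} → splitAt m i ≡ splitAt m j → i ≡ j
  splitAt-injective m {n} {i} {j} eq =
    trans (sym (join-splitAt m n i)) (trans (cong (join m n) eq) (join-splitAt m n j))

  swap-injective : ∀ {A B : Set} {u v : A ⊎ B} → swap u ≡ swap v → u ≡ v
  swap-injective {u = u} {v} eq = trans (sym (swap-involutive u)) (trans (cong swap eq) (swap-involutive v))

  -- `xt` and `ys` play X₀ and Y₀; the vertices of `yt` are those attached to X₀, and those of `xs`
  -- are attached to Y₀.
  blocks⇒attach : ∀ {n s t} (G : BipartiteGraph n n) → Blocks (edge G) s t →
    Σ[ H ∈ BipartiteGraph t s ] toGraph G ≅ toGraph (attach H)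
  blocks⇒attach {n} {s} {t} G B = H , ≅-sym {G = toGraph (attach H)} {toGraph G} (sides-≅ {G = attach H} {G} (proj₁ φ) (proj₁ ψ) same)
    where
    open Blocks B
    H : BipartiteGraph t s
    H = mkBipartite λ a b → edge G (xt a) (ys b)
    f : Fin t ⊎ Fin s → Fin n
    f u = [ xs , xt ]′ (swap u)
    g : Fin s ⊎ Fin t → Fin n
    g = [ ys , yt ]′
    φ = injective⇒↔′ (trans (ℕₚ.+-comm t s) size) (f ∘ splitAt t)
          (λ eq → splitAt-injective t (swap-injective (xst-injective eq)))
    ψ = injective⇒↔′ size (g ∘ splitAt s) (λ eq → splitAt-injective s (yst-injective eq))
    attached : ∀ u v → attachEdge H u v ≡ edge G (f u) (g v)
    attached (inj₁ a) (inj₁ b) = refl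
    attached (inj₁ a) (inj₂ b) = sym (tt a b)
    attached (inj₂ a) (inj₁ b) = sym (ss a b)
    attached (inj₂ a) (inj₂ b) = sym (st a b)
    same : ∀ x y → edge (attach H) x y ≡ edge G (to (proj₁ φ) x) (to (proj₁ ψ) y)
    same x y = trans (attached (splitAt t x) (splitAt s y)) (sym (cong₂ (edge G) (proj₂ φ x) (proj₂ ψ y)))

  transpose-blocks : ∀ {n s t} {E : Edges n} → Blocks E s t → Blocks (transpose E) t s
  transpose-blocks {s = s} {t} B = record
    { size = trans (ℕₚ.+-comm t s) size
    ; xs = yt ; xt = ys ; ys = xt ; yt = xs
    ; xst-injective = λ {u} {v} eq → swap-injective (yst-injective (trans (flip′ u) (trans eq (sym (flip′ v)))))
    ; yst-injective = λ {u} {v} eq → swap-injective (xst-injective (trans (flip″ u) (trans eq (sym (flip″ v)))))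
    ; ss = λ a b → tt b a
    ; st = λ a b → st b a
    ; tt = λ a b → ss b a
    }
    where
    open Blocks B
    flip′ : ∀ u → [ ys , yt ]′ (swap u) ≡ [ yt , ys ]′ u
    flip′ (inj₁ _) = refl
    flip′ (inj₂ _) = refl
    flip″ : ∀ u → [ xs , xt ]′ (swap u) ≡ [ xt , xs ]′ u
    flip″ (inj₁ _) = refl
    flip″ (inj₂ _) = refl

  smaller-half : ∀ s t → s ≤ t → s ≤ ⌊ s + t /2⌋
  smaller-half s t s≤t = subst (_≤ ⌊ s + t /2⌋) (⌊k+k/2⌋ s) (ℕₚ.⌊n/2⌋-mono (ℕₚ.+-monoʳ-≤ s s≤t))
    where
    ⌊k+k/2⌋ : ∀ k → ⌊ k + k /2⌋ ≡ k
    ⌊k+k/2⌋ zero    = refl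
    ⌊k+k/2⌋ (suc k) = trans (cong (λ m → ⌊ suc m /2⌋) (ℕₚ.+-suc k k)) (cong suc (⌊k+k/2⌋ k))

  -- The parameter is the smaller block size, to stay within n/2. `blocks⇒attach` produces the
  -- parameter `t`; when `s` is the smaller one, the two sides are exchanged beforehand.
  blocks⇒In𝓑 : ∀ {n s t} (G : BipartiteGraph n n) → 1 ≤ s → 1 ≤ t → Blocks (edge G) s t →
    ∃[ k ] (1 ≤ k × k ≤ ⌊ n /2⌋ × In𝓑 n k (toGraph G))
  blocks⇒In𝓑 {n} {s} {t} G 1≤s 1≤t B with ℕₚ.≤-total t s
  ... | inj₁ t≤s = t , 1≤t , subst (λ m → t ≤ ⌊ m /2⌋) (trans (ℕₚ.+-comm t s) size) (smaller-half t s t≤s)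
    , subst (λ m → Σ[ H ∈ BipartiteGraph t m ] toGraph G ≅ toGraph (attach H)) s≡ (blocks⇒attach G B)
    where
    open Blocks B using (size)
    s≡ : s ≡ n ∸ t
    s≡ = trans (sym (ℕₚ.m+n∸n≡m s t)) (cong (_∸ t) size)
  ... | inj₂ s≤t = s , 1≤s , subst (λ m → s ≤ ⌊ m /2⌋) size (smaller-half s t s≤t)
    , subst (λ m → Σ[ H ∈ BipartiteGraph s m ] toGraph G ≅ toGraph (attach H)) t≡ attached
    where
    open Blocks B using (size)
    t≡ : t ≡ n ∸ s
    t≡ = trans (sym (ℕₚ.m+n∸m≡n s t)) (cong (_∸ s) size)
    attached : Σ[ H ∈ BipartiteGraph s t ] toGraph G ≅ toGraph (attach H)
    attached = let H , iso = blocks⇒attach (transposed G) (transpose-blocks B)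
      in H , ≅-trans {F = toGraph G} {toGraph (transposed G)} {toGraph (attach H)} (transposed-≅ G) iso

  walk : ∀ {A : Set} → (ℕ → A) → (ℕ → A) → ℕ → ℕ → A ⊎ A
  walk x y k zero          = inj₁ (x k)
  walk x y k (suc zero)    = inj₂ (y k)
  walk x y k (suc (suc m)) = walk x y (suc k) m

  data Parity : ℕ → Set where
    even : ∀ j → Parity (j + j)
    odd  : ∀ j → Parity (suc (j + j))

  evenOrOdd : ∀ m → Parity m
  evenOrOdd zero    = even 0
  evenOrOdd (suc m) with evenOrOdd m
  ... | even j = odd j
  ... | odd j  = subst Parity (cong suc (ℕₚ.+-suc j j)) (even (suc j))

  walk-even : ∀ {A : Set} (x y : ℕ → A) k j → walk x y k (j + j) ≡ inj₁ (x (k + j))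
  walk-even x y k zero    = cong (inj₁ ∘ x) (sym (ℕₚ.+-identityʳ k))
  walk-even x y k (suc j) rewrite ℕₚ.+-suc j j | ℕₚ.+-suc k j = walk-even x y (suc k) j

  walk-odd : ∀ {A : Set} (x y : ℕ → A) k j → walk x y k (suc (j + j)) ≡ inj₂ (y (k + j))
  walk-odd x y k zero    = cong (inj₂ ∘ y) (sym (ℕₚ.+-identityʳ k))
  walk-odd x y k (suc j) rewrite ℕₚ.+-suc j j | ℕₚ.+-suc k j = walk-odd x y (suc k) j

  halve-≤ : ∀ j l → j + j ≤ suc (l + l) → j ≤ l
  halve-≤ j l le with j ℕₚ.≤? l
  ... | yes j≤l = j≤l
  ... | no j≰l  = contradiction (ℕₚ.≤-trans (ℕₚ.+-mono-≤ (ℕₚ.≰⇒> j≰l) (ℕₚ.≰⇒> j≰l)) le)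
    (ℕₚ.<⇒≱ (ℕₚ.≤-reflexive (cong suc (sym (ℕₚ.+-suc l l)))))

  -- Position 2j of the closed walk carries `x j` and position 2j+1 carries `y j`, so each claim
  -- splits by parity into claims about the two sequences.
  hamiltonian : ∀ {l} (G : BipartiteGraph (suc l) (suc l)) → 1 ≤ l → HamiltonCycle (edge G) →
    Hamiltonian (toGraph G)
  hamiltonian {l} G 1≤l (x , y , C) = cycle , covers
    where
    n = suc l
    ℓ = l + suc l
    ℓ≡ : ℓ ≡ suc (l + l)
    ℓ≡ = ℕₚ.+-suc l l
    P = C .isPath
    w : ℕ → Fin n ⊎ Fin n
    w = walk x y 0
    w-even : ∀ j → w (j + j) ≡ inj₁ (x j)
    w-even = walk-even x y 0
    w-odd : ∀ j → w (suc (j + j)) ≡ inj₂ (y j)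
    w-odd = walk-odd x y 0
    vertex : Fin (suc ℓ) → Fin (n + n)
    vertex i = join n n (w (toℕ i))
    split-vertex : ∀ u → splitAt n (join n n u) ≡ u
    split-vertex = splitAt-join n n
    even≤ : ∀ {j} → j + j ≤ ℓ → j ≤ l
    even≤ {j} le = halve-≤ j l (subst (j + j ≤_) ℓ≡ le)
    odd≤ : ∀ {j} → suc (j + j) ≤ ℓ → j ≤ l
    odd≤ le = even≤ (ℕₚ.<⇒≤ le)
    w-injective : ∀ {a b} → a ≤ ℓ → b ≤ ℓ → w a ≡ w b → a ≡ b
    w-injective {a} {b} a≤ b≤ eq with evenOrOdd a | evenOrOdd b
    ... | even i | even j = cong (λ k → k + k) (P .x-injective (even≤ a≤) (even≤ b≤)
            (inj₁-injective (trans (sym (w-even i)) (trans eq (w-even j)))))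
    ... | odd i  | odd j  = cong (λ k → suc (k + k)) (P .y-injective (odd≤ a≤) (odd≤ b≤)
            (inj₂-injective (trans (sym (w-odd i)) (trans eq (w-odd j)))))
    ... | even i | odd j  = contradiction (trans (sym (w-even i)) (trans eq (w-odd j))) λ ()
    ... | odd i  | even j = contradiction (trans (sym (w-odd i)) (trans eq (w-even j))) λ ()
    w-step : ∀ m → suc m ≤ ℓ → bipAdj G (w m) (w (suc m)) ≡ true
    w-step m le with evenOrOdd m
    ... | even j rewrite w-even j | w-odd j = P .rung (odd≤ le)
    ... | odd j rewrite w-odd j = subst (λ u → bipAdj G (inj₂ (y j)) u ≡ true)
            (sym (trans (cong (λ m → w (suc m)) (sym (ℕₚ.+-suc j j))) (w-even (suc j))))
            (P .next (even≤ (subst (_≤ ℓ) (cong suc (sym (ℕₚ.+-suc j j))) le)))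
    adj-join : ∀ u v → adj (toGraph G) (join n n u) (join n n v) ≡ bipAdj G u v
    adj-join u v = cong₂ (bipAdj G) (split-vertex u) (split-vertex v)
    cycle : Cycle (toGraph G)
    cycle = record
      { ℓ        = ℓ
      ; long     = s≤s (ℕₚ.+-mono-≤ 1≤l (s≤s z≤n))
      ; vertex   = vertex
      ; distinct = λ i j eq → toℕ-injective (w-injective (ℕₚ.≤-pred (toℕ<n i)) (ℕₚ.≤-pred (toℕ<n j))
          (trans (sym (split-vertex (w (toℕ i)))) (trans (cong (splitAt n) eq) (split-vertex (w (toℕ j))))))
      ; step     = λ i → trans (adj-join (w (toℕ (inject₁ i))) (w (suc (toℕ i))))
          (subst (λ m → bipAdj G (w m) (w (suc (toℕ i))) ≡ true) (sym (toℕ-inject₁ i)) (w-step (toℕ i) (toℕ<n i)))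
      ; close    = trans (adj-join (w (toℕ (fromℕ ℓ))) (inj₁ (x 0)))
          (subst (λ u → bipAdj G u (inj₁ (x 0)) ≡ true)
            (sym (trans (cong w (trans (toℕ-fromℕ ℓ) ℓ≡)) (w-odd l))) (C .closing))
      }
    covers-split : ∀ u → ∃[ m ] m ≤ ℓ × w m ≡ u
    covers-split (inj₁ u) = let k , k≤l , eq = positions-surjective (P .x-injective) u
      in k + k , ℕₚ.+-mono-≤ k≤l (ℕₚ.m≤n⇒m≤1+n k≤l) , trans (w-even k) (cong inj₁ eq)
    covers-split (inj₂ v) = let k , k≤l , eq = positions-surjective (P .y-injective) v
      in suc (k + k) , subst (suc (k + k) ≤_) (sym ℓ≡) (s≤s (ℕₚ.+-mono-≤ k≤l k≤l)) , trans (w-odd k) (cong inj₂ eq)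
    covers : ∀ v → ∃[ i ] vertex i ≡ v
    covers v = let m , m≤ℓ , eq = covers-split (splitAt n v)
      in fromℕ< (s≤s m≤ℓ) , trans (cong (join n n) (trans (cong w (toℕ-fromℕ< (s≤s m≤ℓ))) eq)) (join-splitAt n n v)

-- The extremal supergraph, the exceptional graphs and the conclusion

module Assembly where

  open HamiltonPaths
  open DegreeSums using (⟦_⟧; degX; degY; module ∑ℕ; SpectralBound; complement; module TightEdges)
  open Saturation using (maximal-nonhamiltonian; complete-cycle)
  open Rotations
  open Words
  open Isomorphisms
  open import Data.Bool.Properties using (not-injective) renaming (_≟_ to _≟B_)
  open import Data.Nat.Base
  open import Data.Fin.Properties using (any?) renaming (_≟_ to _≟F_)
  open import Function.Bundles using (_↔_)
  open import Relation.Nullary.Decidable using (_×-dec_; ⌊_⌋)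

  open Extremal
  open OpenPath

  degX-complement : ∀ {n} (E : Edges n) u → degX (complement E) u + degX E u ≡ n
  degX-complement {n} E u = trans (sym (∑ℕ.∑-distrib-+ (λ v → ⟦ not (E u v) ⟧) (λ v → ⟦ E u v ⟧)))
    (trans (∑ℕ.sum-cong-≗ (λ v → one (E u v))) (sum-ones n))
    where
    one : ∀ b → ⟦ not b ⟧ + ⟦ b ⟧ ≡ 1
    one true  = refl
    one false = refl

  degree-sum-complement : ∀ {n} (E : Edges n) u v →
    (degX (complement E) u + degY (complement E) v) + (degX E u + degY E v) ≡ n + n
  degree-sum-complement E u v = trans
    (interchange (degX (complement E) u) (degY (complement E) v) (degX E u) (degY E v))
    (cong₂ _+_ (degX-complement E u) (degX-complement (transpose E) v))
    where
    interchange : ∀ a b c d → (a + b) + (c + d) ≡ (a + c) + (b + d)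
    interchange a b c d = trans (ℕₚ.+-assoc a b (c + d)) (trans
      (cong (a +_) (trans (sym (ℕₚ.+-assoc b c d)) (trans (cong (_+ d) (ℕₚ.+-comm b c)) (ℕₚ.+-assoc c b d))))
      (sym (ℕₚ.+-assoc a c (b + d))))

  term≤sumℕ : ∀ {n} (f : Fin n → ℕ) i → f i ≤ sumℕ f
  term≤sumℕ f zero    = ℕₚ.m≤m+n (f zero) _
  term≤sumℕ f (suc i) = ℕₚ.≤-trans (term≤sumℕ (λ j → f (suc j)) i) (ℕₚ.m≤n+m _ (f zero))

  degX≡0 : ∀ {n} (E : Edges n) {u} → degX E u ≡ 0 → ∀ v → E u v ≡ false
  degX≡0 E {u} deg≡0 v = decode (E u v) (subst (⟦ E u v ⟧ ≤_) deg≡0 (term≤sumℕ (λ v → ⟦ E u v ⟧) v))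
    where
    decode : ∀ b → ⟦ b ⟧ ≤ 0 → b ≡ false
    decode false _ = refl

  -- What `extra-edge-isolated` says in terms of E: both ends of an added edge are adjacent to the
  -- whole opposite side.
  Rigid : ∀ {n} → Edges n → Edges n → Set
  Rigid G E = G ⊑ E × (∀ u v → E u v ≡ true → G u v ≡ false →
    (∀ v′ → E u v′ ≡ true) × (∀ u′ → E u′ v ≡ true))

  extremal-supergraph : ∀ {l} → 1 ≤ l → (G : Edges (suc l)) → SpectralBound (complement G) →
    ¬ HamiltonCycle G → ∃[ E ] Extremal E × Rigid G E × OpenPath E
  extremal-supergraph {l} 1≤l G bound ¬ham = build (maximal-nonhamiltonian 1≤l G ¬ham)
    where
    n = suc l
    build : ∃[ E ] G ⊑ E × ¬ HamiltonCycle E ×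
        (∀ {a b} → E a b ≡ false → ∃[ x ] ∃[ y ] IsPath E x y × x 0 ≡ a × y l ≡ b) →
      ∃[ E ] Extremal E × Rigid G E × OpenPath E
    build (E , G⊑E , ¬hamE , path-between) = E , record { nonhamiltonian = ¬hamE ; tight = tight′ } , (G⊑E , rigid) , open-path
      where
      F : Edges n
      F = complement E
      Ĝ : Edges n
      Ĝ = complement G
      F⊑Ĝ : F ⊑ Ĝ
      F⊑Ĝ u v Fuv with G u v in eq
      ... | false = refl
      ... | true  = contradiction (trans (sym (G⊑E u v eq)) (not-injective Fuv)) λ ()
      degrees≤ : ∀ u v → E u v ≡ false → degX E u + degY E v ≤ n
      degrees≤ u v e = let x , y , P , x0≡u , yl≡v = path-between e
        in subst₂ (λ a b → degX E a + degY E b ≤ n) x0≡u yl≡v (end-degrees≤ ¬hamE P)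
      large : ∀ u v → F u v ≡ true → n ≤ degX F u + degY F v
      large u v Fuv = ℕₚ.+-cancelʳ-≤ n n (degX F u + degY F v)
        (ℕₚ.≤-trans (ℕₚ.≤-reflexive (sym (degree-sum-complement E u v)))
          (ℕₚ.+-monoʳ-≤ (degX F u + degY F v) (degrees≤ u v (not-injective Fuv))))
      open TightEdges (s≤s 1≤l) F Ĝ F⊑Ĝ large bound
      tight′ : ∀ u v → E u v ≡ false → degX E u + degY E v ≡ n
      tight′ u v e = ℕₚ.+-cancelˡ-≡ n (degX E u + degY E v) n
        (trans (cong (_+ (degX E u + degY E v)) (sym (degree-sum-tight u v (cong not e)))) (degree-sum-complement E u v))
      rigid : ∀ u v → E u v ≡ true → G u v ≡ false → (∀ v′ → E u v′ ≡ true) × (∀ u′ → E u′ v ≡ true)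
      rigid u v e g =
        let du , dv = extra-edge-isolated u v (cong not e) (cong not g)
        in (λ v′ → not-injective (degX≡0 F du v′)) , (λ u′ → not-injective (degX≡0 (transpose F) dv u′))
      open-path : OpenPath E
      open-path with any? (λ u → any? (λ v → E u v ≟B false))
      ... | yes (u , v , e) = let x , y , P , x0≡u , yl≡v = path-between e
        in record { x = x ; y = y ; path = P ; apart = trans (cong₂ E x0≡u yl≡v) e }
      ... | no none = contradiction (complete-cycle E full) ¬hamE
        where
        full : ∀ u v → E u v ≡ true
        full u v with E u v in eq
        ... | true  = refl
        ... | false = contradiction (u , v , eq) none

  module _ {n} {G E : Edges n} (R : Rigid G E) where

    rigid-false : ∀ {u v} → E u v ≡ false → G u v ≡ false
    rigid-false {u} {v} e with G u v in eq
    ... | false = refl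
    ... | true  = contradiction (trans (sym (proj₁ R u v eq)) e) λ ()

    rigid-row : ∀ {u v v′} → E u v′ ≡ false → E u v ≡ true → G u v ≡ true
    rigid-row {u} {v} {v′} e′ e with G u v in eq
    ... | true  = refl
    ... | false = contradiction (trans (sym (proj₁ (proj₂ R u v e eq) v′)) e′) λ ()

    rigid-column : ∀ {u v u′} → E u′ v ≡ false → E u v ≡ true → G u v ≡ true
    rigid-column {u} {v} {u′} e′ e with G u v in eq
    ... | true  = refl
    ... | false = contradiction (trans (sym (proj₂ (proj₂ R u v e eq) u′)) e′) λ ()

    -- Each vertex of `xs` misses some vertex of `yt` and conversely, so none of them is full and
    -- their edges survive in G. Edges can be lost only between `xt` and `ys`, where nothing is
    -- prescribed.
    rigid-blocks : ∀ {s t} → 1 ≤ s → 1 ≤ t → Blocks E s t → Blocks G s t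
    rigid-blocks {suc s} {suc t} _ _ B = record
      { size = size ; xs = xs ; xt = xt ; ys = ys ; yt = yt
      ; xst-injective = xst-injective ; yst-injective = yst-injective
      ; ss = λ a b → rigid-row (st a zero) (ss a b)
      ; st = λ a b → rigid-false (st a b)
      ; tt = λ a b → rigid-column (st zero b) (tt a b)
      }
      where open Blocks B

  -- The positions on the path of t₁, …, t₄ and of b₁, …, b₄.
  tops bottoms : Fin 4 → ℕ
  tops zero                   = 1
  tops (suc zero)             = 0
  tops (suc (suc zero))       = 2
  tops (suc (suc (suc zero))) = 3
  bottoms zero                   = 2
  bottoms (suc zero)             = 0
  bottoms (suc (suc zero))       = 1
  bottoms (suc (suc (suc zero))) = 3

  -- The sum of a row and a column of a 4 by 4 adjacency table, bracketed as `sumℕ` unfolds on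
  -- `Fin 4`, so that tightness applies to it by computation.
  crossSum : (a b c d a′ b′ c′ d′ : Bool) → ℕ
  crossSum a b c d a′ b′ c′ d′ =
    (⟦ a ⟧ + (⟦ b ⟧ + (⟦ c ⟧ + (⟦ d ⟧ + 0)))) + (⟦ a′ ⟧ + (⟦ b′ ⟧ + (⟦ c′ ⟧ + (⟦ d′ ⟧ + 0))))

  crossSum-false₁ : ∀ {a b c d a′ b′ c′ d′} →
    a ≡ true → b ≡ false → c ≡ true → d ≡ false → a′ ≡ false → b′ ≡ true → c′ ≡ true →
    crossSum a b c d a′ b′ c′ d′ ≡ 4 → d′ ≡ false
  crossSum-false₁ {d′ = false} _ _ _ _ _ _ _ _ = refl
  crossSum-false₁ {d′ = true} refl refl refl refl refl refl refl ()

  crossSum-false₂ : ∀ {a b c d a′ b′ c′ d′} →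
    a ≡ false → b ≡ true → c ≡ true → d ≡ false → a′ ≡ true → b′ ≡ true → c′ ≡ false →
    crossSum a b c d a′ b′ c′ d′ ≡ 4 → d′ ≡ false
  crossSum-false₂ {d′ = false} _ _ _ _ _ _ _ _ = refl
  crossSum-false₂ {d′ = true} refl refl refl refl refl refl refl ()

  crossSum-≢4 : ∀ {a b c d a′ b′ c′ d′} →
    a ≡ true → b ≡ true → c ≡ false → d ≡ true → a′ ≡ true → b′ ≡ false → c′ ≡ true → d′ ≡ true →
    crossSum a b c d a′ b′ c′ d′ ≢ 4
  crossSum-≢4 refl refl refl refl refl refl refl refl ()

  tops-injective : ∀ i j → tops i ≡ tops j → i ≡ j
  tops-injective i j eq = trans (sym (inverse i)) (trans (cong position eq) (inverse j))
    where
    position : ℕ → Fin 4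
    position 0 = suc zero
    position 1 = zero
    position 2 = suc (suc zero)
    position _ = suc (suc (suc zero))
    inverse : ∀ i → position (tops i) ≡ i
    inverse zero                   = refl
    inverse (suc zero)             = refl
    inverse (suc (suc zero))       = refl
    inverse (suc (suc (suc zero))) = refl

  bottoms-injective : ∀ i j → bottoms i ≡ bottoms j → i ≡ j
  bottoms-injective i j eq = trans (sym (inverse i)) (trans (cong position eq) (inverse j))
    where
    position : ℕ → Fin 4
    position 0 = suc zero
    position 1 = suc (suc zero)
    position 2 = zero
    position _ = suc (suc (suc zero))
    inverse : ∀ i → position (bottoms i) ≡ i
    inverse zero                   = refl
    inverse (suc zero)             = refl
    inverse (suc (suc zero))       = refl
    inverse (suc (suc (suc zero))) = refl

  tops≤3 : ∀ i → tops i ≤ 3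
  tops≤3 zero                   = s≤s z≤n
  tops≤3 (suc zero)             = z≤n
  tops≤3 (suc (suc zero))       = s≤s (s≤s z≤n)
  tops≤3 (suc (suc (suc zero))) = ℕₚ.≤-refl

  bottoms≤3 : ∀ i → bottoms i ≤ 3
  bottoms≤3 zero                   = s≤s (s≤s z≤n)
  bottoms≤3 (suc zero)             = z≤n
  bottoms≤3 (suc (suc zero))       = s≤s z≤n
  bottoms≤3 (suc (suc (suc zero))) = ℕₚ.≤-refl

  module _ {G : BipartiteGraph 4 4} {E : Edges 4} (ext : Extremal E) (R : Rigid (edge G) E)
    (O : OpenPath E) (S1 : word O 1 ≡ false) (S2 : word O 2 ≡ true) where

    private
      e : ℕ → ℕ → Bool
      e i j = E (O .x i) (O .y j)

      2≤3 : 2 ≤ 3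
      2≤3 = s≤s (s≤s z≤n)

      e00 : e 0 0 ≡ true
      e00 = word-0 O
      e03 : e 0 3 ≡ false
      e03 = O .apart
      e10 : e 1 0 ≡ true
      e10 = O .path .next (s≤s z≤n)
      e11 : e 1 1 ≡ true
      e11 = O .path .rung (s≤s z≤n)
      e13 : e 1 3 ≡ true
      e13 = trans (last-column ext O (s≤s z≤n)) (cong not S1)
      e20 : e 2 0 ≡ false
      e20 = trans (row-left ext O 2≤3 S2 (s≤s z≤n)) S1
      e21 : e 2 1 ≡ true
      e21 = trans (row-left ext O 2≤3 S2 (s≤s (s≤s z≤n))) S2
      e22 : e 2 2 ≡ true
      e22 = O .path .rung 2≤3
      e23 : e 2 3 ≡ false
      e23 = trans (last-column ext O 2≤3) (cong not S2)
      e32 : e 3 2 ≡ true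
      e32 = O .path .next (s≤s (s≤s (s≤s z≤n)))
      e33 : e 3 3 ≡ true
      e33 = O .path .rung ℕₚ.≤-refl

      tight-positions : ∀ i j → e i j ≡ false →
        crossSum (e i 0) (e i 1) (e i 2) (e i 3) (e 0 j) (e 1 j) (e 2 j) (e 3 j) ≡ 4
      tight-positions i j eij = trans
        (sym (cong₂ _+_ (sum-positions (O .path .y-injective) (λ v → ⟦ E (O .x i) v ⟧))
                        (sum-positions (O .path .x-injective) (λ u → ⟦ E u (O .y j) ⟧))))
        (ext .tight (O .x i) (O .y j) eij)

      -- Path edges, word and rotations fix thirteen of the sixteen entries. The others come from
      -- degree sum 4 at non-adjacent pairs: the pairs (0,1) and (2,0) leave no room for `e 3 1` and
      -- `e 3 0`, and a missing `e 1 2` would have degree sum 6.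
      e31 : e 3 1 ≡ false
      e31 = crossSum-false₁ e00 S1 S2 e03 S1 e11 e21 (tight-positions 0 1 S1)
      e30 : e 3 0 ≡ false
      e30 = crossSum-false₂ e20 e21 e22 e23 e00 e10 e20 (tight-positions 2 0 e20)
      e12 : e 1 2 ≡ true
      e12 with e 1 2 in eq
      ... | true  = refl
      ... | false = contradiction (tight-positions 1 2 eq) (crossSum-≢4 e10 e11 eq e13 S2 eq e22 e32)

      f g : Fin 4 → Fin 4
      f i = O .x (tops i)
      g i = O .y (bottoms i)

      φ ψ : Fin 4 ↔ Fin 4
      φ = injective⇒↔ f (λ {i} {j} eq → tops-injective i j (O .path .x-injective (tops≤3 i) (tops≤3 j) eq))
      ψ = injective⇒↔ g (λ {i} {j} eq → bottoms-injective i j (O .path .y-injective (bottoms≤3 i) (bottoms≤3 j) eq))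

      top-row : ∀ j → edge G (f zero) (g (suc j)) ≡ true
      top-row zero             = rigid-column R e20 e10
      top-row (suc zero)       = rigid-column R S1 e11
      top-row (suc (suc zero)) = rigid-column R e03 e13

      left-column : ∀ i → edge G (f (suc i)) (g zero) ≡ true
      left-column zero             = rigid-row R S1 S2
      left-column (suc zero)       = rigid-row R e20 e22
      left-column (suc (suc zero)) = rigid-row R e30 e32

      core : ∀ i j → edge G (f (suc i)) (g (suc j)) ≡ ⌊ i ≟F j ⌋
      core zero             zero             = rigid-row R S1 e00
      core zero             (suc zero)       = rigid-false R S1
      core zero             (suc (suc zero)) = rigid-false R e03
      core (suc zero)       zero             = rigid-false R e20
      core (suc zero)       (suc zero)       = rigid-row R e20 e21
      core (suc zero)       (suc (suc zero)) = rigid-false R e23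
      core (suc (suc zero)) zero             = rigid-false R e30
      core (suc (suc zero)) (suc zero)       = rigid-false R e31
      core (suc (suc zero)) (suc (suc zero)) = rigid-row R e30 e33

    four-vertices : (toGraph G ≅ toGraph Γ₁) ⊎ (toGraph G ≅ toGraph Γ₂)
    -- t₁ and b₁ are the only full vertices of E, so theirs is the only edge of E that may be absent
    -- from G.
    four-vertices = by-corner (edge G (f zero) (g zero)) refl
      where
      by-corner : ∀ b → edge G (f zero) (g zero) ≡ b → (toGraph G ≅ toGraph Γ₁) ⊎ (toGraph G ≅ toGraph Γ₂)
      by-corner false corner = inj₁ (≅-sym {G = toGraph Γ₁} {toGraph G} (sides-≅ {G = Γ₁} {G} φ ψ λ where
        zero    zero    → sym corner
        zero    (suc j) → sym (top-row j)
        (suc i) zero    → sym (left-column i)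
        (suc i) (suc j) → sym (core i j)))
      by-corner true corner = inj₂ (≅-sym {G = toGraph Γ₂} {toGraph G} (sides-≅ {G = Γ₂} {G} φ ψ λ where
        zero    zero    → sym corner
        zero    (suc j) → sym (top-row j)
        (suc i) zero    → sym (left-column i)
        (suc i) (suc j) → sym (core i j)))

  Conclusion : ∀ {n} → BipartiteGraph n n → Set
  Conclusion {n} G =
    Hamiltonian (toGraph G)
    ⊎ (∃[ k ] (1 ≤ k × k ≤ ⌊ n /2⌋ × In𝓑 n k (toGraph G)))
    ⊎ (n ≡ 4 × (toGraph G ≅ toGraph Γ₁ ⊎ toGraph G ≅ toGraph Γ₂))

  return⇒conclusion : ∀ {l k} (G : BipartiteGraph (suc l) (suc l)) {E : Edges (suc l)} →
    Extremal E → Rigid (edge G) E → (O : OpenPath E) → Return O k → l ≡ 3 → k ≡ 1 → Conclusion G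
  return⇒conclusion G ext R O (Sk , Sk+1) refl refl = inj₂ (inj₂ (refl , four-vertices ext R O Sk Sk+1))

  extremal⇒conclusion : ∀ {l} (G : BipartiteGraph (suc l) (suc l)) {E : Edges (suc l)} →
    Extremal E → Rigid (edge G) E → (O : OpenPath E) → Dec (∃[ k ] k < l × Return O k) → Conclusion G
  extremal⇒conclusion G ext R O (no ¬return) =
    let s , t , 1≤s , 1≤t , B = prefix⇒blocks ext O (λ k<l r → ¬return (_ , k<l , r))
    in inj₂ (inj₁ (blocks⇒In𝓑 G 1≤s 1≤t (rigid-blocks R 1≤s 1≤t B)))
  extremal⇒conclusion G ext R O (yes (k , k<l , Sk , Sk+1)) =
    let l≡3 , k≡1 = return⇒4 ext O k<l Sk Sk+1
    in return⇒conclusion G ext R O (Sk , Sk+1) l≡3 k≡1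

  spectral⇒conclusion : ∀ {l} → 1 ≤ l → (G : BipartiteGraph (suc l) (suc l)) →
    SpectralBound (complement (edge G)) → Dec (HamiltonCycle (edge G)) → Conclusion G
  spectral⇒conclusion 1≤l G bound (yes ham) = inj₁ (hamiltonian G 1≤l ham)
  spectral⇒conclusion {l} 1≤l G bound (no ¬ham) =
    let E , ext , R , O = extremal-supergraph 1≤l (edge G) bound ¬ham
    in extremal⇒conclusion G ext R O
         (ℕₚ.anyUpTo? (λ k → (word O k ≟B false) ×-dec (word O (suc k) ≟B true)) l)

open DegreeSums using (spectral-bound)
open Saturation using (hamiltonCycle?)
open Assembly using (spectral⇒conclusion)

theorem1p11 : (n : ℕ) → 2 ≤ n →
    (G : BipartiteGraph n n) →
    (q : ℝ) → IsSignlessSpectralRadius (toGraph (quasiComplement G)) q →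
    q ≤ℝ fromℕℝ n →
    Hamiltonian (toGraph G)
    ⊎ (∃[ k ] (1 ≤ k × k ≤ ⌊ n /2⌋ × In𝓑 n k (toGraph G)))
    ⊎ (n ≡ 4 × (toGraph G ≅ toGraph Γ₁ ⊎ toGraph G ≅ toGraph Γ₂))
theorem1p11 (suc l) (s≤s 1≤l) G q radius q≤n =
  spectral⇒conclusion 1≤l G (spectral-bound G q radius q≤n) (hamiltonCycle? (edge G))
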